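{- $\mathsf{P}\neq \mathrm{DAGR}(\mathsf{P})$ if and only if $\mathsf{P}\neq\mathsf{NP}$.
   Context: For a language $L\subseteq\Sigma^*$, $\mathrm{DAGREACH}(L)$ is the set of triples $(G,s,t)$ where $G$ is a directed acyclic graph with edges labelled by symbols of $\Sigma$ and $s,t$ are vertices, such that some path from $s$ to $t$ has yield (concatenation of edge labels in order) in $L$. For a complexity class $\mathcal{C}$, $\mathrm{DAGR}(\mathcal{C})=\{L : \mathrm{DAGREACH}(L)\in\mathcal{C}\}$. -}

module Defs where

open import Data.Nat using (ℕ; zero; suc; _+_; _*_; _^_; _≤_)
open import Data.Fin using (Fin; zero; suc; toℕ; _↑ˡ_; _↑ʳ_)
open import Data.Bool using (Bool; true; false)
open import Data.List using (List; []; _∷_; _++_; length; map; replicate; concatMap)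
open import Data.List.Membership.Propositional using (_∈_)
open import Data.Maybe using (Maybe; just; nothing)
open import Data.Product using (Σ; ∃; ∃-syntax; _×_; _,_)
open import Data.Empty using (⊥)
open import Relation.Nullary using (¬_)
open import Relation.Binary.PropositionalEquality using (_≡_)
open import Function.Bundles using (_⇔_)

Language : ℕ → Set₁
Language k = List (Fin k) → Set

-- Deterministic single-tape Turing machines with input alphabet Fin k.
-- Tape alphabet: Fin (suc (k + Γ)); zero is the blank, input symbol i
-- is suc (i ↑ˡ Γ), the remaining Γ symbols are work symbols.

Sym : ℕ → ℕ → Set
Sym k Γ = Fin (suc (k + Γ))

inSym : ∀ {k} Γ → Fin k → Sym k Γ
inSym Γ i = suc (i ↑ˡ Γ)

data Move : Set where
  left right stay : Move

data Action (Q S : Set) : Set where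
  halt : Bool → Action Q S
  go   : Q → S → Move → Action Q S

record TM (k : ℕ) : Set where
  field
    nQ    : ℕ
    Γ     : ℕ
    start : Fin nQ
    δ     : Fin nQ → Sym k Γ → Action (Fin nQ) (Sym k Γ)

-- configuration: state, tape left of head (nearest cell first),
-- tape from head cell rightwards (cells beyond the list are blank)
record Config {k : ℕ} (M : TM k) : Set where
  constructor conf
  field
    state : Fin (TM.nQ M)
    lft   : List (Sym k (TM.Γ M))
    rgt   : List (Sym k (TM.Γ M))

data StepResult {k : ℕ} (M : TM k) : Set where
  halted : Bool → StepResult M
  next   : Config M → StepResult M

module _ {k : ℕ} (M : TM k) where
  open TM M

  private
    S = Sym k Γ

    readHead : List S → S
    readHead []      = zero
    readHead (x ∷ _) = x

    dropHead : List S → List S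
    dropHead []       = []
    dropHead (_ ∷ xs) = xs

    moveHead : Move → S → List S → List S → List S × List S
    moveHead left  x []       r = [] , x ∷ r        -- left end: head stays
    moveHead left  x (l ∷ ls) r = ls , l ∷ x ∷ r
    moveHead right x ls       r = x ∷ ls , r
    moveHead stay  x ls       r = ls , x ∷ r

    mkNext : Fin nQ → List S × List S → StepResult M
    mkNext q (ls , rs) = next (conf q ls rs)

  step : Config M → StepResult M
  step (conf q ls rs) with δ q (readHead rs)
  ... | halt b      = halted b
  ... | go q' x mv  = mkNext q' (moveHead mv x ls (dropHead rs))

  run : ℕ → Config M → Maybe Bool
  run zero    c = nothing
  run (suc n) c with step c
  ... | halted b = just b
  ... | next c'  = run n c'

  initConfig : List (Fin k) → Config M
  initConfig w = conf start [] (map (inSym Γ) w)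

DecidesInTime : ∀ {k} → TM k → (ℕ → ℕ) → Language k → Set
DecidesInTime M T L =
  ∀ w → Σ Bool λ b → (run M (T (length w)) (initConfig M w) ≡ just b)
                      × ((b ≡ true) ⇔ L w)

InP : (k : ℕ) → Language k → Set
InP k L = Σ (TM k) λ M → Σ ℕ λ c → Σ ℕ λ d →
            DecidesInTime M (λ n → c * n ^ d + c) L

-- the class NP, via polynomial-time verifiers.  A verifier reads
-- w # y over the alphabet Fin (3 + k): zero = separator #,
-- 1 = bit false, 2 = bit true, 3 ↑ʳ i = input symbol i.

pairEnc : ∀ {k} → List (Fin k) → List Bool → List (Fin (3 + k))
pairEnc w y = map (3 ↑ʳ_) w ++ (zero ∷ map bit y)
  where
  bit : Bool → Fin (3 + _)
  bit false = suc zero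
  bit true  = suc (suc zero)

InNP : (k : ℕ) → Language k → Set₁
InNP k L = Σ (Language (3 + k)) λ V → InP (3 + k) V × Σ ℕ λ c → Σ ℕ λ d →
             (∀ w → L w ⇔ (∃[ y ] (length y ≤ c * length w ^ d + c × V (pairEnc w y))))

record LGraph (k : ℕ) : Set where
  constructor lgraph
  field
    n     : ℕ
    edges : List (Fin n × Fin k × Fin n)   -- (source , label , target)

data Path {k : ℕ} (G : LGraph k) : Fin (LGraph.n G) → Fin (LGraph.n G) → List (Fin k) → Set where
  nil  : ∀ {u} → Path G u u []
  cons : ∀ {u a w v ys} → (u , a , w) ∈ LGraph.edges G → Path G w v ys → Path G u v (a ∷ ys)

Acyclic : ∀ {k} → LGraph k → Set
Acyclic G = ∀ u a ys → ¬ Path G u u (a ∷ ys)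

encNat : ℕ → List (Fin 2)
encNat m = replicate m (suc zero) ++ (zero ∷ [])

encInstance : ∀ {k} (G : LGraph k) → Fin (LGraph.n G) → Fin (LGraph.n G) → List (Fin 2)
encInstance {k} G s t =
  concatMap encNat (LGraph.n G ∷ toℕ s ∷ toℕ t ∷ concatMap edgeNums (LGraph.edges G))
  where
  edgeNums : Fin (LGraph.n G) × Fin k × Fin (LGraph.n G) → List ℕ
  edgeNums (u , a , v) = toℕ u ∷ toℕ a ∷ toℕ v ∷ []

DAGREACH : ∀ k → Language k → Language 2
DAGREACH k L x =
  Σ (LGraph k) λ G → Σ (Fin (LGraph.n G)) λ s → Σ (Fin (LGraph.n G)) λ t →
    (x ≡ encInstance G s t) × Acyclic G × (∃[ ys ] (Path G s t ys × L ys))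

InDAGRP : (k : ℕ) → Language k → Set
InDAGRP k L = InP 2 (DAGREACH k L)

P≡DAGR-P : Set₁
P≡DAGR-P = ∀ k (L : Language k) → InP k L ⇔ InDAGRP k L

P≡NP : Set₁
P≡NP = ∀ k (L : Language k) → InP k L ⇔ InNP k L

{-# OPTIONS --safe #-}
module Submission where

open import Defs
open import Relation.Nullary using (¬_)
open import Function.Bundles using (_⇔_)
open import Data.Bool using (Bool; true; false; if_then_else_; _∧_; _∨_; not)
open import Data.Bool.ListAction using (any; all)
open import Data.Empty using (⊥-elim)
open import Data.Fin using (Fin; zero; suc; splitAt; _↑ʳ_; toℕ; fromℕ<)
open import Data.Fin.Properties using (splitAt-↑ˡ; splitAt-↑ʳ; toℕ-fromℕ<; toℕ<n; toℕ-injective; fromℕ<-injective; pigeonhole)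
open import Data.List using (List; []; _∷_; _++_; length; map; concatMap; allFin; head; foldl; foldr; reverse; replicate; concat; _ʳ++_)
open import Data.List.Membership.Propositional using (_∈_; lose)
open import Data.List.Membership.Propositional.Properties using (∈-map⁺; ∈-map⁻; ∈-++⁺ˡ; ∈-++⁺ʳ; ∈-allFin; ∈-concatMap⁺)
open import Data.List.Properties using (map-∘; map-cong; map-injective)
open import Data.List.Relation.Unary.All using (All; []; _∷_)
open import Data.List.Relation.Unary.Any using (here; there; index)
open import Data.List.Relation.Unary.Any.Properties using (lookup-index)
open import Data.Maybe using (Maybe; just; nothing; maybe′)
open import Data.Nat using (ℕ; zero; suc; _+_; _*_; _^_; _≤_; z≤n; s≤s; pred; _∸_; _<_)
open import Data.Nat.Properties
open import Data.Nat.Tactic.RingSolver using (solve-∀)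
open import Data.Product using (Σ; ∃-syntax; _×_; _,_; proj₁; proj₂)
open import Data.Sum using (_⊎_; inj₁; inj₂; [_,_]′)
open import Data.Unit using (⊤; tt)
open import Data.Vec using (Vec; []; _∷_; lookup; updateAt; _[_]≔_)
open import Function using (_∘_; id)
open import Function.Bundles using (mk⇔; Equivalence)
open import Relation.Binary.PropositionalEquality
import Data.Fin as Fin
import Data.List as List
import Data.List.Properties as List
import Data.List.Relation.Unary.All as All
import Data.List.Relation.Unary.All.Properties as All
import Data.Maybe as Maybe
import Data.Vec as Vec
import Data.Vec.Properties as Vec

-- If P = NP and L ∈ P, then DAGREACH(L) is in NP, hence in P: the certificate is the
-- yield of the path, which is short because a walk with n edges in a graph with n
-- vertices closes a cycle.  Conversely a word w lies in L if and only if the graph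
-- that is a single path labelled w lies in DAGREACH(L), so DAGR(P) ⊆ P.  If
-- P = DAGR(P) and V is a verifier for L with certificate bound p, prolong the path
-- labelled w by edges labelled # into every position of a chain of p double edges
-- labelled by both bits.  The yields of this graph are the words w # y with |y| ≤ p,
-- so L reduces to DAGREACH(V), which is in P.
--
-- Membership in P is traded for PT, computability in polynomial time by a program
-- that acts on codes of trees on four stacks.  A single-tape machine simulates the
-- stacks with their tops in its first cell; PT is closed under composition, pairing,
-- case distinction and folds whose state grows additively; and since the run of a
-- Turing machine is such a fold, InP and PT define the same languages.

-- Since P ⊆ NP and DAGR(P) ⊆ P are proved outright, each equality comes down to one inclusion: NP ⊆
-- P or P ⊆ DAGR(P). The combinatorics is short; the weight lies in exhibiting polynomial-time
-- machines. Single-tape machines are awkward to compose, whence the intermediate languages, whose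
-- time bounds are syntactic polynomials. A fold whose step is merely polynomial may double its
-- state in every round and reach exponential size, so the enlargement in one round has to be
-- bounded by the environment and the current element alone. `DAGREACH` contains only genuine
-- encodings of acyclic graphs, so a verifier has to decode its input, reject malformed strings and
-- test acyclicity besides following the word. Because numbers are written in unary, the vertex
-- count is at most the input length, which makes yields short certificates; verifiers read bits, so
-- the letters of the yield are in turn written in unary, at the cost of a factor `k`.

-- Polynomials as time bounds

infixl 6 _⊞_
infixl 7 _⊠_

-- Polynomials with natural coefficients are monotone and closed under substitution, so bounds
-- compose without arithmetic. The shape `c * n ^ d + c` that `InP` demands is recovered only at the
-- end, by `eval-bound`.
data Poly : Set where
  K       : ℕ → Poly
  X       : Poly
  _⊞_ _⊠_ : Poly → Poly → Poly

eval : Poly → ℕ → ℕ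
eval (K c)   n = c
eval X       n = n
eval (p ⊞ q) n = eval p n + eval q n
eval (p ⊠ q) n = eval p n * eval q n

eval-mono : ∀ p {m n} → m ≤ n → eval p m ≤ eval p n
eval-mono (K c)   m≤n = ≤-refl
eval-mono X       m≤n = m≤n
eval-mono (p ⊞ q) m≤n = +-mono-≤ (eval-mono p m≤n) (eval-mono q m≤n)
eval-mono (p ⊠ q) m≤n = *-mono-≤ (eval-mono p m≤n) (eval-mono q m≤n)

_⟪_⟫ : Poly → Poly → Poly
K c     ⟪ r ⟫ = K c
X       ⟪ r ⟫ = r
(p ⊞ q) ⟪ r ⟫ = p ⟪ r ⟫ ⊞ q ⟪ r ⟫
(p ⊠ q) ⟪ r ⟫ = p ⟪ r ⟫ ⊠ q ⟪ r ⟫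

eval-⟪⟫ : ∀ p r n → eval (p ⟪ r ⟫) n ≡ eval p (eval r n)
eval-⟪⟫ (K c)   r n = refl
eval-⟪⟫ X       r n = refl
eval-⟪⟫ (p ⊞ q) r n = cong₂ _+_ (eval-⟪⟫ p r n) (eval-⟪⟫ q r n)
eval-⟪⟫ (p ⊠ q) r n = cong₂ _*_ (eval-⟪⟫ p r n) (eval-⟪⟫ q r n)

^-distribʳ-* : ∀ m n d → (m * n) ^ d ≡ m ^ d * n ^ d
^-distribʳ-* m n zero    = refl
^-distribʳ-* m n (suc d) rewrite ^-distribʳ-* m n d = lemma m n (m ^ d) (n ^ d)
  where
  lemma : ∀ a b c e → a * b * (c * e) ≡ a * c * (b * e)
  lemma = solve-∀

-- The base `suc n` is positive, so its powers are monotone in the exponent and two monomials can be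
-- raised to a common degree.
eval-bound-suc : ∀ p → ∃[ c ] ∃[ d ] (∀ n → eval p n ≤ c * suc n ^ d)
eval-bound-suc (K c) = c , 0 , λ n → ≤-reflexive (sym (*-identityʳ c))
eval-bound-suc X     = 1 , 1 , λ n → ≤-trans (n≤1+n n) (≤-reflexive (lemma n))
  where
  lemma : ∀ n → suc n ≡ 1 * suc n ^ 1
  lemma n = sym (trans (*-identityˡ _) (*-identityʳ _))
eval-bound-suc (p ⊞ q) with eval-bound-suc p | eval-bound-suc q
... | c , d , f | c′ , d′ , g = c + c′ , d + d′ , λ n → begin
    eval p n + eval q n                              ≤⟨ +-mono-≤ (f n) (g n) ⟩
    c * suc n ^ d + c′ * suc n ^ d′                  ≤⟨ +-mono-≤ (*-monoʳ-≤ c (^-monoʳ-≤ (suc n) (m≤m+n d d′)))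
                                                                 (*-monoʳ-≤ c′ (^-monoʳ-≤ (suc n) (m≤n+m d′ d))) ⟩
    c * suc n ^ (d + d′) + c′ * suc n ^ (d + d′)     ≡⟨ *-distribʳ-+ (suc n ^ (d + d′)) c c′ ⟨
    (c + c′) * suc n ^ (d + d′)                      ∎
  where open ≤-Reasoning
eval-bound-suc (p ⊠ q) with eval-bound-suc p | eval-bound-suc q
... | c , d , f | c′ , d′ , g = c * c′ , d + d′ , λ n → begin
    eval p n * eval q n                   ≤⟨ *-mono-≤ (f n) (g n) ⟩
    c * suc n ^ d * (c′ * suc n ^ d′)     ≡⟨ lemma c c′ (suc n ^ d) (suc n ^ d′) ⟩
    c * c′ * (suc n ^ d * suc n ^ d′)     ≡⟨ cong (c * c′ *_) (^-distribˡ-+-* (suc n) d d′) ⟨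
    c * c′ * suc n ^ (d + d′)             ∎
  where
  open ≤-Reasoning
  lemma : ∀ a b x y → a * x * (b * y) ≡ a * b * (x * y)
  lemma = solve-∀

-- For positive `n`, `suc n` is at most `2 * n`, which costs the factor `2 ^ d`; the additive
-- constant takes care of `n = 0`.
eval-bound : ∀ p → ∃[ c ] ∃[ d ] (∀ n → eval p n ≤ c * n ^ d + c)
eval-bound p with eval-bound-suc p
... | c , d , f = 2 ^ d * c , d , λ n → ≤-trans (f n) (lemma n)
  where
  open ≤-Reasoning
  lemma : ∀ n → c * suc n ^ d ≤ 2 ^ d * c * n ^ d + 2 ^ d * c
  lemma zero = begin
    c * 1 ^ d                             ≡⟨ cong (c *_) (^-zeroˡ d) ⟩
    c * 1                                 ≡⟨ *-comm c 1 ⟩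
    1 * c                                 ≤⟨ *-monoˡ-≤ c (m^n>0 2 d) ⟩
    2 ^ d * c                             ≤⟨ m≤n+m _ _ ⟩
    2 ^ d * c * 0 ^ d + 2 ^ d * c         ∎
  lemma n@(suc m) = begin
    c * suc n ^ d                         ≤⟨ *-monoʳ-≤ c (^-monoˡ-≤ d (s≤s (m≤n+m n m))) ⟩
    c * (n + n) ^ d                       ≡⟨ cong (λ z → c * z ^ d) (cong (n +_) (sym (+-identityʳ n))) ⟩
    c * (2 * n) ^ d                       ≡⟨ cong (c *_) (^-distribʳ-* 2 n d) ⟩
    c * (2 ^ d * n ^ d)                   ≡⟨ *-assoc c _ _ ⟨
    c * 2 ^ d * n ^ d                     ≡⟨ cong (_* n ^ d) (*-comm c (2 ^ d)) ⟩
    2 ^ d * c * n ^ d                     ≤⟨ m≤m+n _ _ ⟩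
    2 ^ d * c * n ^ d + 2 ^ d * c         ∎

-- Finite types

-- Repetitions in the enumeration are harmless: `decode` after `code` is the identity, so the type
-- is a retract of some `Fin`, and that is enough to name states and symbols.
record Finite (A : Set) : Set where
  constructor enumerated
  field
    elems    : List A
    complete : ∀ a → a ∈ elems

  size : ℕ
  size = length elems

  code : A → Fin size
  code a = index (complete a)

  decode : Fin size → A
  decode = List.lookup elems

  decode-code : ∀ a → decode (code a) ≡ a
  decode-code a = sym (lookup-index (complete a))

open Finite using (elems; complete)

finite-⊤ : Finite ⊤
finite-⊤ = enumerated (tt ∷ []) λ _ → here refl

finite-Bool : Finite Bool
finite-Bool = enumerated (true ∷ false ∷ []) λ { true → here refl ; false → there (here refl) }

finite-Fin : ∀ {n} → Finite (Fin n)
finite-Fin = enumerated (allFin _) ∈-allFin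

finite-image : ∀ {A B : Set} (f : A → B) → (∀ b → ∃[ a ] f a ≡ b) → Finite A → Finite B
finite-image f onto F = enumerated (map f (elems F)) λ b → lemma b (onto b)
  where
  lemma : ∀ b → ∃[ a ] f a ≡ b → b ∈ map f (elems F)
  lemma b (a , refl) = ∈-map⁺ f (complete F a)

finite-Σ : ∀ {A : Set} {B : A → Set} → Finite A → (∀ a → Finite (B a)) → Finite (Σ A B)
finite-Σ {A} {B} F G = enumerated (concatMap row (elems F))
  λ (a , b) → ∈-concatMap⁺ row (lose (complete F a) (∈-map⁺ (a ,_) (complete (G a) b)))
  where
  row : A → List (Σ A B)
  row a = map (a ,_) (elems (G a))

finite-× : ∀ {A B : Set} → Finite A → Finite B → Finite (A × B)
finite-× F G = finite-Σ F λ _ → G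

finite-⊎ : ∀ {A B : Set} → Finite A → Finite B → Finite (A ⊎ B)
finite-⊎ F G = enumerated (map inj₁ (elems F) ++ map inj₂ (elems G)) λ
  { (inj₁ a) → ∈-++⁺ˡ (∈-map⁺ inj₁ (complete F a))
  ; (inj₂ b) → ∈-++⁺ʳ (map inj₁ (elems F)) (∈-map⁺ inj₂ (complete G b)) }

finite-Maybe : ∀ {A : Set} → Finite A → Finite (Maybe A)
finite-Maybe F = enumerated (nothing ∷ map just (elems F)) λ
  { nothing → here refl ; (just a) → there (∈-map⁺ just (complete F a)) }

finite-Vec : ∀ {A : Set} n → Finite A → Finite (Vec A n)
finite-Vec zero    F = enumerated ([] ∷ []) λ { [] → here refl }
finite-Vec (suc n) F = finite-image (λ (x , xs) → x ∷ xs) (λ { (x ∷ xs) → (x , xs) , refl })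
                                    (finite-× F (finite-Vec n F))

-- Turing machines over arbitrary finite types

record Machine (k : ℕ) : Set₁ where
  field
    Q S    : Set
    finQ   : Finite Q
    finS   : Finite S
    blank  : S
    input  : Fin k → S
    start  : Q
    δ      : Q → S → Action Q S

module Machines {k : ℕ} (M : Machine k) where
  open Machine M

  record Cfg : Set where
    constructor cfg
    field
      state : Q
      lft   : List S
      rgt   : List S

  move : Q → Move → S → List S → List S → Cfg
  move q left  x []       r = cfg q [] (x ∷ r)
  move q left  x (l ∷ ls) r = cfg q ls (l ∷ x ∷ r)
  move q right x ls       r = cfg q (x ∷ ls) r
  move q stay  x ls       r = cfg q ls (x ∷ r)

  act : Action Q S → List S → List S → Bool ⊎ Cfg
  act (halt b)    ls rs = inj₁ b
  act (go q x mv) ls rs = inj₂ (move q mv x ls rs)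

  advance : Cfg → Bool ⊎ Cfg
  advance (cfg q ls [])       = act (δ q blank) ls []
  advance (cfg q ls (x ∷ rs)) = act (δ q x) ls rs

  infix 4 _⟶⟨_⟩_

  data _⟶⟨_⟩_ : Cfg → ℕ → Cfg → Set where
    done : ∀ {c} → c ⟶⟨ 0 ⟩ c
    then : ∀ {c c′ c″ n} → advance c ≡ inj₂ c′ → c′ ⟶⟨ n ⟩ c″ → c ⟶⟨ suc n ⟩ c″

  one : ∀ {c c′} → advance c ≡ inj₂ c′ → c ⟶⟨ 1 ⟩ c′
  one eq = then eq done

  infixr 5 _⊙_

  _⊙_ : ∀ {c c′ c″ m n} → c ⟶⟨ m ⟩ c′ → c′ ⟶⟨ n ⟩ c″ → c ⟶⟨ m + n ⟩ c″
  done      ⊙ r = r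
  then eq p ⊙ r = then eq (p ⊙ r)

  private
    module F = Finite finQ
    module G = Finite finS

  symbol : S → Sym k G.size
  symbol s = suc (k ↑ʳ G.code s)

  -- Not injective: the abstract blank and the abstract input letters also have codes among the work
  -- symbols. The concrete machine writes work symbols only and reads every cell through `meaning`,
  -- so the ambiguity is invisible to it.
  meaning : Sym k G.size → S
  meaning zero    = blank
  meaning (suc i) = [ input , G.decode ]′ (splitAt k i)

  meaning-symbol : ∀ s → meaning (symbol s) ≡ s
  meaning-symbol s rewrite splitAt-↑ʳ k G.size (G.code s) = G.decode-code s

  meaning-inSym : ∀ a → meaning (inSym G.size a) ≡ input a
  meaning-inSym a rewrite splitAt-↑ˡ k a G.size = refl

  encode : Action Q S → Action (Fin F.size) (Sym k G.size)
  encode (halt b)    = halt b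
  encode (go q x mv) = go (F.code q) (symbol x) mv

  concrete : TM k
  concrete = record
    { nQ = F.size ; Γ = G.size ; start = F.code start
    ; δ = λ q s → encode (δ (F.decode q) (meaning s)) }

  abs : Config concrete → Cfg
  abs (conf q ls rs) = cfg (F.decode q) (map meaning ls) (map meaning rs)

  absResult : StepResult concrete → Bool ⊎ Cfg
  absResult (halted b) = inj₁ b
  absResult (next c)   = inj₂ (abs c)

  step-abs : ∀ c → absResult (step concrete c) ≡ advance (abs c)
  step-abs (conf q ls []) with δ (F.decode q) blank
  ... | halt b = refl
  ... | go q′ x stay  rewrite F.decode-code q′ | meaning-symbol x = refl
  ... | go q′ x right rewrite F.decode-code q′ | meaning-symbol x = refl
  step-abs (conf q []       []) | go q′ x left rewrite F.decode-code q′ | meaning-symbol x = refl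
  step-abs (conf q (l ∷ ls) []) | go q′ x left rewrite F.decode-code q′ | meaning-symbol x = refl
  step-abs (conf q ls (s ∷ rs)) with δ (F.decode q) (meaning s)
  ... | halt b = refl
  ... | go q′ x stay  rewrite F.decode-code q′ | meaning-symbol x = refl
  ... | go q′ x right rewrite F.decode-code q′ | meaning-symbol x = refl
  step-abs (conf q []       (s ∷ rs)) | go q′ x left rewrite F.decode-code q′ | meaning-symbol x = refl
  step-abs (conf q (l ∷ ls) (s ∷ rs)) | go q′ x left rewrite F.decode-code q′ | meaning-symbol x = refl

  -- The extra unit of fuel pays for the halting step; surplus fuel changes nothing, as `run` stops
  -- at the first halt.
  run-⟶ : ∀ {n} m c {a a′ b} → abs c ≡ a → a ⟶⟨ n ⟩ a′ → advance a′ ≡ inj₁ b →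
          suc n ≤ m → run concrete m c ≡ just b
  run-⟶ (suc m) c refl done eq n<m with step concrete c | trans (step-abs c) eq
  ... | halted b | refl = refl
  run-⟶ (suc m) c refl (then eq r) eq′ (s≤s n<m) with step concrete c | trans (step-abs c) eq
  ... | next c′ | refl = run-⟶ m c′ refl r eq′ n<m

  abs-init : ∀ w → abs (initConfig concrete w) ≡ cfg start [] (map input w)
  abs-init w rewrite F.decode-code start | sym (map-∘ {g = meaning} {f = inSym G.size} w) =
    cong (cfg start []) (map-cong meaning-inSym w)

  decides : ∀ {L : Language k} (T : ℕ → ℕ) (χ : List (Fin k) → Bool) →
            (∀ w → ∃[ n ] ∃[ c ] (cfg start [] (map input w) ⟶⟨ n ⟩ c) ×
                   advance c ≡ inj₁ (χ w) × suc n ≤ T (length w)) →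
            (∀ w → (χ w ≡ true) ⇔ L w) →
            DecidesInTime concrete T L
  decides T χ runs χ⇔L w with runs w
  ... | n , c , r , halts , n<T =
    χ w , run-⟶ (T _) (initConfig concrete w) (abs-init w) r halts n<T , χ⇔L w

-- Stack machines and their simulation on one tape

data Op (A : Set) (m : ℕ) : Set where
  nop  : Op A m
  push : Fin m → A → Op A m
  pop  : Fin m → Op A m

Stacks : Set → ℕ → Set
Stacks A m = Vec (List A) m

rest : ∀ {A : Set} → List A → List A
rest []       = []
rest (_ ∷ xs) = xs

pushed : ∀ {A : Set} {m} → Fin m → A → Stacks A m → Stacks A m
pushed i a s = updateAt s i (a ∷_)

popped : ∀ {A : Set} {m} → Fin m → Stacks A m → Stacks A m
popped i s = updateAt s i rest

-- Here nothing is the state of a machine that has stopped.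
record StackMachine (k m : ℕ) : Set₁ where
  field
    Q A     : Set
    finQ    : Finite Q
    finA    : Finite A
    input   : Fin k → A
    start   : Q
    op      : Q → Op A (suc m)
    goto    : Q → Maybe A → Maybe Q
    verdict : Maybe A → Bool

module StackMachines {k m : ℕ} (M : StackMachine k m) where
  open StackMachine M

  effect : Op A (suc m) → Stacks A (suc m) → Stacks A (suc m)
  effect nop        s = s
  effect (push i a) s = pushed i a s
  effect (pop i)    s = popped i s

  answer : Op A (suc m) → Stacks A (suc m) → Maybe A
  answer nop        s = nothing
  answer (push i a) s = nothing
  answer (pop i)    s = head (lookup s i)

  infix 4 _,_⇝⟨_⟩_,_

  data _,_⇝⟨_⟩_,_ : Maybe Q → Stacks A (suc m) → ℕ → Maybe Q → Stacks A (suc m) → Set where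
    done : ∀ {q s} → q , s ⇝⟨ 0 ⟩ q , s
    then : ∀ {q s q″ s″ n} →
           goto q (answer (op q) s) , effect (op q) s ⇝⟨ n ⟩ q″ , s″ →
           just q , s ⇝⟨ suc n ⟩ q″ , s″

  -- Cell j of the tape holds the j-th symbol from the top of every stack, so a
  -- push or a pop on stack i shifts track i by one cell.  The flag marks cell 0.
  Tracks Cell : Set
  Tracks = Vec (Maybe A) (suc m)
  Cell   = Bool × Tracks

  -- A push carries the displaced symbol to the right (`shiftIn`) and then walks back (`return`). A
  -- pop first walks past the end of the track (`scan`) and shifts on the way back (`shiftOut`),
  -- because the symbol that enters a cell comes from its right. The popped symbol is known in cell
  -- 0 already, so each state can carry the point at which to continue.
  data State : Set where
    init           : State
    home return    : Maybe Q → State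
    shiftIn        : Fin (suc m) → A → Maybe Q → State
    scan           : Fin (suc m) → Maybe Q → State
    shiftOut       : Fin (suc m) → Maybe A → Maybe Q → State

  δ : State → Cell → Action State Cell
  δ init (_ , c)              = go (home (just start)) (true , c) stay
  δ (home nothing) (_ , c)    = halt (verdict (lookup c zero))
  δ (home (just q)) (f , c) with op q
  ... | nop = go (home (goto q nothing)) (f , c) stay
  ... | push i a with lookup c i
  ...   | nothing = go (home (goto q nothing)) (f , c [ i ]≔ just a) stay
  ...   | just b  = go (shiftIn i b (goto q nothing)) (f , c [ i ]≔ just a) right
  δ (home (just q)) (f , c) | pop i with lookup c i
  ...   | nothing = go (home (goto q nothing)) (f , c) stay
  ...   | just a  = go (scan i (goto q (just a))) (f , c) right
  δ (return κ) (true , c)  = go (home κ) (true , c) stay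
  δ (return κ) (false , c) = go (return κ) (false , c) left
  δ (shiftIn i a κ) (f , c) with lookup c i
  ... | nothing = go (return κ) (f , c [ i ]≔ just a) left
  ... | just b  = go (shiftIn i b κ) (f , c [ i ]≔ just a) right
  δ (scan i κ) (f , c) with lookup c i
  ... | nothing = go (shiftOut i nothing κ) (f , c) left
  ... | just b  = go (scan i κ) (f , c) right
  δ (shiftOut i x κ) (true , c)  = go (home κ) (true , c [ i ]≔ x) stay
  δ (shiftOut i x κ) (false , c) = go (shiftOut i (lookup c i) κ) (false , c [ i ]≔ x) left

  finState : Finite State
  finState = finite-image to onto
    (finite-⊎ finite-⊤ (finite-⊎ (finite-× finite-Bool finκ)
      (finite-⊎ (finite-× finite-Fin (finite-× finA finκ))
      (finite-⊎ (finite-× finite-Fin finκ) (finite-× finite-Fin (finite-× (finite-Maybe finA) finκ))))))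
    where
    finκ = finite-Maybe finQ
    to : ⊤ ⊎ (Bool × Maybe Q) ⊎ (Fin (suc m) × A × Maybe Q) ⊎ (Fin (suc m) × Maybe Q) ⊎
         (Fin (suc m) × Maybe A × Maybe Q) → State
    to (inj₁ tt)                                   = init
    to (inj₂ (inj₁ (true , κ)))                    = home κ
    to (inj₂ (inj₁ (false , κ)))                   = return κ
    to (inj₂ (inj₂ (inj₁ (i , a , κ))))            = shiftIn i a κ
    to (inj₂ (inj₂ (inj₂ (inj₁ (i , κ)))))         = scan i κ
    to (inj₂ (inj₂ (inj₂ (inj₂ (i , x , κ)))))     = shiftOut i x κ
    onto : ∀ q → ∃[ z ] to z ≡ q
    onto init             = _ , refl
    onto (home κ)         = inj₂ (inj₁ (true , κ)) , refl
    onto (return κ)       = inj₂ (inj₁ (false , κ)) , refl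
    onto (shiftIn i a κ)  = inj₂ (inj₂ (inj₁ (i , a , κ))) , refl
    onto (scan i κ)       = inj₂ (inj₂ (inj₂ (inj₁ (i , κ)))) , refl
    onto (shiftOut i x κ) = inj₂ (inj₂ (inj₂ (inj₂ (i , x , κ)))) , refl

  empty : Tracks
  empty = Vec.replicate (suc m) nothing

  machine : Machine k
  machine = record
    { Q = State ; S = Cell ; finQ = finState ; finS = finite-× finite-Bool (finite-Vec (suc m) (finite-Maybe finA))
    ; blank = false , empty
    ; input = λ a → false , just (input a) ∷ Vec.replicate m nothing
    ; start = init ; δ = δ }

  open Machines machine

  tops : ∀ {n} → Stacks A n → Vec (Maybe A) n
  tops = Vec.map head

  rests : ∀ {n} → Stacks A n → Stacks A n
  rests = Vec.map rest

  -- Cells beyond the highest stack may follow, as a pop does not shorten the written part of the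
  -- tape.
  Holds : List Cell → Stacks A (suc m) → Set
  Holds []       s = s ≡ Vec.replicate (suc m) []
  Holds (c ∷ cs) s = c ≡ (false , tops s) × Holds cs (rests s)

  tops-pushed : ∀ {n} (s : Stacks A n) i a → tops s [ i ]≔ just a ≡ tops (pushed i a s)
  tops-pushed (_ ∷ s) zero    a = refl
  tops-pushed (_ ∷ s) (suc i) a = cong (_ ∷_) (tops-pushed s i a)

  tops-popped : ∀ {n} (s : Stacks A n) i → tops s [ i ]≔ head (lookup (rests s) i) ≡ tops (popped i s)
  tops-popped (_ ∷ s) zero    = refl
  tops-popped (_ ∷ s) (suc i) = cong (_ ∷_) (tops-popped s i)

  rests-popped : ∀ {n} (s : Stacks A n) i → rests (popped i s) ≡ popped i (rests s)
  rests-popped (_ ∷ s) zero    = refl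
  rests-popped (_ ∷ s) (suc i) = cong (_ ∷_) (rests-popped s i)

  lookup-tops : ∀ {n} (s : Stacks A n) i → lookup (tops s) i ≡ head (lookup s i)
  lookup-tops s i = Vec.lookup-map i head s

  rests-pushed-nothing : ∀ {n} (s : Stacks A n) i a → head (lookup s i) ≡ nothing →
                         rests (pushed i a s) ≡ rests s
  rests-pushed-nothing ([] ∷ s) zero    a _  = refl
  rests-pushed-nothing (_ ∷ s)  (suc i) a eq = cong (_ ∷_) (rests-pushed-nothing s i a eq)

  rests-pushed-just : ∀ {n} (s : Stacks A n) i a {b} → head (lookup s i) ≡ just b →
                      rests (pushed i a s) ≡ pushed i b (rests s)
  rests-pushed-just ((_ ∷ _) ∷ s) zero    a refl = refl
  rests-pushed-just (_ ∷ s)       (suc i) a eq   = cong (_ ∷_) (rests-pushed-just s i a eq)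

  popped-nothing : ∀ {n} (s : Stacks A n) i → head (lookup s i) ≡ nothing → popped i s ≡ s
  popped-nothing ([] ∷ s) zero    _  = refl
  popped-nothing (_ ∷ s)  (suc i) eq = cong (_ ∷_) (popped-nothing s i eq)

  tops-[] : ∀ n → tops (Vec.replicate n []) ≡ Vec.replicate n nothing
  tops-[] n = Vec.map-replicate head [] n

  rests-[] : ∀ n → rests (Vec.replicate n []) ≡ Vec.replicate n []
  rests-[] n = Vec.map-replicate rest [] n

  blanks-hold : Holds ((false , empty) ∷ []) (Vec.replicate (suc m) [])
  blanks-hold = cong (false ,_) (sym (tops-[] (suc m))) , rests-[] (suc m)

  δ-shiftIn-nothing : ∀ i a κ f c → lookup c i ≡ nothing →
                      δ (shiftIn i a κ) (f , c) ≡ go (return κ) (f , c [ i ]≔ just a) left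
  δ-shiftIn-nothing i a κ f c eq with lookup c i | eq
  ... | nothing | refl = refl

  δ-shiftIn-just : ∀ i a κ f c {b} → lookup c i ≡ just b →
                   δ (shiftIn i a κ) (f , c) ≡ go (shiftIn i b κ) (f , c [ i ]≔ just a) right
  δ-shiftIn-just i a κ f c eq with lookup c i | eq
  ... | just b | refl = refl

  δ-scan-nothing : ∀ i κ f c → lookup c i ≡ nothing →
                   δ (scan i κ) (f , c) ≡ go (shiftOut i nothing κ) (f , c) left
  δ-scan-nothing i κ f c eq with lookup c i | eq
  ... | nothing | refl = refl

  δ-scan-just : ∀ i κ f c {b} → lookup c i ≡ just b →
                δ (scan i κ) (f , c) ≡ go (scan i κ) (f , c) right
  δ-scan-just i κ f c eq with lookup c i | eq
  ... | just b | refl = refl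

  stepTo : ∀ ls rs {α β} → α ≡ β → act α ls rs ≡ act β ls rs
  stepTo ls rs eq = cong (λ α → act α ls rs) eq

  _+2*_ : ℕ → ℕ → ℕ
  a +2* n = a + (n + n)

  -- Each further cell costs one step on the way out and one on the way back.
  +2*-suc : ∀ {t a n} → t ≤ a +2* n → suc (t + 1) ≤ a +2* suc n
  +2*-suc {t} {a} {n} t≤ = begin
    suc (t + 1)             ≡⟨ cong suc (+-comm t 1) ⟩
    2 + t                   ≤⟨ +-monoʳ-≤ 2 t≤ ⟩
    2 + (a + (n + n))       ≡⟨ lemma a n ⟩
    a + (suc n + suc n)     ∎
    where
    open ≤-Reasoning
    lemma : ∀ a n → 2 + (a + (n + n)) ≡ a + (suc n + suc n)
    lemma = solve-∀

  -- The outcome of an excursion over `n` cells that ends on the cell `l` to the left of its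
  -- starting point. It may enter one fresh blank cell, hence `suc n`.
  record Swept (c : Cfg) (q : State) (ls : List Cell) (l : Cell) (s : Stacks A (suc m)) (n : ℕ) : Set where
    constructor swept
    field
      cells    : List Cell
      time     : ℕ
      reaches  : c ⟶⟨ time ⟩ cfg q ls (l ∷ cells)
      holds    : Holds cells s
      time≤    : time ≤ 1 +2* n
      length≤  : length cells ≤ suc n

  shiftIn-sweep : ∀ i a κ l ls rs s → Holds rs s →
    Swept (cfg (shiftIn i a κ) (l ∷ ls) rs) (return κ) ls l (pushed i a s) (length rs)
  shiftIn-sweep i a κ l ls [] s refl = swept _ _
    (one (cong (λ α → act α (l ∷ ls) [])
               (δ-shiftIn-nothing i a κ false empty (Vec.lookup-replicate i nothing))))
    (cong (false ,_) eq , trans (rests-pushed-nothing s i a eq′) (rests-[] (suc m)))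
    ≤-refl ≤-refl
    where
    eq : empty [ i ]≔ just a ≡ tops (pushed i a s)
    eq = trans (cong (_[ i ]≔ just a) (sym (tops-[] (suc m)))) (tops-pushed s i a)
    eq′ : head (lookup s i) ≡ nothing
    eq′ = cong head (Vec.lookup-replicate i [])
  shiftIn-sweep i a κ l ls (_ ∷ cs) s (refl , h) with head (lookup s i) in eq
  ... | nothing = swept _ _
    (one (stepTo (l ∷ ls) cs (δ-shiftIn-nothing i a κ false (tops s) (trans (lookup-tops s i) eq))))
    (cong (false ,_) (tops-pushed s i a) , subst (Holds cs) (sym (rests-pushed-nothing s i a eq)) h)
    (s≤s z≤n) (n≤1+n _)
  ... | just b with shiftIn-sweep i b κ (false , tops s [ i ]≔ just a) (l ∷ ls) cs (rests s) h
  ...   | swept cs′ t r h′ t≤ l≤ = swept _ _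
    (then (stepTo (l ∷ ls) cs (δ-shiftIn-just i a κ false (tops s) (trans (lookup-tops s i) eq)))
          (r ⊙ one refl))
    (cong (false ,_) (tops-pushed s i a) , subst (Holds cs′) (sym (rests-pushed-just s i a eq)) h′)
    (+2*-suc {a = 1} t≤) (s≤s l≤)

  scan-sweep : ∀ i κ l ls rs s → Holds rs s →
    Swept (cfg (scan i κ) (l ∷ ls) rs) (shiftOut i (head (lookup s i)) κ) ls l (popped i s) (length rs)
  scan-sweep i κ l ls [] s refl = swept _ _
    (one (trans (cong (λ α → act α (l ∷ ls) []) (δ-scan-nothing i κ false empty (Vec.lookup-replicate i nothing)))
                (cong (λ x → inj₂ (cfg (shiftOut i x κ) ls (l ∷ (false , empty) ∷ []))) (sym eq))))
    (subst (Holds ((false , empty) ∷ [])) (sym (popped-nothing s i eq)) blanks-hold)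
    ≤-refl ≤-refl
    where
    eq : head (lookup s i) ≡ nothing
    eq = cong head (Vec.lookup-replicate i [])
  scan-sweep i κ l ls (_ ∷ cs) s (refl , h) with head (lookup s i) in eq
  ... | nothing = swept _ _
    (one (stepTo (l ∷ ls) cs (δ-scan-nothing i κ false (tops s) (trans (lookup-tops s i) eq))))
    (subst (Holds ((false , tops s) ∷ cs)) (sym (popped-nothing s i eq)) (refl , h))
    (s≤s z≤n) (n≤1+n _)
  ... | just b with scan-sweep i κ (false , tops s) (l ∷ ls) cs (rests s) h
  ...   | swept cs′ t r h′ t≤ l≤ = swept _ _
    (then (stepTo (l ∷ ls) cs (δ-scan-just i κ false (tops s) (trans (lookup-tops s i) eq)))
          (r ⊙ one (cong (λ x → inj₂ (cfg (shiftOut i x κ) ls (l ∷ (false , tops s [ i ]≔ head (lookup (rests s) i)) ∷ cs′)))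
                         (trans (lookup-tops s i) eq))))
    (cong (false ,_) (tops-popped s i) , subst (Holds cs′) (sym (rests-popped s i)) h′)
    (+2*-suc {a = 1} t≤) (s≤s l≤)

  data Represents : Cfg → Maybe Q → Stacks A (suc m) → ℕ → Set where
    represents : ∀ {q s cs n} → Holds cs (rests s) → length cs ≤ n →
                 Represents (cfg (home q) [] ((true , tops s) ∷ cs)) q s n

  -- One step in cell 0, a sweep of at most `1 +2* n` steps, and one step to come home.
  opCost : ℕ → ℕ
  opCost n = 3 +2* n

  record Simulated (c : Cfg) (q : Maybe Q) (s : Stacks A (suc m)) (n t : ℕ) : Set where
    constructor simulated
    field
      {final}   : Cfg
      time      : ℕ
      reaches   : c ⟶⟨ time ⟩ final
      represent : Represents final q s n
      time≤     : time ≤ t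

  1≤opCost : ∀ n → 1 ≤ opCost n
  1≤opCost n = s≤s z≤n

  sweep≤opCost : ∀ {t a n} → t ≤ 1 +2* a → a ≤ n → suc (t + 1) ≤ opCost n
  sweep≤opCost {t} {a} {n} t≤ a≤n = begin
    suc (t + 1)             ≡⟨ cong suc (+-comm t 1) ⟩
    2 + t                   ≤⟨ +-monoʳ-≤ 2 t≤ ⟩
    3 + (a + a)             ≤⟨ +-monoʳ-≤ 3 (+-mono-≤ a≤n a≤n) ⟩
    3 + (n + n)             ∎
    where open ≤-Reasoning

  simulate-op : ∀ {c q s n} → Represents c (just q) s n →
    Simulated c (goto q (answer (op q) s)) (effect (op q) s) (suc n) (opCost n)
  simulate-op {q = q} {s} {n} (represents {cs = cs} h l≤) with op q in o
  ... | nop = simulated 1 (one (stepTo [] cs eq)) (represents h (m≤n⇒m≤1+n l≤)) (1≤opCost n)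
    where
    eq : δ (home (just q)) (true , tops s) ≡ go (home (goto q nothing)) (true , tops s) stay
    eq rewrite o = refl
  ... | push i a with lookup (tops s) i in e
  ...   | nothing = simulated 1 (one (stepTo [] cs eq))
                      (subst (λ z → Represents (cfg _ [] ((true , z) ∷ cs)) _ (pushed i a s) _) (sym (tops-pushed s i a))
                        (represents (subst (Holds cs) (sym (rests-pushed-nothing s i a (trans (sym (lookup-tops s i)) e))) h)
                                    (m≤n⇒m≤1+n l≤))) (1≤opCost n)
    where
    eq : δ (home (just q)) (true , tops s) ≡ go (home (goto q nothing)) (true , tops s [ i ]≔ just a) stay
    eq rewrite o | e = refl
  ...   | just b with shiftIn-sweep i b (goto q nothing) (true , tops s [ i ]≔ just a) [] cs (rests s) h
  ...     | swept cs′ t r h′ t≤ l≤′ = simulated _ (then (stepTo [] cs eq) (r ⊙ one refl))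
                      (subst (λ z → Represents (cfg _ [] ((true , z) ∷ cs′)) _ (pushed i a s) _) (sym (tops-pushed s i a))
                        (represents (subst (Holds cs′) (sym (rests-pushed-just s i a (trans (sym (lookup-tops s i)) e))) h′)
                                    (≤-trans l≤′ (s≤s l≤)))) (sweep≤opCost t≤ l≤)
    where
    eq : δ (home (just q)) (true , tops s) ≡ go (shiftIn i b (goto q nothing)) (true , tops s [ i ]≔ just a) right
    eq rewrite o | e = refl
  simulate-op {q = q} {s} {n} (represents {cs = cs} h l≤) | pop i with head (lookup s i) in e
  ...   | nothing = simulated 1 (one (stepTo [] cs eq))
                      (subst (λ z → Represents _ _ z (suc n)) (sym (popped-nothing s i e))
                        (represents h (m≤n⇒m≤1+n l≤))) (1≤opCost n)
    where
    eq : δ (home (just q)) (true , tops s) ≡ go (home (goto q nothing)) (true , tops s) stay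
    eq rewrite o | lookup-tops s i | e = refl
  ...   | just b with scan-sweep i (goto q (just b)) (true , tops s) [] cs (rests s) h
  ...     | swept cs′ t r h′ t≤ l≤′ = simulated _ (then (stepTo [] cs eq) (r ⊙ one refl))
                      (subst (λ z → Represents (cfg _ [] ((true , z) ∷ cs′)) _ (popped i s) _) (sym (tops-popped s i))
                        (represents (subst (Holds cs′) (sym (rests-popped s i)) h′)
                                    (≤-trans l≤′ (s≤s l≤)))) (sweep≤opCost t≤ l≤)
    where
    eq : δ (home (just q)) (true , tops s) ≡ go (scan i (goto q (just b))) (true , tops s) right
    eq rewrite o | lookup-tops s i | e = refl

  -- An operation lengthens the tape by at most one cell, so all `t` of them work on at most `t + n`
  -- cells and the slowdown is quadratic.
  simulate : ∀ {t q s q′ s′ c n} → q , s ⇝⟨ t ⟩ q′ , s′ → Represents c q s n →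
             Simulated c q′ s′ (t + n) (t * opCost (t + n))
  simulate done r = simulated 0 done r z≤n
  simulate {suc t} {n = n} (then p) r with simulate-op r
  ... | simulated a r₁ rep₁ a≤ with simulate p rep₁
  ...   | simulated b r₂ rep₂ b≤ =
    simulated (a + b) (r₁ ⊙ r₂) (subst (Represents _ _ _) (+-suc t n) rep₂)
      (+-mono-≤ (≤-trans a≤ (mono (≤-trans (m≤n+m n t) (n≤1+n _))))
                (subst (λ z → b ≤ t * opCost z) (+-suc t n) b≤))
    where
    mono : ∀ {x y} → x ≤ y → opCost x ≤ opCost y
    mono x≤y = +-monoʳ-≤ 3 (+-mono-≤ x≤y x≤y)

  inputStacks : List (Fin k) → Stacks A (suc m)
  inputStacks w = map input w ∷ Vec.replicate m []

  input-holds : ∀ w → Holds (map (Machine.input machine) w) (inputStacks w)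
  input-holds []      = refl
  input-holds (a ∷ w) = cong (λ z → false , just (input a) ∷ z) (sym (tops-[] m)) ,
                        subst (Holds _) (cong (map input w ∷_) (sym (rests-[] m))) (input-holds w)

  tape-length : ∀ w → length (map (Machine.input machine) w) ≡ length w
  tape-length w = List.length-map _ w

  initialise : ∀ w → Simulated (cfg init [] (map (Machine.input machine) w)) (just start) (inputStacks w) (length w) 1
  initialise [] = simulated 1
    (one (cong (λ z → inj₂ (cfg (home (just start)) [] ((true , z) ∷ []))) (sym (tops-[] (suc m)))))
    (represents (rests-[] (suc m)) z≤n) ≤-refl
  initialise (a ∷ w) = simulated 1
    (one (cong (λ z → inj₂ (cfg (home (just start)) [] ((true , just (input a) ∷ z) ∷ map (Machine.input machine) w)))
               (sym (tops-[] m))))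
    (represents (proj₂ (input-holds (a ∷ w))) (m≤n⇒m≤1+n (≤-reflexive (tape-length w)))) ≤-refl

  -- The constant 2 pays for marking cell 0 and for halting; the other summand is the bound of
  -- `simulate` with `T` for the number of operations and `X` for the input length.
  tapeTime : Poly → Poly
  tapeTime T = K 2 ⊞ T ⊠ (K 3 ⊞ ((T ⊞ X) ⊞ (T ⊞ X)))

  stack-decides : ∀ {L : Language k} (T : Poly) (χ : List (Fin k) → Bool) →
    (∀ w → ∃[ t ] ∃[ s ] (just start , inputStacks w ⇝⟨ t ⟩ nothing , s) ×
           verdict (head (lookup s zero)) ≡ χ w × t ≤ eval T (length w)) →
    (∀ w → (χ w ≡ true) ⇔ L w) → InP k L
  stack-decides {L} T χ runs χ⇔L with eval-bound (tapeTime T)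
  ... | c , d , bound = concrete , c , d , decides (λ n → c * n ^ d + c) χ body χ⇔L
    where
    body : ∀ w → ∃[ n ] ∃[ z ] (cfg init [] (map (Machine.input machine) w) ⟶⟨ n ⟩ z) ×
                 advance z ≡ inj₁ (χ w) × suc n ≤ c * length w ^ d + c
    body w with runs w | initialise w
    ... | t , s , r , v , t≤ | simulated a r₁ rep₁ a≤ with simulate r rep₁
    ...   | simulated b r₂ (represents h l≤) b≤ =
      a + b , _ , r₁ ⊙ r₂ , cong inj₁ (trans (cong verdict (lookup-tops s zero)) v) ,
      ≤-trans (s≤s (+-mono-≤ a≤ (≤-trans b≤ (*-mono-≤ t≤ (+-monoʳ-≤ 3 (+-mono-≤ le le)))))) (bound (length w))
      where
      le : t + length w ≤ eval T (length w) + length w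
      le = +-monoˡ-≤ (length w) t≤

-- Structured stack programs and their compilation

infixr 5 _⨾_

-- read i b r pops x from stack i, runs b x, and then repeats itself if r x.
data Cmd (A : Set) (m : ℕ) : Set where
  skip : Cmd A m
  push : Fin m → A → Cmd A m
  _⨾_  : Cmd A m → Cmd A m → Cmd A m
  read : Fin m → (Maybe A → Cmd A m) → (Maybe A → Bool) → Cmd A m

infix 4 _⊢_⇓_⟨_⟩

-- Time is the exact number of stack-machine operations: sequencing is free, and `skip` costs 1
-- because it compiles to `nop`. Hence `follow` preserves it on the nose.
data _⊢_⇓_⟨_⟩ {A : Set} {m : ℕ} : Cmd A m → Stacks A m → Stacks A m → ℕ → Set where
  skip⇓ : ∀ {s} → skip ⊢ s ⇓ s ⟨ 1 ⟩
  push⇓ : ∀ {i a s} → push i a ⊢ s ⇓ pushed i a s ⟨ 1 ⟩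
  _⨾⇓_  : ∀ {c d s s′ s″ t u} → c ⊢ s ⇓ s′ ⟨ t ⟩ → d ⊢ s′ ⇓ s″ ⟨ u ⟩ → c ⨾ d ⊢ s ⇓ s″ ⟨ t + u ⟩
  exit⇓ : ∀ {i b r s s′ t} → r (head (lookup s i)) ≡ false →
          b (head (lookup s i)) ⊢ popped i s ⇓ s′ ⟨ t ⟩ → read i b r ⊢ s ⇓ s′ ⟨ suc t ⟩
  loop⇓ : ∀ {i b r s s′ s″ t u} → r (head (lookup s i)) ≡ true →
          b (head (lookup s i)) ⊢ popped i s ⇓ s′ ⟨ t ⟩ → read i b r ⊢ s′ ⇓ s″ ⟨ u ⟩ →
          read i b r ⊢ s ⇓ s″ ⟨ suc (t + u) ⟩

height : ∀ {A : Set} {m} → Stacks A m → ℕ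
height s = Vec.sum (Vec.map length s)

height-pushed : ∀ {A : Set} {m} i (a : A) (s : Stacks A m) → height (pushed i a s) ≡ suc (height s)
height-pushed zero    a (_ ∷ s) = refl
height-pushed (suc i) a (u ∷ s) = trans (cong (length u +_) (height-pushed i a s)) (+-suc _ _)

height-popped : ∀ {A : Set} {m} i (s : Stacks A m) → height (popped i s) ≤ height s
height-popped zero    ([] ∷ s)      = ≤-refl
height-popped zero    ((_ ∷ _) ∷ s) = n≤1+n _
height-popped (suc i) (u ∷ s)       = +-monoʳ-≤ (length u) (height-popped i s)

-- A unit of time pushes at most one symbol. Running times therefore bound the sizes of results, and
-- no separate size analysis of programs is called for.
height-⇓ : ∀ {A : Set} {m} {c : Cmd A m} {s s′ t} → c ⊢ s ⇓ s′ ⟨ t ⟩ → height s′ ≤ t + height s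
height-⇓ skip⇓ = n≤1+n _
height-⇓ (push⇓ {i} {a} {s}) = ≤-reflexive (height-pushed i a s)
height-⇓ {s = s} (_⨾⇓_ {t = t} {u} p q) = begin
  _                  ≤⟨ height-⇓ q ⟩
  u + _              ≤⟨ +-monoʳ-≤ u (height-⇓ p) ⟩
  u + (t + height s) ≡⟨ +-assoc u t _ ⟨
  u + t + height s   ≡⟨ cong (_+ height s) (+-comm u t) ⟩
  t + u + height s   ∎
  where open ≤-Reasoning
height-⇓ (exit⇓ {i} {s = s} {t = t} _ p) =
  m≤n⇒m≤1+n (≤-trans (height-⇓ p) (+-monoʳ-≤ t (height-popped i s)))
height-⇓ (loop⇓ {i} {s = s} {t = t} {u} _ p q) = m≤n⇒m≤1+n (begin
  _                  ≤⟨ height-⇓ q ⟩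
  u + _              ≤⟨ +-monoʳ-≤ u (height-⇓ p) ⟩
  u + (t + _)        ≤⟨ +-monoʳ-≤ u (+-monoʳ-≤ t (height-popped i s)) ⟩
  u + (t + height s) ≡⟨ +-assoc u t _ ⟨
  u + t + height s   ≡⟨ cong (_+ height s) (+-comm u t) ⟩
  t + u + height s   ∎)
  where open ≤-Reasoning

module _ {A : Set} {m : ℕ} where

  -- A point inside the body of a `read` records the symbol that was read, so that `after` can still
  -- evaluate the loop condition `r x` when the body ends.
  Point : Cmd A m → Set
  Point skip         = ⊤
  Point (push i a)   = ⊤
  Point (c ⨾ d)      = Point c ⊎ Point d
  Point (read i b r) = ⊤ ⊎ Σ (Maybe A) (λ x → Point (b x))

  finite-Point : Finite A → ∀ c → Finite (Point c)
  finite-Point F skip         = finite-⊤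
  finite-Point F (push i a)   = finite-⊤
  finite-Point F (c ⨾ d)      = finite-⊎ (finite-Point F c) (finite-Point F d)
  finite-Point F (read i b r) = finite-⊎ finite-⊤ (finite-Σ (finite-Maybe F) (λ x → finite-Point F (b x)))

  entry : ∀ c → Point c
  entry skip         = tt
  entry (push i a)   = tt
  entry (c ⨾ d)      = inj₁ (entry c)
  entry (read i b r) = inj₁ tt

  opAt : ∀ c → Point c → Op A m
  opAt skip         _              = nop
  opAt (push i a)   _              = push i a
  opAt (c ⨾ d)      (inj₁ q)       = opAt c q
  opAt (c ⨾ d)      (inj₂ q)       = opAt d q
  opAt (read i b r) (inj₁ _)       = pop i
  opAt (read i b r) (inj₂ (x , q)) = opAt (b x) q

  after : ∀ c → Point c → Maybe A → Maybe (Point c)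
  after skip         _              _ = nothing
  after (push i a)   _              _ = nothing
  after (c ⨾ d)      (inj₁ q)       y = just (maybe′ inj₁ (inj₂ (entry d)) (after c q y))
  after (c ⨾ d)      (inj₂ q)       y = Maybe.map inj₂ (after d q y)
  after (read i b r) (inj₁ _)       y = just (inj₂ (y , entry (b y)))
  after (read i b r) (inj₂ (x , q)) y =
    maybe′ (λ q′ → just (inj₂ (x , q′))) (if r x then just (inj₁ tt) else nothing) (after (b x) q y)

-- `lf` and `nd` spell trees in prefix order, `mk` marks the bottom of a tree parked on an auxiliary
-- stack, and `inp` carries the raw input before it is turned into a tree.
data Symbol (k : ℕ) : Set where
  lf nd mk : Symbol k
  inp      : Fin k → Symbol k

finite-Symbol : ∀ {k} → Finite (Symbol k)
finite-Symbol {k} = finite-image to onto (finite-⊎ (finite-Fin {3}) (finite-Fin {k}))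
  where
  to : Fin 3 ⊎ Fin k → Symbol k
  to (inj₁ zero)             = lf
  to (inj₁ (suc zero))       = nd
  to (inj₁ (suc (suc zero))) = mk
  to (inj₂ a)                = inp a
  onto : ∀ x → ∃[ z ] to z ≡ x
  onto lf      = inj₁ zero , refl
  onto nd      = inj₁ (suc zero) , refl
  onto mk      = inj₁ (suc (suc zero)) , refl
  onto (inp a) = inj₂ a , refl

module Compile {k m : ℕ} (main : Cmd (Symbol k) (suc m)) where

  A = Symbol k

  -- The result is the code of a Boolean on top of stack 0: that of `true` begins with `nd`, that of
  -- `false` with `lf`.
  accepting : Maybe A → Bool
  accepting (just nd) = true
  accepting _         = false

  compiled : StackMachine k m
  compiled = record
    { Q = Point main ; A = A ; finQ = finite-Point finite-Symbol main ; finA = finite-Symbol ; input = inp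
    ; start = entry main ; op = opAt main ; goto = after main ; verdict = accepting }

  open StackMachines compiled

  _⊙_ : ∀ {q s q′ s′ q″ s″ t u} → q , s ⇝⟨ t ⟩ q′ , s′ → q′ , s′ ⇝⟨ u ⟩ q″ , s″ → q , s ⇝⟨ t + u ⟩ q″ , s″
  done   ⊙ r = r
  then p ⊙ r = then (p ⊙ r)

  -- The command `c` occurs in `main` at the points `e`, and control that leaves it continues at
  -- `κ`.
  record Embeds (c : Cmd A (suc m)) (e : Point c → Point main) (κ : Maybe (Point main)) : Set where
    field
      op≡   : ∀ q → opAt main (e q) ≡ opAt c q
      goto≡ : ∀ q x → after main (e q) x ≡ maybe′ (just ∘ e) κ (after c q x)

  open Embeds

  at : ∀ {c e κ q s q″ s″ t} → Embeds c e κ →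
         maybe′ (just ∘ e) κ (after c q (answer (opAt c q) s)) , effect (opAt c q) s ⇝⟨ t ⟩ q″ , s″ →
         just (e q) , s ⇝⟨ suc t ⟩ q″ , s″
  at {q = q} {s} E p = then (subst (λ o → after main _ (answer o s) , effect o s ⇝⟨ _ ⟩ _ , _) (sym (op≡ E q))
                                 (subst (λ z → z , _ ⇝⟨ _ ⟩ _ , _) (sym (goto≡ E q _)) p))

  seqˡ : ∀ {c d e κ} → Embeds (c ⨾ d) e κ → Embeds c (e ∘ inj₁) (just (e (inj₂ (entry d))))
  seqˡ E .op≡ q = op≡ E (inj₁ q)
  seqˡ {c} E .goto≡ q x with after c q x | goto≡ E (inj₁ q) x
  ... | just _  | eq = eq
  ... | nothing | eq = eq

  seqʳ : ∀ {c d e κ} → Embeds (c ⨾ d) e κ → Embeds d (e ∘ inj₂) κ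
  seqʳ E .op≡ q = op≡ E (inj₂ q)
  seqʳ {d = d} E .goto≡ q x with after d q x | goto≡ E (inj₂ q) x
  ... | just _  | eq = eq
  ... | nothing | eq = eq

  branch : ∀ {i b r e κ} → Embeds (read i b r) e κ → ∀ x →
           Embeds (b x) (λ q → e (inj₂ (x , q))) (if r x then just (e (inj₁ tt)) else κ)
  branch E x .op≡ q = op≡ E (inj₂ (x , q))
  branch {b = b} {r} E x .goto≡ q y with after (b x) q y | goto≡ E (inj₂ (x , q)) y
  ... | just _  | eq = eq
  ... | nothing | eq with r x
  ...   | true  = eq
  ...   | false = eq

  -- Induction on the evaluation and not on the command, since a loop re-enters the same `read`;
  -- there `branch` makes the entry of the `read` the exit of its body.
  follow : ∀ {c e κ s s′ t} → c ⊢ s ⇓ s′ ⟨ t ⟩ → Embeds c e κ → just (e (entry c)) , s ⇝⟨ t ⟩ κ , s′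
  follow skip⇓        E = at E done
  follow push⇓        E = at E done
  follow (p ⨾⇓ q)     E = follow p (seqˡ E) ⊙ follow q (seqʳ E)
  follow (exit⇓ eq p) E = at E (subst (λ z → _ , _ ⇝⟨ _ ⟩ z , _) (cong (if_then _ else _) eq) (follow p (branch E _)))
  follow (loop⇓ eq p q) E =
    at E (subst (λ z → _ , _ ⇝⟨ _ ⟩ z , _) (cong (if_then _ else _) eq) (follow p (branch E _)) ⊙ follow q E)

  whole : Embeds main id nothing
  whole .op≡ q = refl
  whole .goto≡ q x with after main q x
  ... | just _  = refl
  ... | nothing = refl

  cmd-decides : ∀ {L : Language k} (T : Poly) (χ : List (Fin k) → Bool) →
    (∀ w → ∃[ t ] ∃[ s ] (main ⊢ map inp w ∷ Vec.replicate m [] ⇓ s ⟨ t ⟩) ×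
           accepting (head (lookup s zero)) ≡ χ w × t ≤ eval T (length w)) →
    (∀ w → (χ w ≡ true) ⇔ L w) → InP k L
  cmd-decides T χ runs = stack-decides T χ λ w →
    let t , s , r , v , t≤ = runs w in t , s , follow r whole , v , t≤

-- Data types coded as binary trees

data Tree : Set where
  leaf : Tree
  node : Tree → Tree → Tree

#_ : Tree → ℕ
# leaf     = 1
# node x y = suc (# x + # y)

1≤# : ∀ x → 1 ≤ # x
1≤# leaf       = ≤-refl
1≤# (node x y) = s≤s z≤n

data Ty : Set where
  unit bool nat : Ty
  fin           : ℕ → Ty
  list          : Ty → Ty
  _⊗_           : Ty → Ty → Ty

infixr 4 _⊗_

⟦_⟧ : Ty → Set
⟦ unit ⟧   = ⊤
⟦ bool ⟧   = Bool
⟦ nat ⟧    = ℕ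
⟦ fin j ⟧  = Fin j
⟦ list σ ⟧ = List ⟦ σ ⟧
⟦ σ ⊗ τ ⟧  = ⟦ σ ⟧ × ⟦ τ ⟧

-- Codes are shared on purpose: a number is a list of leaves, an element of `fin j` is its number,
-- Booleans agree with `fin 2`, and a nonempty list is the pair of its head and tail. Conversions
-- between these types then amount to `skip`, by `retype`.
tree : ∀ σ → ⟦ σ ⟧ → Tree
tree unit     _        = leaf
tree bool     false    = leaf
tree bool     true     = node leaf leaf
tree nat      zero     = leaf
tree nat      (suc n)  = node leaf (tree nat n)
tree (fin j)  zero     = leaf
tree (fin j)  (suc i)  = node leaf (tree (fin _) i)
tree (list σ) []       = leaf
tree (list σ) (x ∷ xs) = node (tree σ x) (tree (list σ) xs)
tree (σ ⊗ τ)  (x , y)  = node (tree σ x) (tree τ y)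

size : ∀ σ → ⟦ σ ⟧ → ℕ
size σ x = # tree σ x

-- Moving tree codes between stacks

module _ {k : ℕ} where

  private
    A = Symbol k

  -- The prefix code of a tree is self-delimiting, so a tree on top of a stack can be
  -- moved without a separator below it.
  infixr 5 _▷_ _◁_

  _▷_ _◁_ : Tree → List A → List A
  leaf     ▷ r = lf ∷ r
  node x y ▷ r = nd ∷ x ▷ y ▷ r
  leaf     ◁ r = lf ∷ r
  node x y ◁ r = y ◁ x ◁ nd ∷ r

  length-▷ : ∀ x r → length (x ▷ r) ≡ # x + length r
  length-▷ leaf       r = refl
  length-▷ (node x y) r = cong suc (begin
    length (x ▷ y ▷ r)       ≡⟨ length-▷ x _ ⟩
    # x + length (y ▷ r)     ≡⟨ cong (# x +_) (length-▷ y r) ⟩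
    # x + (# y + length r)   ≡⟨ +-assoc (# x) _ _ ⟨
    # x + # y + length r     ∎)
    where open ≡-Reasoning

  pattern r0 = zero
  pattern r1 = suc zero
  pattern r2 = suc (suc zero)
  pattern r3 = suc (suc (suc zero))

  Program : Set
  Program = Cmd A 4

  infix 3 _∣_∣_∣_

  _∣_∣_∣_ : List A → List A → List A → List A → Stacks A 4
  a ∣ b ∣ c ∣ d = a ∷ b ∷ c ∷ d ∷ []

  infix 2 _⊢_⇒_within_

  _⊢_⇒_within_ : Program → Stacks A 4 → Stacks A 4 → ℕ → Set
  p ⊢ s ⇒ s′ within n = ∃[ t ] (p ⊢ s ⇓ s′ ⟨ t ⟩) × t ≤ n

  weaken : ∀ {p s s′ m n} → m ≤ n → p ⊢ s ⇒ s′ within m → p ⊢ s ⇒ s′ within n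
  weaken m≤n (t , r , t≤) = t , r , ≤-trans t≤ m≤n

  infixr 5 _⨾⇒_

  _⨾⇒_ : ∀ {p q s s′ s″ m n} → p ⊢ s ⇒ s′ within m → q ⊢ s′ ⇒ s″ within n → p ⨾ q ⊢ s ⇒ s″ within m + n
  (t , p , t≤) ⨾⇒ (u , q , u≤) = t + u , p ⨾⇓ q , +-mono-≤ t≤ u≤

  skip⇒ : ∀ {s} → skip ⊢ s ⇒ s within 1
  skip⇒ = 1 , skip⇓ , ≤-refl

  push⇒ : ∀ {i a s} → push i a ⊢ s ⇒ pushed i a s within 1
  push⇒ = 1 , push⇓ , ≤-refl

  exit⇒ : ∀ {i b r s s′ n} → r (head (lookup s i)) ≡ false →
          b (head (lookup s i)) ⊢ popped i s ⇒ s′ within n → read i b r ⊢ s ⇒ s′ within suc n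
  exit⇒ eq (t , p , t≤) = suc t , exit⇓ eq p , s≤s t≤

  loop⇒ : ∀ {i b r s s′ s″ m n} → r (head (lookup s i)) ≡ true →
          b (head (lookup s i)) ⊢ popped i s ⇒ s′ within m → read i b r ⊢ s′ ⇒ s″ within n →
          read i b r ⊢ s ⇒ s″ within suc (m + n)
  loop⇒ eq (t , p , t≤) (u , q , u≤) = suc (t + u) , loop⇓ eq p q , s≤s (+-mono-≤ t≤ u≤)

  popAny : Program
  popAny = read r0 (λ _ → skip) (λ _ → false)

  popAny⇒ : ∀ {x a b c d} → popAny ⊢ (x ∷ a ∣ b ∣ c ∣ d) ⇒ (a ∣ b ∣ c ∣ d) within 2
  popAny⇒ = exit⇒ refl skip⇒

  isBit : Maybe A → Bool
  isBit (just lf) = true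
  isBit (just nd) = true
  isBit _         = false

  isNode : Maybe A → Bool
  isNode (just nd) = true
  isNode _         = false

  -- Stack 3 counts, in unary, the trees still to be moved.
  transfer : Maybe A → Program
  transfer (just nd) = push r1 nd ⨾ push r2 nd ⨾ push r3 nd ⨾ push r3 nd
  transfer _         = push r1 lf ⨾ push r2 lf

  takeLoop take : Program
  takeLoop = read r3 body isNode
    where
    body : Maybe A → Program
    body (just nd) = read r0 transfer (λ _ → false)
    body _         = skip
  take = push r1 mk ⨾ push r2 mk ⨾ push r3 mk ⨾ push r3 nd ⨾ takeLoop

  -- Each tree consumes one `nd` of the counter and a node puts two back for its subtrees. Symbols
  -- moved one by one arrive in reverse, which is what `◁` spells. The factor 6 covers two reads and
  -- four pushes; the arbitrary continuation lets the two subtrees be chained.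
  takeLoop⇒ : ∀ x {a b c d s n} → takeLoop ⊢ (a ∣ x ◁ b ∣ x ◁ c ∣ d) ⇒ s within n →
              takeLoop ⊢ (x ▷ a ∣ b ∣ c ∣ nd ∷ d) ⇒ s within (6 * # x + n)
  takeLoop⇒ leaf {n = n} r = weaken (+-monoˡ-≤ n (m≤m+n 4 2)) (loop⇒ refl (exit⇒ refl (push⇒ ⨾⇒ push⇒)) r)
  takeLoop⇒ (node x y) {n = n} r = weaken (≤-reflexive (lemma (# x) (# y) n))
    (loop⇒ refl (exit⇒ refl (push⇒ ⨾⇒ push⇒ ⨾⇒ push⇒ ⨾⇒ push⇒)) (takeLoop⇒ x (takeLoop⇒ y r)))
    where
    lemma : ∀ x y n → 6 + (6 * x + (6 * y + n)) ≡ 6 * suc (x + y) + n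
    lemma = solve-∀

  take⇒ : ∀ x {a b c d} → take ⊢ (x ▷ a ∣ b ∣ c ∣ d) ⇒ (a ∣ x ◁ mk ∷ b ∣ x ◁ mk ∷ c ∣ d) within (12 * # x)
  take⇒ x = weaken bound (push⇒ ⨾⇒ push⇒ ⨾⇒ push⇒ ⨾⇒ push⇒ ⨾⇒ takeLoop⇒ x (exit⇒ refl skip⇒))
    where
    open ≤-Reasoning
    -- A tree has at least one symbol, so constant overhead is absorbed into a multiple of `# x`.
    bound : 4 + (6 * # x + 2) ≤ 12 * # x
    bound = begin
      4 + (6 * # x + 2)      ≡⟨ lemma (# x) ⟩
      6 * # x + 6 * 1        ≤⟨ +-monoʳ-≤ (6 * # x) (*-monoʳ-≤ 6 (1≤# x)) ⟩
      6 * # x + 6 * # x      ≡⟨ *-distribʳ-+ (# x) 6 6 ⟨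
      12 * # x               ∎
      where
      lemma : ∀ n → 4 + (6 * n + 2) ≡ 6 * n + 6 * 1
      lemma = solve-∀

  restore discard : Fin 4 → Program
  restore i = read i body isBit
    where
    body : Maybe A → Program
    body (just lf) = push r0 lf
    body (just nd) = push r0 nd
    body _         = skip
  discard i = read i (λ _ → skip) isBit

  private
    node-bound : ∀ x y n → 2 * y + (2 * x + (2 + n)) ≡ 2 * suc (x + y) + n
    node-bound = solve-∀

    exit-bound : ∀ x → 2 * # x + 2 ≤ 4 * # x
    exit-bound x = ≤-trans (+-monoʳ-≤ (2 * # x) (*-monoʳ-≤ 2 (1≤# x))) (≤-reflexive (sym (*-distribʳ-+ (# x) 2 2)))

  restore₁-loop : ∀ x {a b c d s n} → restore r1 ⊢ (x ▷ a ∣ b ∣ c ∣ d) ⇒ s within n →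
                  restore r1 ⊢ (a ∣ x ◁ b ∣ c ∣ d) ⇒ s within (2 * # x + n)
  restore₁-loop leaf r = loop⇒ refl push⇒ r
  restore₁-loop (node x y) {n = n} r = weaken (≤-reflexive (node-bound (# x) (# y) n))
    (restore₁-loop y (restore₁-loop x (loop⇒ refl push⇒ r)))

  restore₂-loop : ∀ x {a b c d s n} → restore r2 ⊢ (x ▷ a ∣ b ∣ c ∣ d) ⇒ s within n →
                  restore r2 ⊢ (a ∣ b ∣ x ◁ c ∣ d) ⇒ s within (2 * # x + n)
  restore₂-loop leaf r = loop⇒ refl push⇒ r
  restore₂-loop (node x y) {n = n} r = weaken (≤-reflexive (node-bound (# x) (# y) n))
    (restore₂-loop y (restore₂-loop x (loop⇒ refl push⇒ r)))

  discard₁-loop : ∀ x {a b c d s n} → discard r1 ⊢ (a ∣ b ∣ c ∣ d) ⇒ s within n →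
                  discard r1 ⊢ (a ∣ x ◁ b ∣ c ∣ d) ⇒ s within (2 * # x + n)
  discard₁-loop leaf r = loop⇒ refl skip⇒ r
  discard₁-loop (node x y) {n = n} r = weaken (≤-reflexive (node-bound (# x) (# y) n))
    (discard₁-loop y (discard₁-loop x (loop⇒ refl skip⇒ r)))

  discard₂-loop : ∀ x {a b c d s n} → discard r2 ⊢ (a ∣ b ∣ c ∣ d) ⇒ s within n →
                  discard r2 ⊢ (a ∣ b ∣ x ◁ c ∣ d) ⇒ s within (2 * # x + n)
  discard₂-loop leaf r = loop⇒ refl skip⇒ r
  discard₂-loop (node x y) {n = n} r = weaken (≤-reflexive (node-bound (# x) (# y) n))
    (discard₂-loop y (discard₂-loop x (loop⇒ refl skip⇒ r)))

  restore₁⇒ : ∀ x {a b c d} → restore r1 ⊢ (a ∣ x ◁ mk ∷ b ∣ c ∣ d) ⇒ (x ▷ a ∣ b ∣ c ∣ d) within (4 * # x)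
  restore₁⇒ x = weaken (exit-bound x) (restore₁-loop x (exit⇒ refl skip⇒))

  restore₂⇒ : ∀ x {a b c d} → restore r2 ⊢ (a ∣ b ∣ x ◁ mk ∷ c ∣ d) ⇒ (x ▷ a ∣ b ∣ c ∣ d) within (4 * # x)
  restore₂⇒ x = weaken (exit-bound x) (restore₂-loop x (exit⇒ refl skip⇒))

  discard₁⇒ : ∀ x {a b c d} → discard r1 ⊢ (a ∣ x ◁ mk ∷ b ∣ c ∣ d) ⇒ (a ∣ b ∣ c ∣ d) within (4 * # x)
  discard₁⇒ x = weaken (exit-bound x) (discard₁-loop x (exit⇒ refl skip⇒))

  discard₂⇒ : ∀ x {a b c d} → discard r2 ⊢ (a ∣ b ∣ x ◁ mk ∷ c ∣ d) ⇒ (a ∣ b ∣ c ∣ d) within (4 * # x)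
  discard₂⇒ x = weaken (exit-bound x) (discard₂-loop x (exit⇒ refl skip⇒))

  -- `take` leaves reversed copies on stacks 1 and 2; the four programs differ in which copies they
  -- restore, discard or leave parked.
  dup drop stash₁ stash₂ : Program
  dup    = take ⨾ restore r1 ⨾ restore r2
  drop   = take ⨾ discard r1 ⨾ discard r2
  stash₁ = take ⨾ discard r2
  stash₂ = take ⨾ discard r1

  private
    20-bound : ∀ x → 12 * x + (4 * x + 4 * x) ≡ 20 * x
    20-bound = solve-∀

    16-bound : ∀ x → 12 * x + 4 * x ≤ 20 * x
    16-bound x = ≤-trans (≤-reflexive (sym (*-distribʳ-+ x 12 4))) (*-monoˡ-≤ x (m≤m+n 16 4))

  dup⇒ : ∀ x {a b c d} → dup ⊢ (x ▷ a ∣ b ∣ c ∣ d) ⇒ (x ▷ x ▷ a ∣ b ∣ c ∣ d) within (20 * # x)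
  dup⇒ x = weaken (≤-reflexive (20-bound (# x))) (take⇒ x ⨾⇒ restore₁⇒ x ⨾⇒ restore₂⇒ x)

  drop⇒ : ∀ x {a b c d} → drop ⊢ (x ▷ a ∣ b ∣ c ∣ d) ⇒ (a ∣ b ∣ c ∣ d) within (20 * # x)
  drop⇒ x = weaken (≤-reflexive (20-bound (# x))) (take⇒ x ⨾⇒ discard₁⇒ x ⨾⇒ discard₂⇒ x)

  stash₁⇒ : ∀ x {a b c d} → stash₁ ⊢ (x ▷ a ∣ b ∣ c ∣ d) ⇒ (a ∣ x ◁ mk ∷ b ∣ c ∣ d) within (20 * # x)
  stash₁⇒ x = weaken (16-bound (# x)) (take⇒ x ⨾⇒ discard₂⇒ x)

  stash₂⇒ : ∀ x {a b c d} → stash₂ ⊢ (x ▷ a ∣ b ∣ c ∣ d) ⇒ (a ∣ b ∣ x ◁ mk ∷ c ∣ d) within (20 * # x)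
  stash₂⇒ x = weaken (16-bound (# x)) (take⇒ x ⨾⇒ discard₁⇒ x)

  literal : Tree → Program
  literal leaf       = push r0 lf
  literal (node x y) = literal y ⨾ literal x ⨾ push r0 nd

  literal⇒ : ∀ x {a b c d} → literal x ⊢ (a ∣ b ∣ c ∣ d) ⇒ (x ▷ a ∣ b ∣ c ∣ d) within (# x)
  literal⇒ leaf       = push⇒
  literal⇒ (node x y) = weaken (≤-reflexive (lemma (# x) (# y))) (literal⇒ y ⨾⇒ literal⇒ x ⨾⇒ push⇒)
    where
    lemma : ∀ x y → y + (x + 1) ≡ suc (x + y)
    lemma = solve-∀

-- Functions computable in polynomial time

-- Whatever lies below the argument is left untouched, so that programs can be nested
-- with intermediate results stored on the stacks.
record PT (k : ℕ) (σ τ : Ty) (f : ⟦ σ ⟧ → ⟦ τ ⟧) : Set where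
  constructor polytime
  field
    prog : Program {k}
    time : Poly
    runs : ∀ x {a b c d} → prog ⊢ (tree σ x ▷ a ∣ b ∣ c ∣ d) ⇒ (tree τ (f x) ▷ a ∣ b ∣ c ∣ d)
           within eval time (size σ x)

  out : Poly
  out = time ⊞ X

  -- On otherwise empty stacks the final height is the size of the result, and `height-⇓` bounds it
  -- by time plus input size.
  size-out : ∀ x → size τ (f x) ≤ eval out (size σ x)
  size-out x with runs x {[]} {[]} {[]} {[]}
  ... | t , r , t≤ = begin
    size τ (f x)                            ≡⟨ lemma (tree τ (f x)) ⟨
    height (tree τ (f x) ▷ [] ∣ [] ∣ [] ∣ []) ≤⟨ height-⇓ r ⟩
    t + height (tree σ x ▷ [] ∣ [] ∣ [] ∣ []) ≡⟨ cong (t +_) (lemma (tree σ x)) ⟩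
    t + size σ x                            ≤⟨ +-monoˡ-≤ (size σ x) t≤ ⟩
    eval time (size σ x) + size σ x         ∎
    where
    open ≤-Reasoning
    lemma : ∀ y → height (y ▷ [] ∣ [] ∣ [] ∣ []) ≡ # y
    lemma y = trans (+-identityʳ _) (trans (length-▷ y []) (+-identityʳ _))

open PT

1≤size : ∀ σ x → 1 ≤ size σ x
1≤size σ x = 1≤# (tree σ x)

eval-∘ : ∀ p q {m n} → m ≤ eval q n → eval p m ≤ eval (p ⟪ q ⟫) n
eval-∘ p q {n = n} m≤ = ≤-trans (eval-mono p m≤) (≤-reflexive (sym (eval-⟪⟫ p q n)))

boolToFin : Bool → Fin 2
boolToFin false = zero
boolToFin true  = suc zero

byList : ∀ {A B C : Set} → (B → C) → (((A × List A) × B) → C) → List A × B → C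
byList f g ([] , r)     = f r
byList f g (x ∷ xs , r) = g ((x , xs) , r)

-- Output bounds of the step compound when iterated, so `PT-loop` asks beforehand for one bound on
-- all states that the fold passes through.
Within : ∀ {σ τ} → (⟦ σ ⊗ τ ⟧ → ⟦ τ ⟧) → ℕ → List ⟦ σ ⟧ → ⟦ τ ⟧ → Set
Within {τ = τ} f n []       s = size τ s ≤ n
Within {τ = τ} f n (x ∷ xs) s = size τ s ≤ n × Within f n xs (f (x , s))

length≤size : ∀ σ xs → length xs ≤ size (list σ) xs
length≤size σ []       = z≤n
length≤size σ (x ∷ xs) = s≤s (≤-trans (length≤size σ xs) (m≤n+m _ (size σ x)))

module _ {k : ℕ} where

  retype : ∀ {σ τ f} → (∀ x → tree τ (f x) ≡ tree σ x) → PT k σ τ f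
  retype same = polytime skip (K 1) λ x {a} {b} {c} {d} →
    subst (λ z → skip ⊢ _ ⇒ (z ▷ a ∣ b ∣ c ∣ d) within 1) (sym (same x)) skip⇒

  PT-id : ∀ {σ} → PT k σ σ id
  PT-id = retype λ _ → refl

  PT-cong : ∀ {σ τ f g} → (∀ x → f x ≡ g x) → PT k σ τ f → PT k σ τ g
  PT-cong {τ = τ} eq p = polytime (prog p) (time p) λ x {a} {b} {c} {d} →
    subst (λ z → prog p ⊢ _ ⇒ (tree τ z ▷ a ∣ b ∣ c ∣ d) within _) (eq x) (runs p x)

  infixr 9 _∙_

  _∙_ : ∀ {ρ σ τ g f} → PT k σ τ g → PT k ρ σ f → PT k ρ τ (g ∘ f)
  q ∙ p = polytime (prog p ⨾ prog q) (time p ⊞ time q ⟪ out p ⟫) λ x →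
    weaken (+-monoʳ-≤ _ (eval-∘ (time q) (out p) (size-out p x))) (runs p x ⨾⇒ runs q _)

  PT-const : ∀ {σ τ} v → PT k σ τ (λ _ → v)
  PT-const {σ} {τ} v = polytime (drop ⨾ literal (tree τ v)) (K 20 ⊠ X ⊞ K (size τ v)) λ x →
    drop⇒ (tree σ x) ⨾⇒ literal⇒ (tree τ v)

  infixr 4 _▵_

  -- The value of `p` waits above its marker on stack 1 while `q` works on the second copy; `q`
  -- leaves it intact because `runs` holds over arbitrary stack contents.
  _▵_ : ∀ {ρ σ τ f g} → PT k ρ σ f → PT k ρ τ g → PT k ρ (σ ⊗ τ) (λ x → f x , g x)
  _▵_ {ρ} {σ} {τ} {f} {g} p q = polytime
    (dup ⨾ prog p ⨾ stash₁ ⨾ prog q ⨾ restore r1 ⨾ push r0 nd)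
    (K 20 ⊠ X ⊞ (time p ⊞ (K 20 ⊠ out p ⊞ (time q ⊞ (K 4 ⊠ out p ⊞ K 1)))))
    λ x → weaken
      (+-monoʳ-≤ (20 * size ρ x) (+-monoʳ-≤ (eval (time p) (size ρ x)) (+-mono-≤ (*-monoʳ-≤ 20 (size-out p x))
        (+-monoʳ-≤ (eval (time q) (size ρ x)) (+-monoˡ-≤ 1 (*-monoʳ-≤ 4 (size-out p x)))))))
      (dup⇒ (tree ρ x) ⨾⇒ runs p x ⨾⇒ stash₁⇒ (tree σ (f x)) ⨾⇒ runs q x ⨾⇒ restore₁⇒ (tree σ (f x)) ⨾⇒ push⇒)

  PT-proj₁ : ∀ {σ τ} → PT k (σ ⊗ τ) σ proj₁
  PT-proj₁ {σ} {τ} = polytime (popAny ⨾ stash₁ ⨾ drop ⨾ restore r1) (K 2 ⊞ (K 20 ⊠ X ⊞ (K 20 ⊠ X ⊞ K 4 ⊠ X)))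
    λ (x , y) → weaken
      (+-monoʳ-≤ 2 (+-mono-≤ (*-monoʳ-≤ 20 (le₁ x y)) (+-mono-≤ (*-monoʳ-≤ 20 (le₂ x y)) (*-monoʳ-≤ 4 (le₁ x y)))))
      (popAny⇒ ⨾⇒ stash₁⇒ (tree σ x) ⨾⇒ drop⇒ (tree τ y) ⨾⇒ restore₁⇒ (tree σ x))
    where
    le₁ : ∀ x y → size σ x ≤ size (σ ⊗ τ) (x , y)
    le₁ x y = m≤n⇒m≤1+n (m≤m+n _ _)
    le₂ : ∀ x y → size τ y ≤ size (σ ⊗ τ) (x , y)
    le₂ x y = m≤n⇒m≤1+n (m≤n+m _ (size σ x))

  PT-proj₂ : ∀ {σ τ} → PT k (σ ⊗ τ) τ proj₂
  PT-proj₂ {σ} {τ} = polytime (popAny ⨾ drop) (K 2 ⊞ K 20 ⊠ X)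
    λ (x , y) → weaken (+-monoʳ-≤ 2 (*-monoʳ-≤ 20 (m≤n⇒m≤1+n (m≤m+n (size σ x) (size τ y))))) (popAny⇒ ⨾⇒ drop⇒ (tree σ x))

  -- Finite tables

  private
    casesTime : ∀ {σ τ} j {g : Fin j → ⟦ σ ⟧ → ⟦ τ ⟧} → (∀ i → PT k σ τ (g i)) → Poly
    casesTime zero    p = K 0
    casesTime (suc j) p = K 4 ⊞ (time (p zero) ⊞ casesTime j (p ∘ suc))

    cases : ∀ {σ τ} j {g : Fin j → ⟦ σ ⟧ → ⟦ τ ⟧} → (∀ i → PT k σ τ (g i)) → Program {k}
    cases zero    p = skip
    cases (suc j) p = read r0 body (λ _ → false)
      where
      body : Maybe (Symbol k) → Program
      body (just nd) = popAny ⨾ cases j (p ∘ suc)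
      body _         = prog (p zero)

    cases⇒ : ∀ {σ τ} j {g : Fin j → ⟦ σ ⟧ → ⟦ τ ⟧} (p : ∀ i → PT k σ τ (g i)) i x {a b c d} →
             cases j p ⊢ (tree (fin j) i ▷ tree σ x ▷ a ∣ b ∣ c ∣ d) ⇒ (tree τ (g i x) ▷ a ∣ b ∣ c ∣ d)
             within eval (casesTime j p) (size σ x)
    cases⇒ (suc j) p zero    x = weaken (+-mono-≤ {1} {4} (s≤s z≤n) (m≤m+n _ _)) (exit⇒ refl (runs (p zero) x))
    cases⇒ (suc j) p (suc i) x = weaken (+-mono-≤ {3} {4} (m≤m+n 3 1) (m≤n+m _ _))
      (exit⇒ refl (popAny⇒ ⨾⇒ cases⇒ j (p ∘ suc) i x))

  PT-cases : ∀ {j σ τ} {g : Fin j → ⟦ σ ⟧ → ⟦ τ ⟧} → (∀ i → PT k σ τ (g i)) →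
             PT k (fin j ⊗ σ) τ (λ (i , x) → g i x)
  PT-cases {j} {σ} {τ} p = polytime (popAny ⨾ cases j p) (K 2 ⊞ casesTime j p) λ (i , x) →
    weaken (+-monoʳ-≤ 2 (eval-mono (casesTime j p) (m≤n⇒m≤1+n (m≤n+m _ (size (fin j) i)))))
           (popAny⇒ ⨾⇒ cases⇒ j p i x)

  PT-table : ∀ {j τ} (g : Fin j → ⟦ τ ⟧) → PT k (fin j) τ g
  PT-table g = PT-cases (λ i → PT-const (g i)) ∙ (PT-id ▵ PT-const tt)

  PT-if : ∀ {ρ τ t f g} → PT k ρ bool t → PT k ρ τ f → PT k ρ τ g → PT k ρ τ (λ x → if t x then f x else g x)
  PT-if {ρ} {τ} {t} {f} {g} pt p q = PT-cong same (PT-cases {g = branches} programs ∙ (retype boolTree ∙ pt ▵ PT-id))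
    where
    branches : Fin 2 → ⟦ ρ ⟧ → ⟦ τ ⟧
    branches zero       = g
    branches (suc zero) = f
    programs : ∀ i → PT k ρ τ (branches i)
    programs zero       = q
    programs (suc zero) = p
    boolTree : ∀ b → tree (fin 2) (boolToFin b) ≡ tree bool b
    boolTree false = refl
    boolTree true  = refl
    same : ∀ x → branches (boolToFin (t x)) x ≡ (if t x then f x else g x)
    same x with t x
    ... | true  = refl
    ... | false = refl

  PT-byList : ∀ {ρ σ τ f g} → PT k ρ τ f → PT k ((σ ⊗ list σ) ⊗ ρ) τ g → PT k (list σ ⊗ ρ) τ (byList f g)
  PT-byList {ρ} {σ} {τ} {f} {g} p q = polytime (popAny ⨾ read r0 body (λ _ → false))
    (K 6 ⊞ (time p ⊞ time q)) correct
    where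
    body : Maybe (Symbol k) → Program
    -- The `nd` of the list cell has just been popped; two new ones regroup head, tail and `r` as
    -- `((x , xs) , r)`.
    body (just nd) = push r0 nd ⨾ push r0 nd ⨾ prog q
    body _         = prog p
    correct : ∀ x {a b c d} → popAny ⨾ read r0 body (λ _ → false) ⊢ (tree (list σ ⊗ ρ) x ▷ a ∣ b ∣ c ∣ d) ⇒
          (tree τ (byList f g x) ▷ a ∣ b ∣ c ∣ d) within (6 + (eval (time p) (size _ x) + eval (time q) (size _ x)))
    correct ([] , r) = weaken (+-mono-≤ {3} {6} (m≤m+n 3 3)
        (≤-trans (eval-mono (time p) (m≤n⇒m≤1+n (n≤1+n _))) (m≤m+n _ _)))
      (popAny⇒ ⨾⇒ exit⇒ refl (runs p r))
    correct (x ∷ xs , r) = weaken (+-mono-≤ {5} {6} (m≤m+n 5 1) (m≤n+m _ _))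
      (popAny⇒ ⨾⇒ exit⇒ refl (push⇒ ⨾⇒ push⇒ ⨾⇒ runs q ((x , xs) , r)))

  -- Folds

  PT-loop : ∀ {σ τ f} → PT k (σ ⊗ τ) τ f → (B : Poly) →
    (∀ xs s → Within f (eval B (size (list σ ⊗ τ) (xs , s))) xs s) →
    PT k (list σ ⊗ τ) τ (λ (xs , s) → foldl (λ s x → f (x , s)) s xs)
  PT-loop {σ} {τ} {f} p B bounded = polytime (popAny ⨾ loop) (K 4 ⊞ X ⊠ roundTime) correct
    where
    body : Maybe (Symbol k) → Program
    -- The tail lies between the head and the state. Parking head and tail on different stacks
    -- allows the head alone to be put back on the state.
    body (just nd) = stash₁ ⨾ stash₂ ⨾ restore r1 ⨾ push r0 nd ⨾ prog p ⨾ restore r2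
    body _         = skip

    loop : Program {k}
    loop = read r0 body isNode

    roundTime : Poly
    roundTime = K 1 ⊞ (K 20 ⊠ X ⊞ (K 20 ⊠ X ⊞ (K 4 ⊠ X ⊞ (K 1 ⊞ (time p ⟪ K 1 ⊞ (X ⊞ B) ⟫ ⊞ K 4 ⊠ X)))))

    arith : ∀ t n l → suc (t + (l * suc t + n)) ≡ suc l * suc t + n
    arith = solve-∀

    rounds : ∀ N xs s {a b c d} → Within f (eval B N) xs s → size (list σ) xs ≤ N →
             loop ⊢ (tree (list σ) xs ▷ tree τ s ▷ a ∣ b ∣ c ∣ d) ⇒
             (tree τ (foldl (λ s x → f (x , s)) s xs) ▷ a ∣ b ∣ c ∣ d)
             within (length xs * eval roundTime N + 2)
    rounds N []       s w le = exit⇒ refl skip⇒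
    rounds N (x ∷ xs) s (w , ws) le = weaken (≤-reflexive (arith _ 2 (length xs)))
      (loop⇒ refl (weaken
        (+-mono-≤ (*-monoʳ-≤ 20 x≤) (+-mono-≤ (*-monoʳ-≤ 20 xs≤) (+-mono-≤ (*-monoʳ-≤ 4 x≤) (+-monoʳ-≤ 1
          (+-mono-≤ (eval-∘ (time p) (K 1 ⊞ (X ⊞ B)) (s≤s (+-mono-≤ x≤ w))) (*-monoʳ-≤ 4 xs≤))))))
        (stash₁⇒ (tree σ x) ⨾⇒ stash₂⇒ (tree (list σ) xs) ⨾⇒ restore₁⇒ (tree σ x) ⨾⇒ push⇒ ⨾⇒
         runs p (x , s) ⨾⇒ restore₂⇒ (tree (list σ) xs)))
        (rounds N xs (f (x , s)) ws xs≤))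
      where
      x≤ : size σ x ≤ N
      x≤ = ≤-trans (m≤n⇒m≤1+n (m≤m+n _ _)) le
      xs≤ : size (list σ) xs ≤ N
      xs≤ = ≤-trans (m≤n⇒m≤1+n (m≤n+m _ (size σ x))) le

    correct : ∀ z {a b c d} → popAny ⨾ loop ⊢ (tree (list σ ⊗ τ) z ▷ a ∣ b ∣ c ∣ d) ⇒
          (tree τ (foldl (λ s x → f (x , s)) (proj₂ z) (proj₁ z)) ▷ a ∣ b ∣ c ∣ d)
          within (4 + size _ z * eval roundTime (size _ z))
    correct z@(xs , s) = weaken bound (popAny⇒ ⨾⇒ rounds (size _ z) xs s (bounded xs s) xs≤)
      where
      xs≤ : size (list σ) xs ≤ size (list σ ⊗ τ) (xs , s)
      xs≤ = m≤n⇒m≤1+n (m≤m+n _ _)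
      bound : 2 + (length xs * eval roundTime (size _ z) + 2) ≤ 4 + size _ z * eval roundTime (size _ z)
      bound = ≤-trans (≤-reflexive (cong (2 +_) (+-comm _ 2)))
                (+-monoʳ-≤ 4 (*-monoˡ-≤ (eval roundTime (size _ z)) (≤-trans (length≤size σ xs) xs≤)))

-- Folds of additive growth and the functions built from them

foldl-env : ∀ {A B C : Set} (f : A × B × C → C) e c xs →
            foldl (λ (e , c) x → e , f (e , x , c)) (e , c) xs ≡ (e , foldl (λ c x → f (e , x , c)) c xs)
foldl-env f e c []       = refl
foldl-env f e c (x ∷ xs) = foldl-env f e (f (e , x , c)) xs

∷-grows : ∀ {e} h a → 1 ≤ e → suc (h + a) ≤ a + (e + h)
∷-grows {e} h a 1≤e = ≤-trans (+-monoˡ-≤ (h + a) 1≤e) (≤-reflexive (arith e h a))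
  where
  arith : ∀ e h a → e + (h + a) ≡ a + (e + h)
  arith = solve-∀

size-++ : ∀ σ xs ys → size (list σ) (xs ++ ys) ≤ size (list σ) ys + size (list σ) xs
size-++ σ []       ys = m≤m+n _ 1
size-++ σ (x ∷ xs) ys = ≤-trans (s≤s (+-monoʳ-≤ (size σ x) (size-++ σ xs ys)))
                          (≤-reflexive (arith (size σ x) (size (list σ) ys) (size (list σ) xs)))
  where
  arith : ∀ x y s → suc (x + (y + s)) ≡ y + suc (x + s)
  arith = solve-∀

size-bool : ∀ b → size bool b ≤ 3
size-bool true  = ≤-refl
size-bool false = s≤s z≤n

tree-replicate : ∀ n → tree (list unit) (replicate n tt) ≡ tree nat n
tree-replicate zero    = refl
tree-replicate (suc n) = cong (node leaf) (tree-replicate n)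

tree-length : ∀ xs → tree nat (length xs) ≡ tree (list unit) xs
tree-length []       = refl
tree-length (x ∷ xs) = cong (node leaf) (tree-length xs)

byNat : ∀ {A B : Set} → (A → B) → (ℕ × A → B) → ℕ × A → B
byNat f g (zero , r)  = f r
byNat f g (suc n , r) = g (n , r)

iterate : ∀ {A : Set} → (A → A) → ℕ → A → A
iterate f zero    a = a
iterate f (suc n) a = iterate f n (f a)

isZero : ℕ → Bool
isZero zero    = true
isZero (suc _) = false

size-pred : ∀ n → size nat (pred n) ≤ size nat n
size-pred zero    = ≤-refl
size-pred (suc n) = m≤n⇒m≤1+n (n≤1+n _)

iterate-pred : ∀ m n → iterate pred n m ≡ m ∸ n
iterate-pred m zero          = refl
iterate-pred zero    (suc n) = trans (iterate-pred 0 n) (0∸n≡0 n)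
iterate-pred (suc m) (suc n) = iterate-pred m n

iterate-+ : ∀ {A : Set} (f : A → A) n a → iterate f n (f a) ≡ f (iterate f n a)
iterate-+ f zero    a = refl
iterate-+ f (suc n) a = iterate-+ f n (f a)

iterate-suc : ∀ m n → iterate suc n m ≡ n + m
iterate-suc m zero    = refl
iterate-suc m (suc n) = trans (iterate-+ suc n m) (cong suc (iterate-suc m n))

iterate-add : ∀ m n a → iterate (m +_) n a ≡ n * m + a
iterate-add m zero    a = refl
iterate-add m (suc n) a = trans (iterate-+ (m +_) n a)
  (trans (cong (m +_) (iterate-add m n a)) (sym (+-assoc m (n * m) a)))

size-+ : ∀ m n → size nat (m + n) ≤ size nat n + size nat m
size-+ zero    n = m≤m+n _ 1
size-+ (suc m) n = ≤-trans (s≤s (s≤s (size-+ m n))) (≤-reflexive (arith (size nat n) (size nat m)))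
  where
  arith : ∀ a b → 2 + (a + b) ≡ a + (2 + b)
  arith = solve-∀

infix 4 _<ℕ_ _≡ℕ_

-- Truncated subtraction is an iterated predecessor, so comparisons in this form come down to
-- `PT-iterate`.
_<ℕ_ _≡ℕ_ : ℕ → ℕ → Bool
m <ℕ n = not (isZero (n ∸ m))
m ≡ℕ n = isZero (m ∸ n) ∧ isZero (n ∸ m)

module _ {k : ℕ} where

  -- The increment `G` does not see the state, so after `l` rounds the state exceeds its initial
  -- size by at most `l` times a fixed value of `G`; this is the bound `X ⊞ X ⊠ G` given to
  -- `PT-loop`. The environment travels inside the state because a round of `PT-loop` sees nothing
  -- else besides the current element.
  PT-foldl : ∀ {ε ρ σ τ f} {e : ⟦ ρ ⟧ → ⟦ ε ⟧} {xs z} → PT k (ε ⊗ σ ⊗ τ) τ f → (G : Poly) →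
    (∀ e x a → size τ (f (e , x , a)) ≤ size τ a + eval G (size ε e + size σ x)) →
    PT k ρ ε e → PT k ρ (list σ) xs → PT k ρ τ z →
    PT k ρ τ (λ r → foldl (λ a x → f (e r , x , a)) (z r) (xs r))
  PT-foldl {ε} {ρ} {σ} {τ} {f} {e₀} {xs₀} {z₀} p G grows pe pxs pz =
    PT-cong (λ r → cong proj₂ (foldl-env f (e₀ r) (z₀ r) (xs₀ r)))
      (PT-proj₂ ∙ PT-loop round (X ⊞ X ⊠ G) bounded ∙ (pxs ▵ pe ▵ pz))
    where
    open ≤-Reasoning
    f′ : ⟦ σ ⊗ ε ⊗ τ ⟧ → ⟦ ε ⊗ τ ⟧
    f′ (x , e , a) = e , f (e , x , a)

    round : PT k (σ ⊗ ε ⊗ τ) (ε ⊗ τ) f′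
    round = PT-proj₁ ∙ PT-proj₂ ▵ p ∙ (PT-proj₁ ∙ PT-proj₂ ▵ PT-proj₁ ▵ PT-proj₂ ∙ PT-proj₂)

    within : ∀ N {M} e xs a → size ε e + size (list σ) xs ≤ N →
             size (ε ⊗ τ) (e , a) + length xs * eval G N ≤ M → Within f′ M xs (e , a)
    within N e []       a _  le = ≤-trans (m≤m+n _ _) le
    within N {M} e (x ∷ xs) a le₁ le = ≤-trans (m≤m+n _ _) le ,
      within N e xs (f (e , x , a)) (≤-trans (+-monoʳ-≤ (size ε e) (m≤n⇒m≤1+n (m≤n+m _ (size σ x)))) le₁) (begin
        suc (size ε e + size τ (f (e , x , a))) + length xs * g   ≤⟨ +-monoˡ-≤ (length xs * g) (s≤s (+-monoʳ-≤ (size ε e) step≤)) ⟩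
        suc (size ε e + (size τ a + g)) + length xs * g           ≡⟨ arith (size ε e) (size τ a) g (length xs) ⟩
        suc (size ε e + size τ a) + suc (length xs) * g           ≤⟨ le ⟩
        M                                                         ∎)
      where
      g = eval G N
      arith : ∀ e a g l → suc (e + (a + g)) + l * g ≡ suc (e + a) + suc l * g
      arith = solve-∀
      step≤ : size τ (f (e , x , a)) ≤ size τ a + g
      step≤ = ≤-trans (grows e x a) (+-monoʳ-≤ (size τ a) (eval-mono G
                (≤-trans (+-monoʳ-≤ (size ε e) (m≤n⇒m≤1+n (m≤m+n _ _))) le₁)))

    bounded : ∀ xs s → Within f′ (eval (X ⊞ X ⊠ G) (size (list σ ⊗ ε ⊗ τ) (xs , s))) xs s
    bounded xs (e , a) = within n e xs a
      (begin
        size ε e + size (list σ) xs                       ≡⟨ +-comm (size ε e) _ ⟩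
        size (list σ) xs + size ε e                       ≤⟨ +-monoʳ-≤ _ (≤-trans (m≤m+n _ (size τ a)) (n≤1+n _)) ⟩
        size (list σ) xs + suc (size ε e + size τ a)      ≤⟨ n≤1+n _ ⟩
        n                                                 ∎)
      (+-mono-≤ (≤-trans (m≤n+m _ (size (list σ) xs)) (n≤1+n _))
        (*-monoˡ-≤ (eval G n) (≤-trans (length≤size σ xs) (≤-trans (m≤m+n _ _) (n≤1+n _)))))
      where
      n = size (list σ ⊗ ε ⊗ τ) (xs , e , a)

  PT-∷ : ∀ {σ} → PT k (σ ⊗ list σ) (list σ) (λ (x , xs) → x ∷ xs)
  PT-∷ = retype λ _ → refl

  PT-reverse : ∀ {σ} → PT k (list σ) (list σ) reverse
  PT-reverse = PT-foldl (PT-∷ ∙ PT-proj₂) X (λ e x a → ∷-grows (size _ x) (size _ a) (1≤size unit e))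
                 (PT-const tt) PT-id (PT-const [])

  PT-foldr : ∀ {ε ρ σ τ f} {e : ⟦ ρ ⟧ → ⟦ ε ⟧} {xs z} → PT k (ε ⊗ σ ⊗ τ) τ f → (G : Poly) →
    (∀ e x a → size τ (f (e , x , a)) ≤ size τ a + eval G (size ε e + size σ x)) →
    PT k ρ ε e → PT k ρ (list σ) xs → PT k ρ τ z →
    PT k ρ τ (λ r → foldr (λ x a → f (e r , x , a)) (z r) (xs r))
  PT-foldr {e = e} {xs} {z} p G grows pe pxs pz =
    PT-cong (λ r → List.reverse-foldl _ (z r) (xs r)) (PT-foldl p G grows pe (PT-reverse ∙ pxs) pz)

  PT-map : ∀ {ε ρ σ τ f} {e : ⟦ ρ ⟧ → ⟦ ε ⟧} {xs} → PT k (ε ⊗ σ) τ f → PT k ρ ε e → PT k ρ (list σ) xs →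
           PT k ρ (list τ) (λ r → map (λ x → f (e r , x)) (xs r))
  PT-map {ε} {σ = σ} {τ} {f} {e} {xs} p pe pxs =
    PT-cong (λ r → same (e r) (xs r))
      (PT-foldr (PT-∷ ∙ (p ∙ (PT-proj₁ ▵ PT-proj₁ ∙ PT-proj₂) ▵ PT-proj₂ ∙ PT-proj₂)) (K 1 ⊞ out p ⟪ K 1 ⊞ X ⟫)
        (λ e x a → ≤-trans (≤-reflexive (cong suc (+-comm _ (size (list τ) a))))
          (≤-trans (≤-reflexive (sym (+-suc (size (list τ) a) _)))
            (+-monoʳ-≤ (size (list τ) a) (s≤s (≤-trans (size-out p (e , x)) (≤-reflexive (sym (eval-⟪⟫ (out p) (K 1 ⊞ X) _))))))))
        pe pxs (PT-const []))
    where
    same : ∀ e xs → foldr (λ x a → f (e , x) ∷ a) [] xs ≡ map (λ x → f (e , x)) xs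
    same e []       = refl
    same e (x ∷ xs) = cong (f (e , x) ∷_) (same e xs)

  PT-++ : ∀ {ρ σ f g} → PT k ρ (list σ) f → PT k ρ (list σ) g → PT k ρ (list σ) (λ r → f r ++ g r)
  PT-++ {σ = σ} {f} {g} p q = PT-cong (λ r → sym (List.++-is-foldr (f r) (g r)))
    (PT-foldr (PT-∷ ∙ PT-proj₂) X (λ e x a → ∷-grows (size _ x) (size _ a) (1≤size unit e)) (PT-const tt) p q)

  PT-concat : ∀ {σ} → PT k (list (list σ)) (list σ) concat
  PT-concat {σ} = PT-foldr (PT-++ PT-proj₁ PT-proj₂ ∙ PT-proj₂) X
    (λ e xs a → ≤-trans (size-++ σ xs a) (+-monoʳ-≤ (size (list σ) a) (m≤n+m _ (size unit e))))
    (PT-const tt) PT-id (PT-const [])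

  PT-concatMap : ∀ {ε ρ σ τ f} {e : ⟦ ρ ⟧ → ⟦ ε ⟧} {xs} → PT k (ε ⊗ σ) (list τ) f → PT k ρ ε e → PT k ρ (list σ) xs →
                 PT k ρ (list τ) (λ r → concatMap (λ x → f (e r , x)) (xs r))
  PT-concatMap p pe pxs = PT-concat ∙ PT-map p pe pxs

  PT-∧ : ∀ {ρ f g} → PT k ρ bool f → PT k ρ bool g → PT k ρ bool (λ r → f r ∧ g r)
  PT-∧ {f = f} {g} p q = PT-cong same (PT-if p q (PT-const false))
    where
    same : ∀ r → (if f r then g r else false) ≡ f r ∧ g r
    same r with f r
    ... | true  = refl
    ... | false = refl

  PT-not : ∀ {ρ f} → PT k ρ bool f → PT k ρ bool (not ∘ f)
  PT-not {f = f} p = PT-cong same (PT-if p (PT-const false) (PT-const true))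
    where
    same : ∀ r → (if f r then false else true) ≡ not (f r)
    same r with f r
    ... | true  = refl
    ... | false = refl

  PT-∨ : ∀ {ρ f g} → PT k ρ bool f → PT k ρ bool g → PT k ρ bool (λ r → f r ∨ g r)
  PT-∨ {f = f} {g} p q = PT-cong same (PT-if p (PT-const true) q)
    where
    same : ∀ r → (if f r then true else g r) ≡ f r ∨ g r
    same r with f r
    ... | true  = refl
    ... | false = refl

  PT-any : ∀ {ε ρ σ f} {e : ⟦ ρ ⟧ → ⟦ ε ⟧} {xs} → PT k (ε ⊗ σ) bool f → PT k ρ ε e → PT k ρ (list σ) xs →
           PT k ρ bool (λ r → any (λ x → f (e r , x)) (xs r))
  PT-any p pe pxs = PT-foldr (PT-∨ (PT-proj₁ ∙ PT-proj₂) (PT-proj₂ ∙ PT-proj₂)) (K 3)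
    (λ _ _ a → ≤-trans (size-bool _) (m≤n+m 3 (size bool a))) (PT-const tt) (PT-map p pe pxs) (PT-const false)

  PT-all : ∀ {ε ρ σ f} {e : ⟦ ρ ⟧ → ⟦ ε ⟧} {xs} → PT k (ε ⊗ σ) bool f → PT k ρ ε e → PT k ρ (list σ) xs →
           PT k ρ bool (λ r → all (λ x → f (e r , x)) (xs r))
  PT-all p pe pxs = PT-foldr (PT-∧ (PT-proj₁ ∙ PT-proj₂) (PT-proj₂ ∙ PT-proj₂)) (K 3)
    (λ _ _ a → ≤-trans (size-bool _) (m≤n+m 3 (size bool a))) (PT-const tt) (PT-map p pe pxs) (PT-const true)

  -- Arithmetic of unary numbers

  PT-suc : PT k nat nat suc
  PT-suc = retype (λ _ → refl) ∙ (PT-const {τ = unit} tt ▵ PT-id)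

  PT-ones : PT k nat (list unit) (λ n → replicate n tt)
  PT-ones = retype tree-replicate

  PT-toℕ : ∀ {j} → PT k (fin j) nat toℕ
  PT-toℕ = retype same
    where
    same : ∀ {j} (i : Fin j) → tree nat (toℕ i) ≡ tree (fin j) i
    same zero    = refl
    same (suc i) = cong (node leaf) (same i)

  PT-byNat : ∀ {ρ τ f g} → PT k ρ τ f → PT k (nat ⊗ ρ) τ g → PT k (nat ⊗ ρ) τ (byNat f g)
  PT-byNat {ρ} {τ} {f} {g} p q = PT-cong same
    (PT-byList {g = λ ((x , xs) , r) → g (length xs , r)} p (q ∙ (retype tree-length ∙ PT-proj₂ ∙ PT-proj₁ ▵ PT-proj₂)) ∙ (PT-ones ∙ PT-proj₁ ▵ PT-proj₂))
    where
    same : ∀ x → byList f (λ ((x , xs) , r) → g (length xs , r)) (replicate (proj₁ x) tt , proj₂ x) ≡ byNat f g x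
    same (zero , r)  = refl
    same (suc n , r) = cong (λ m → g (m , r)) (List.length-replicate n)

  PT-iterate : ∀ {ε ρ τ f} {e : ⟦ ρ ⟧ → ⟦ ε ⟧} {n z} → PT k (ε ⊗ τ) τ f → (G : Poly) →
    (∀ e a → size τ (f (e , a)) ≤ size τ a + eval G (size ε e)) →
    PT k ρ ε e → PT k ρ nat n → PT k ρ τ z →
    PT k ρ τ (λ r → iterate (λ a → f (e r , a)) (n r) (z r))
  PT-iterate {ε} {τ = τ} {f} {e} {n} {z} p G grows pe pn pz = PT-cong (λ r → same (e r) (n r) (z r))
    (PT-foldl (p ∙ (PT-proj₁ ▵ PT-proj₂ ∙ PT-proj₂)) G
      (λ e x a → ≤-trans (grows e a) (+-monoʳ-≤ (size τ a) (eval-mono G (m≤m+n _ (size unit x))))) pe (PT-ones ∙ pn) pz)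
    where
    same : ∀ e n z → foldl (λ a _ → f (e , a)) z (replicate n tt) ≡ iterate (λ a → f (e , a)) n z
    same e zero    z = refl
    same e (suc n) z = same e n (f (e , z))

  PT-pred : PT k nat nat pred
  PT-pred = PT-cong same (PT-byNat (PT-const zero) PT-proj₁ ∙ (PT-id ▵ PT-const {τ = unit} tt))
    where
    same : ∀ n → byNat (λ _ → 0) proj₁ (n , tt) ≡ pred n
    same zero    = refl
    same (suc n) = refl

  PT-isZero : PT k nat bool isZero
  PT-isZero = PT-cong same (PT-byNat (PT-const true) (PT-const false) ∙ (PT-id ▵ PT-const {τ = unit} tt))
    where
    same : ∀ n → byNat (λ _ → true) (λ _ → false) (n , tt) ≡ isZero n
    same zero    = refl
    same (suc n) = refl

  PT-∸ : ∀ {ρ f g} → PT k ρ nat f → PT k ρ nat g → PT k ρ nat (λ r → f r ∸ g r)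
  PT-∸ {f = f} {g} p q = PT-cong (λ r → iterate-pred (f r) (g r))
    (PT-iterate (PT-pred ∙ PT-proj₂) (K 0) (λ _ a → m≤n⇒m≤n+o _ (size-pred a)) (PT-const {τ = unit} tt) q p)

  PT-+ : ∀ {ρ f g} → PT k ρ nat f → PT k ρ nat g → PT k ρ nat (λ r → f r + g r)
  PT-+ {f = f} {g} p q = PT-cong (λ r → iterate-suc (g r) (f r))
    (PT-iterate (PT-suc ∙ PT-proj₂) (K 2) (λ _ a → ≤-reflexive (+-comm 2 (size nat a))) (PT-const {τ = unit} tt) p q)

  PT-* : ∀ {ρ f g} → PT k ρ nat f → PT k ρ nat g → PT k ρ nat (λ r → f r * g r)
  PT-* {f = f} {g} p q = PT-cong (λ r → trans (iterate-add (g r) (f r) 0) (+-identityʳ _))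
    (PT-iterate (PT-+ PT-proj₁ PT-proj₂) X (λ e a → size-+ e a) q p (PT-const 0))

  PT-^ : ∀ {ρ f} d → PT k ρ nat f → PT k ρ nat (λ r → f r ^ d)
  PT-^ zero    p = PT-const 1
  PT-^ (suc d) p = PT-* p (PT-^ d p)

  PT-length : ∀ {σ} → PT k (list σ) nat length
  PT-length = PT-foldr (PT-suc ∙ PT-proj₂ ∙ PT-proj₂) (K 2) (λ _ _ a → ≤-reflexive (+-comm 2 (size nat a)))
    (PT-const {τ = unit} tt) PT-id (PT-const 0)

  PT-<ℕ : ∀ {ρ f g} → PT k ρ nat f → PT k ρ nat g → PT k ρ bool (λ r → f r <ℕ g r)
  PT-<ℕ p q = PT-not (PT-isZero ∙ PT-∸ q p)

  PT-≡ℕ : ∀ {ρ f g} → PT k ρ nat f → PT k ρ nat g → PT k ρ bool (λ r → f r ≡ℕ g r)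
  PT-≡ℕ p q = PT-∧ (PT-isZero ∙ PT-∸ p q) (PT-isZero ∙ PT-∸ q p)

-- From polynomial-time functions to Turing machines

size-fin : ∀ {j} (i : Fin j) → size (fin j) i ≤ 2 * j
size-fin {suc j} zero    = s≤s z≤n
size-fin {suc j} (suc i) = ≤-trans (s≤s (s≤s (size-fin i))) (≤-reflexive (arith j))
  where
  arith : ∀ j → 2 + 2 * j ≡ 2 * suc j
  arith = solve-∀

module Loading {k : ℕ} where

  -- A list code grows at its front, so it has to be built from the last letter on; unloading to
  -- stack 1 brings that letter to the top.
  unload load : Program {k}
  unload = read r0 body isJust
    where
    body : Maybe (Symbol k) → Program
    body (just x) = push r1 x
    body nothing  = skip
    isJust : Maybe (Symbol k) → Bool
    isJust (just _) = true
    isJust nothing  = false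
  load = read r1 body isInput
    where
    body : Maybe (Symbol k) → Program
    body (just (inp a)) = literal (tree (fin k) a) ⨾ push r0 nd
    body _              = skip
    isInput : Maybe (Symbol k) → Bool
    isInput (just (inp a)) = true
    isInput _              = false

  unload⇒ : ∀ xs {b c d} → unload ⊢ (xs ∣ b ∣ c ∣ d) ⇒ ([] ∣ xs ʳ++ b ∣ c ∣ d) within (length xs * 2 + 2)
  unload⇒ []       = exit⇒ refl skip⇒
  unload⇒ (x ∷ xs) = loop⇒ refl push⇒ (unload⇒ xs)

  load-loop : ∀ w {v a b c d s n} → load ⊢ (tree (list (fin k)) (w ++ v) ▷ a ∣ b ∣ c ∣ d) ⇒ s within n →
              load ⊢ (tree (list (fin k)) v ▷ a ∣ map inp w ʳ++ b ∣ c ∣ d) ⇒ s within (length w * (2 + 2 * k) + n)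
  load-loop []      r = r
  load-loop (x ∷ w) {n = n} r = weaken (≤-reflexive (arith (length w * (2 + 2 * k)) (2 * k) n))
    (load-loop w (loop⇒ refl (weaken (+-monoˡ-≤ 1 (size-fin x)) (literal⇒ (tree (fin k) x) ⨾⇒ push⇒)) r))
    where
    arith : ∀ l k n → l + suc ((k + 1) + n) ≡ (2 + k) + l + n
    arith = solve-∀

  size-word : ∀ (w : List (Fin k)) → size (list (fin k)) w ≤ 1 + length w * (1 + 2 * k)
  size-word []      = ≤-refl
  size-word (a ∷ w) = s≤s (≤-trans (+-mono-≤ (size-fin a) (size-word w)) (≤-reflexive (+-suc (2 * k) _)))

-- Abstract, because normalising the machines and programs involved is infeasible.
abstract

  PT⇒InP : ∀ {k} {L : Language k} {χ} → PT k (list (fin k)) bool χ → (∀ w → χ w ≡ true ⇔ L w) → InP k L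
  PT⇒InP {k} {L} {χ} p χ⇔L = cmd-decides T χ correct χ⇔L
    where
    open Loading {k}
    main : Program {k}
    main = unload ⨾ push r0 lf ⨾ load ⨾ prog p
    open Compile main using (cmd-decides; accepting)
    S T : Poly
    S = K 1 ⊞ X ⊠ K (1 + 2 * k)
    T = (X ⊠ K 2 ⊞ K 2) ⊞ (K 1 ⊞ ((X ⊠ K (2 + 2 * k) ⊞ K 2) ⊞ time p ⟪ S ⟫))

    loaded : ∀ w → load ⊢ (lf ∷ [] ∣ map inp w ʳ++ [] ∣ [] ∣ []) ⇒ (tree (list (fin k)) w ▷ [] ∣ [] ∣ [] ∣ [])
             within (length w * (2 + 2 * k) + 2)
    loaded w = load-loop w {v = []} (subst (λ u → load ⊢ (tree (list (fin k)) u ▷ [] ∣ [] ∣ [] ∣ []) ⇒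
                                        (tree (list (fin k)) w ▷ [] ∣ [] ∣ [] ∣ []) within 2)
                                      (sym (List.++-identityʳ w)) (exit⇒ refl skip⇒))

    accepts : ∀ b → accepting (head (tree bool b ▷ [])) ≡ b
    accepts true  = refl
    accepts false = refl

    correct : ∀ w → ∃[ t ] ∃[ s ] (main ⊢ map inp w ∷ [] ∷ [] ∷ [] ∷ [] ⇓ s ⟨ t ⟩) ×
              accepting (head (lookup s zero)) ≡ χ w × t ≤ eval T (length w)
    correct w with unload⇒ (map inp w) ⨾⇒ push⇒ ⨾⇒ loaded w ⨾⇒ runs p w
    ... | t , r , t≤ = t , _ , r , accepts (χ w) , ≤-trans t≤
          (+-mono-≤ (≤-reflexive (cong (λ z → z * 2 + 2) (List.length-map inp w)))
            (+-monoʳ-≤ 1 (+-monoʳ-≤ (length w * (2 + 2 * k) + 2) (eval-∘ (time p) S (size-word w)))))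

-- Turing machines as polynomial-time functions

module Simulate {j : ℕ} (M : TM j) where

  open TM M

  sym# : ℕ
  sym# = suc (j + Γ)

  -- The first component of a state is a status: running, accepted or rejected. A halted
  -- configuration is a fixed point of `step′`, so the step can be iterated for the whole time bound
  -- however early the machine stops.
  tape state : Ty
  tape  = list (fin sym#) ⊗ list (fin sym#)
  state = fin 3 ⊗ fin nQ ⊗ tape

  code : Bool → Fin 3
  code true  = suc zero
  code false = suc (suc zero)

  moved : Fin nQ → Fin sym# → Move → ⟦ tape ⟧ → ⟦ state ⟧
  moved q x left  ([] , rs)     = zero , q , [] , x ∷ rs
  moved q x left  (l ∷ ls , rs) = zero , q , ls , l ∷ x ∷ rs
  moved q x right (ls , rs)     = zero , q , x ∷ ls , rs
  moved q x stay  (ls , rs)     = zero , q , ls , x ∷ rs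

  acted : Action (Fin nQ) (Fin sym#) → ⟦ tape ⟧ → ⟦ state ⟧
  -- Only the status is consulted after halting, so `start` is an arbitrary default.
  acted (halt b)    t = code b , start , t
  acted (go q x mv) t = moved q x mv t

  next′ : ⟦ fin nQ ⊗ tape ⟧ → ⟦ state ⟧
  next′ (q , ls , [])     = acted (δ q zero) (ls , [])
  next′ (q , ls , x ∷ rs) = acted (δ q x) (ls , rs)

  step′ : ⟦ state ⟧ → ⟦ state ⟧
  step′ (zero , c)  = next′ c
  step′ (suc i , c) = suc i , c

  accepted : Fin 3 → Bool
  accepted (suc zero) = true
  accepted _          = false

  step-halted : ∀ q ls rs {b} → step M (conf q ls rs) ≡ halted b → proj₁ (next′ (q , ls , rs)) ≡ code b
  step-halted q ls [] eq with δ q zero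
  step-halted q ls [] refl | halt b = refl
  step-halted q []       [] () | go q′ x left
  step-halted q (_ ∷ ls) [] () | go q′ x left
  step-halted q ls [] () | go q′ x right
  step-halted q ls [] () | go q′ x stay
  step-halted q ls (y ∷ rs) eq with δ q y
  step-halted q ls (y ∷ rs) refl | halt b = refl
  step-halted q []       (y ∷ rs) () | go q′ x left
  step-halted q (_ ∷ ls) (y ∷ rs) () | go q′ x left
  step-halted q ls (y ∷ rs) () | go q′ x right
  step-halted q ls (y ∷ rs) () | go q′ x stay

  step-next : ∀ q ls rs {q′ ls′ rs′} → step M (conf q ls rs) ≡ next (conf q′ ls′ rs′) →
              next′ (q , ls , rs) ≡ (zero , q′ , ls′ , rs′)
  step-next q ls [] eq with δ q zero
  step-next q [] [] refl       | go q′ x left  = refl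
  step-next q (_ ∷ ls) [] refl | go q′ x left  = refl
  step-next q ls [] refl       | go q′ x right = refl
  step-next q ls [] refl       | go q′ x stay  = refl
  step-next q ls (y ∷ rs) eq with δ q y
  step-next q [] (y ∷ rs) refl       | go q′ x left  = refl
  step-next q (_ ∷ ls) (y ∷ rs) refl | go q′ x left  = refl
  step-next q ls (y ∷ rs) refl       | go q′ x right = refl
  step-next q ls (y ∷ rs) refl       | go q′ x stay  = refl

  iterate-halted : ∀ n i c → iterate step′ n (suc i , c) ≡ (suc i , c)
  iterate-halted zero    i c = refl
  iterate-halted (suc n) i c = iterate-halted n i c

  accepted-halted : ∀ n b z → proj₁ z ≡ code b → accepted (proj₁ (iterate step′ n z)) ≡ b
  accepted-halted n true  (_ , c) refl = cong (accepted ∘ proj₁) (iterate-halted n _ c)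
  accepted-halted n false (_ , c) refl = cong (accepted ∘ proj₁) (iterate-halted n _ c)

  run-accepted : ∀ n q ls rs {b} → run M n (conf q ls rs) ≡ just b →
                 accepted (proj₁ (iterate step′ n (zero , q , ls , rs))) ≡ b
  run-accepted (suc n) q ls rs eq with step M (conf q ls rs) in e
  run-accepted (suc n) q ls rs refl | halted b            = accepted-halted n b _ (step-halted q ls rs e)
  run-accepted (suc n) q ls rs eq   | next (conf q′ l′ r′) =
    trans (cong (λ z → accepted (proj₁ (iterate step′ n z))) (step-next q ls rs e)) (run-accepted n q′ l′ r′ eq)

  used : ⟦ tape ⟧ → ℕ
  used (ls , rs) = size (list (fin sym#)) ls + size (list (fin sym#)) rs

  C : ℕ
  C = 1 + 2 * sym#

  ∷-used : ∀ x rs → size (list (fin sym#)) (x ∷ rs) ≤ C + size (list (fin sym#)) rs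
  ∷-used x rs = s≤s (+-monoˡ-≤ _ (size-fin x))

  moved-used : ∀ q x mv t → used (proj₂ (proj₂ (moved q x mv t))) ≤ C + used t
  moved-used q x left ([] , rs)     = ≤-trans (+-monoʳ-≤ 1 (∷-used x rs)) (≤-reflexive (sym (+-suc C _)))
  moved-used q x left (l ∷ ls , rs) = ≤-trans (+-monoʳ-≤ (size _ ls) (s≤s (+-monoʳ-≤ (size _ l) (∷-used x rs))))
    (≤-reflexive (arith (size _ ls) (size _ l) C (size _ rs)))
    where
    arith : ∀ a b c d → a + suc (b + (c + d)) ≡ c + (suc (b + a) + d)
    arith = solve-∀
  moved-used q x right (ls , rs)    = ≤-trans (+-monoˡ-≤ (size _ rs) (∷-used x ls)) (≤-reflexive (+-assoc C _ _))
  moved-used q x stay (ls , rs)     = ≤-trans (+-monoʳ-≤ (size _ ls) (∷-used x rs)) (≤-reflexive (arith (size _ ls) C (size _ rs)))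
    where
    arith : ∀ a c d → a + (c + d) ≡ c + (a + d)
    arith = solve-∀

  acted-used : ∀ α t → used (proj₂ (proj₂ (acted α t))) ≤ C + used t
  acted-used (halt b)    t = m≤n+m _ C
  acted-used (go q x mv) t = moved-used q x mv t

  step-used : ∀ z → used (proj₂ (proj₂ (step′ z))) ≤ C + used (proj₂ (proj₂ z))
  step-used (zero , q , ls , [])     = acted-used (δ q zero) (ls , [])
  step-used (zero , q , ls , x ∷ rs) = ≤-trans (acted-used (δ q x) (ls , rs))
    (+-monoʳ-≤ C (+-monoʳ-≤ (size _ ls) (m≤n⇒m≤1+n (m≤n+m _ (size _ x)))))
  step-used (suc i , c)              = m≤n+m _ C

  D : ℕ
  D = 9 + 2 * nQ

  size≤used : ∀ z → size state z ≤ D + used (proj₂ (proj₂ z))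
  size≤used (i , q , ls , rs) = ≤-trans
    (s≤s (+-mono-≤ (size-fin i) (s≤s (+-monoˡ-≤ (suc (used (ls , rs))) (size-fin q)))))
    (≤-reflexive (arith (2 * nQ) (used (ls , rs))))
    where
    arith : ∀ n u → 1 + (6 + (1 + (n + suc u))) ≡ 9 + n + u
    arith = solve-∀

  used≤size : ∀ z → used (proj₂ (proj₂ z)) ≤ size state z
  used≤size (i , q , ls , rs) =
    m≤n⇒m≤1+n (≤-trans (m≤n⇒m≤1+n (≤-trans (n≤1+n _) (m≤n+m _ (size _ q)))) (m≤n+m _ (size _ i)))

  -- A step adds at most one tape cell, of size below `C`, and status and control state together
  -- with the pairing nodes fit into `D`. The growth is constant, as `PT-iterate` requires.
  step-grows : ∀ z → size state (step′ z) ≤ size state z + (D + C)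
  step-grows z = begin
    size state (step′ z)                  ≤⟨ size≤used (step′ z) ⟩
    D + used (proj₂ (proj₂ (step′ z)))    ≤⟨ +-monoʳ-≤ D (step-used z) ⟩
    D + (C + used (proj₂ (proj₂ z)))      ≤⟨ +-monoʳ-≤ D (+-monoʳ-≤ C (used≤size z)) ⟩
    D + (C + size state z)                ≡⟨ +-assoc D C _ ⟨
    D + C + size state z                  ≡⟨ +-comm (D + C) _ ⟩
    size state z + (D + C)                ∎
    where open ≤-Reasoning

  simulation : ℕ → ℕ → List (Fin j) → Bool
  simulation c d w = accepted (proj₁ (iterate step′ (c * length w ^ d + c) (zero , start , [] , map (inSym Γ) w)))

  module _ {k : ℕ} where

    PT-moved : ∀ q x mv → PT k tape state (moved q x mv)
    PT-moved q x left = PT-cong (λ { ([] , _) → refl ; (_ ∷ _ , _) → refl })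
      (PT-byList {f = λ rs → zero , q , [] , x ∷ rs} {g = λ ((l , ls) , rs) → zero , q , ls , l ∷ x ∷ rs}
        (PT-const zero ▵ PT-const q ▵ PT-const [] ▵ PT-∷ ∙ (PT-const x ▵ PT-id))
        (PT-const zero ▵ PT-const q ▵ PT-proj₂ ∙ PT-proj₁ ▵
         PT-∷ ∙ (PT-proj₁ ∙ PT-proj₁ ▵ PT-∷ ∙ (PT-const x ▵ PT-proj₂))))
    PT-moved q x right = PT-const zero ▵ PT-const q ▵ PT-∷ ∙ (PT-const x ▵ PT-proj₁) ▵ PT-proj₂
    PT-moved q x stay  = PT-const zero ▵ PT-const q ▵ PT-proj₁ ▵ PT-∷ ∙ (PT-const x ▵ PT-proj₂)

    PT-acted : ∀ α → PT k tape state (acted α)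
    PT-acted (halt b)    = PT-const (code b) ▵ PT-const start ▵ PT-id
    PT-acted (go q x mv) = PT-moved q x mv

    -- The transition table is finite: after a case distinction on state and symbol the action is
    -- fixed in the program text.
    PT-next′ : PT k (fin nQ ⊗ tape) state next′
    PT-next′ = PT-cong (λ { (_ , _ , []) → refl ; (_ , _ , _ ∷ _) → refl })
      (PT-byList {f = λ (q , ls) → acted (δ q zero) (ls , [])} {g = λ ((x , rs) , (q , ls)) → acted (δ q x) (ls , rs)}
        (PT-cases (λ q → PT-acted (δ q zero)) ∙ (PT-proj₁ ▵ PT-proj₂ ▵ PT-const []))
        (PT-cases (λ q → PT-cases (λ x → PT-acted (δ q x))) ∙
          (PT-proj₁ ∙ PT-proj₂ ▵ PT-proj₁ ∙ PT-proj₁ ▵ PT-proj₂ ∙ PT-proj₂ ▵ PT-proj₂ ∙ PT-proj₁))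
        ∙ (PT-proj₂ ∙ PT-proj₂ ▵ PT-proj₁ ▵ PT-proj₁ ∙ PT-proj₂))

    PT-step′ : PT k state state step′
    PT-step′ = PT-cong (λ { (zero , _) → refl ; (suc _ , _) → refl }) (PT-cases programs)
      where
      branches : Fin 3 → ⟦ fin nQ ⊗ tape ⟧ → ⟦ state ⟧
      branches zero    c = next′ c
      branches (suc i) c = suc i , c
      programs : ∀ i → PT k (fin nQ ⊗ tape) state (branches i)
      programs zero    = PT-next′
      programs (suc i) = PT-const (suc i) ▵ PT-id

    PT-simulation : ∀ c d → PT k (list (fin j)) bool (simulation c d)
    PT-simulation c d = PT-table accepted ∙ PT-proj₁ ∙
      PT-iterate (PT-step′ ∙ PT-proj₂) (K (D + C)) (λ _ z → step-grows z) (PT-const {τ = unit} tt)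
        (PT-+ (PT-* (PT-const c) (PT-^ d PT-length)) (PT-const c))
        (PT-const zero ▵ PT-const start ▵ PT-const [] ▵
         PT-map (PT-table (inSym Γ) ∙ PT-proj₂) (PT-const {τ = unit} tt) PT-id)

abstract

  -- The alphabet `k` of the machine that will run the program is free of `j`, since words over
  -- `Fin j` have become data; this is what lets machines over different alphabets be combined.
  InP⇒PT : ∀ {j} k {L : Language j} → InP j L →
           ∃[ χ ] PT k (list (fin j)) bool χ × (∀ w → χ w ≡ true ⇔ L w)
  InP⇒PT k {L} (M , c , d , decides) = simulation c d , PT-simulation c d , λ w →
    let b , halts , b⇔L = decides w in
    subst (λ z → z ≡ true ⇔ L w) (sym (run-accepted (c * length w ^ d + c) (TM.start M) [] (map (inSym (TM.Γ M)) w) halts)) b⇔L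
    where open Simulate M

-- Encoding and decoding lists of triples

Triple : Set
Triple = ℕ × ℕ × ℕ

triple : Ty
triple = nat ⊗ nat ⊗ nat

flat : List Triple → List ℕ
flat = concatMap λ (a , b , c) → a ∷ b ∷ c ∷ []

-- The header of an instance (vertex count, start, goal) has the shape of an edge, so an instance is
-- a nonempty list of triples.
encode : List Triple → List (Fin 2)
encode ts = concatMap encNat (flat ts)

-- Decoding reads the string from right to left; the flag reports malformed input.

bitStep : Fin 2 × Bool × List ℕ → Bool × List ℕ
bitStep (zero , ok , ns)         = ok , 0 ∷ ns
bitStep (suc zero , ok , [])     = false , []
bitStep (suc zero , ok , n ∷ ns) = ok , suc n ∷ ns

numbers : List (Fin 2) → Bool × List ℕ
numbers = foldr (λ b s → bitStep (b , s)) (true , [])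

numbers-encNat : ∀ n x → numbers (encNat n ++ x) ≡ (proj₁ (numbers x) , n ∷ proj₂ (numbers x))
numbers-encNat zero    x = refl
numbers-encNat (suc n) x rewrite numbers-encNat n x = refl

numbers-complete : ∀ ns → numbers (concatMap encNat ns) ≡ (true , ns)
numbers-complete []       = refl
numbers-complete (n ∷ ns) = trans (numbers-encNat n (concatMap encNat ns))
                                  (cong (λ z → proj₁ z , n ∷ proj₂ z) (numbers-complete ns))

-- Codes of numbers are blocks of ones closed by a zero, so the only malformed strings are those
-- that end in a one: such a one meets the empty list.
numbers-sound : ∀ x → proj₁ (numbers x) ≡ true → concatMap encNat (proj₂ (numbers x)) ≡ x
numbers-sound []             ok = refl
numbers-sound (zero ∷ x)     ok = cong (zero ∷_) (numbers-sound x ok)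
numbers-sound (suc zero ∷ x) ok with numbers x | numbers-sound x
numbers-sound (suc zero ∷ x) () | _ , []      | _
... | _ , n ∷ ns | ih = cong (suc zero ∷_) (ih ok)

-- How many numbers wait for their triple to fill up, followed by these numbers, the latest first
-- and padded with 0.
Pending : Ty
Pending = fin 3 ⊗ nat ⊗ nat

groupStep : ℕ × ⟦ Pending ⟧ × List Triple → ⟦ Pending ⟧ × List Triple
groupStep (n , (zero , _ , _) , ts)           = (suc zero , n , 0) , ts
groupStep (n , (suc zero , b , _) , ts)       = (suc (suc zero) , n , b) , ts
groupStep (n , (suc (suc zero) , b , c) , ts) = (zero , 0 , 0) , (n , b , c) ∷ ts

group : List ℕ → ⟦ Pending ⟧ × List Triple
group = foldr (λ n s → groupStep (n , s)) ((zero , 0 , 0) , [])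

isFirst : Fin 3 → Bool
isFirst zero    = true
isFirst (suc _) = false

group-complete : ∀ ts → group (flat ts) ≡ ((zero , 0 , 0) , ts)
group-complete []       = refl
group-complete (t ∷ ts) rewrite group-complete ts = refl

pending : ⟦ Pending ⟧ → List ℕ
pending (zero , _ , _)           = []
pending (suc zero , b , _)       = b ∷ []
pending (suc (suc zero) , b , c) = b ∷ c ∷ []

group-sound : ∀ ns → pending (proj₁ (group ns)) ++ flat (proj₂ (group ns)) ≡ ns
group-sound []       = refl
group-sound (n ∷ ns) with group ns | group-sound ns
... | (zero , _ , _) , ts           | refl = refl
... | (suc zero , _ , _) , ts       | refl = refl
... | (suc (suc zero) , _ , _) , ts | refl = refl

decode : List (Fin 2) → Bool × List Triple
decode x = proj₁ (numbers x) ∧ isFirst (proj₁ (proj₁ (group (proj₂ (numbers x))))) , proj₂ (group (proj₂ (numbers x)))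

decode-encode : ∀ ts → decode (encode ts) ≡ (true , ts)
decode-encode ts rewrite numbers-complete (flat ts) | group-complete ts = refl

∧-true : ∀ a {b} → a ∧ b ≡ true → a ≡ true × b ≡ true
∧-true true eq = refl , eq

-- The counterpart of `decode-encode` that makes the flag an exact test: strings that encode nothing
-- are not in `DAGREACH` and have to be rejected.
encode-decode : ∀ x → proj₁ (decode x) ≡ true → encode (proj₂ (decode x)) ≡ x
encode-decode x ok with ∧-true (proj₁ (numbers x)) ok
... | ok₁ , ok₂ with group (proj₂ (numbers x)) | group-sound (proj₂ (numbers x))
...   | (zero , _ , _) , ts | eq = trans (cong (concatMap encNat) eq) (numbers-sound x ok₁)

module _ {k : ℕ} where

  PT-encNat : PT k nat (list (fin 2)) encNat
  PT-encNat = PT-cong (λ n → cong (_++ zero ∷ []) (List.map-replicate (λ _ → suc zero) n tt))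
    (PT-++ (PT-map (PT-const (suc zero)) (PT-const {τ = unit} tt) PT-ones) (PT-const (zero ∷ [])))

  PT-flat : PT k (list triple) (list nat) flat
  PT-flat = PT-concatMap (PT-∷ ∙ (PT-proj₁ ▵ PT-∷ ∙ (PT-proj₁ ∙ PT-proj₂ ▵ PT-∷ ∙ (PT-proj₂ ∙ PT-proj₂ ▵ PT-const []))) ∙ PT-proj₂)
    (PT-const {τ = unit} tt) PT-id

  PT-encode : PT k (list triple) (list (fin 2)) encode
  PT-encode = PT-concatMap (PT-encNat ∙ PT-proj₂) (PT-const {τ = unit} tt) PT-flat

  PT-bitStep : PT k (fin 2 ⊗ bool ⊗ list nat) (bool ⊗ list nat) bitStep
  PT-bitStep = PT-cong (λ { (zero , _) → refl ; (suc zero , _) → refl }) (PT-cases programs)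
    where
    branches : Fin 2 → ⟦ bool ⊗ list nat ⟧ → ⟦ bool ⊗ list nat ⟧
    branches i s = bitStep (i , s)
    programs : ∀ i → PT k (bool ⊗ list nat) (bool ⊗ list nat) (branches i)
    programs zero       = PT-proj₁ ▵ PT-∷ ∙ (PT-const 0 ▵ PT-proj₂)
    programs (suc zero) = PT-cong (λ { (_ , []) → refl ; (_ , _ ∷ _) → refl })
      (PT-byList {g = λ ((n , ns) , ok) → ok , suc n ∷ ns} (PT-const (false , []))
        (PT-proj₂ ▵ PT-∷ ∙ (PT-suc ∙ PT-proj₁ ∙ PT-proj₁ ▵ PT-proj₂ ∙ PT-proj₁)) ∙ (PT-proj₂ ▵ PT-proj₁))

  PT-numbers : PT k (list (fin 2)) (bool ⊗ list nat) numbers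
  PT-numbers = PT-foldr (PT-bitStep ∙ PT-proj₂) (K 2) grows (PT-const {τ = unit} tt) PT-id (PT-const (true , []))
    where
    grows : ∀ (e : ⊤) b s → size (bool ⊗ list nat) (bitStep (b , s)) ≤ size (bool ⊗ list nat) s + 2
    grows e zero       (ok , ns)     = ≤-reflexive (arith (size bool ok) (size (list nat) ns))
      where
      arith : ∀ o s → suc (o + (2 + s)) ≡ suc (o + s) + 2
      arith = solve-∀
    grows e (suc zero) (ok , [])     = ≤-trans (s≤s (+-monoˡ-≤ 1 (1≤size bool ok))) (m≤m+n _ 2)
    grows e (suc zero) (ok , n ∷ ns) = ≤-reflexive (arith (size bool ok) (size nat n) (size (list nat) ns))
      where
      arith : ∀ o n s → suc (o + suc (suc (suc n) + s)) ≡ suc (o + suc (n + s)) + 2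
      arith = solve-∀

  PT-groupStep : PT k (nat ⊗ Pending ⊗ list triple) (Pending ⊗ list triple) groupStep
  PT-groupStep = PT-cong (λ { (_ , (zero , _) , _) → refl ; (_ , (suc zero , _) , _) → refl ; (_ , (suc (suc zero) , _) , _) → refl })
    (PT-cases programs ∙ (PT-proj₁ ∙ PT-proj₁ ∙ PT-proj₂ ▵ PT-proj₁ ▵ PT-proj₂ ∙ PT-proj₁ ∙ PT-proj₂ ▵ PT-proj₂ ∙ PT-proj₂))
    where
    branches : Fin 3 → ⟦ nat ⊗ (nat ⊗ nat) ⊗ list triple ⟧ → ⟦ Pending ⊗ list triple ⟧
    branches i (n , p , ts) = groupStep (n , (i , p) , ts)
    programs : ∀ i → PT k (nat ⊗ (nat ⊗ nat) ⊗ list triple) (Pending ⊗ list triple) (branches i)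
    programs zero             = (PT-const (suc zero) ▵ PT-proj₁ ▵ PT-const 0) ▵ PT-proj₂ ∙ PT-proj₂
    programs (suc zero)       = (PT-const (suc (suc zero)) ▵ PT-proj₁ ▵ PT-proj₁ ∙ PT-proj₁ ∙ PT-proj₂) ▵ PT-proj₂ ∙ PT-proj₂
    programs (suc (suc zero)) = PT-const (zero , 0 , 0) ▵ PT-∷ ∙ ((PT-proj₁ ▵ PT-proj₁ ∙ PT-proj₂) ▵ PT-proj₂ ∙ PT-proj₂)

  PT-group : PT k (list nat) (Pending ⊗ list triple) group
  PT-group = PT-foldr (PT-groupStep ∙ PT-proj₂) (K 9 ⊞ X) grows (PT-const {τ = unit} tt) PT-id (PT-const ((zero , 0 , 0) , []))
    where
    open ≤-Reasoning
    grows : ∀ (e : ⊤) n s → size (Pending ⊗ list triple) (groupStep (n , s)) ≤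
            size (Pending ⊗ list triple) s + (9 + (1 + size nat n))
    grows e n ((zero , b , c) , ts) = begin
      suc (suc (3 + suc (size nat n + 1)) + l)                 ≤⟨ m≤n+m _ (size nat b + size nat c + 7) ⟩
      (size nat b + size nat c + 7) + suc (suc (3 + suc (size nat n + 1)) + l) ≡⟨ arith (size nat b) (size nat c) (size nat n) l ⟩
      suc (suc (1 + suc (size nat b + size nat c)) + l) + (9 + (1 + size nat n)) ∎
      where
      l = size (list triple) ts
      arith : ∀ b c n l → (b + c + 7) + suc (suc (3 + suc (n + 1)) + l) ≡ suc (suc (1 + suc (b + c)) + l) + (9 + (1 + n))
      arith = solve-∀
    grows e n ((suc zero , b , c) , ts) = begin
      suc (suc (5 + suc (size nat n + size nat b)) + l)                 ≤⟨ m≤n+m _ (size nat c + 8) ⟩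
      (size nat c + 8) + suc (suc (5 + suc (size nat n + size nat b)) + l) ≡⟨ arith (size nat b) (size nat c) (size nat n) l ⟩
      suc (suc (3 + suc (size nat b + size nat c)) + l) + (9 + (1 + size nat n)) ∎
      where
      l = size (list triple) ts
      arith : ∀ b c n l → (c + 8) + suc (suc (5 + suc (n + b)) + l) ≡ suc (suc (3 + suc (b + c)) + l) + (9 + (1 + n))
      arith = solve-∀
    grows e n ((suc (suc zero) , b , c) , ts) = begin
      suc (suc (1 + suc 2) + suc (suc (size nat n + suc (size nat b + size nat c)) + l)) ≤⟨ m≤n+m _ 9 ⟩
      9 + suc (suc (1 + suc 2) + suc (suc (size nat n + suc (size nat b + size nat c)) + l)) ≡⟨ arith (size nat b) (size nat c) (size nat n) l ⟩
      suc (suc (5 + suc (size nat b + size nat c)) + l) + (9 + (1 + size nat n)) ∎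
      where
      l = size (list triple) ts
      arith : ∀ b c n l → 9 + suc (suc (1 + suc 2) + suc (suc (n + suc (b + c)) + l)) ≡ suc (suc (5 + suc (b + c)) + l) + (9 + (1 + n))
      arith = solve-∀

  PT-decode : PT k (list (fin 2)) (bool ⊗ list triple) decode
  PT-decode = PT-∧ (PT-proj₁ ∙ PT-numbers) (PT-table isFirst ∙ PT-proj₁ ∙ PT-proj₁ ∙ PT-group ∙ PT-proj₂ ∙ PT-numbers)
            ▵ PT-proj₂ ∙ PT-group ∙ PT-proj₂ ∙ PT-numbers

-- Instances with numbers as vertices

source label target : Triple → ℕ
source (u , _ , _) = u
label  (_ , a , _) = a
target (_ , _ , v) = v

data Walk (es : List Triple) : ℕ → ℕ → List ℕ → Set where
  nil  : ∀ {u} → Walk es u u []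
  cons : ∀ {u a w v zs} → (u , a , w) ∈ es → Walk es w v zs → Walk es u v (a ∷ zs)

NoCycle : List Triple → Set
NoCycle es = ∀ u a zs → ¬ Walk es u u (a ∷ zs)

InRange : ℕ → ℕ → Triple → Set
InRange k n (u , a , v) = u < n × a < k × v < n

IsInstance : ℕ → List (Fin 2) → ℕ → ℕ → ℕ → List Triple → Set
IsInstance k x n s t es = x ≡ encode ((n , s , t) ∷ es) × s < n × t < n × All (InRange k n) es × NoCycle es

-- Labelled graphs with numbers as vertices

nums : ∀ {n k} → Fin n × Fin k × Fin n → Triple
nums (u , a , v) = toℕ u , toℕ a , toℕ v

encInstance-encode : ∀ {k} (G : LGraph k) s t →
  encInstance G s t ≡ encode ((LGraph.n G , toℕ s , toℕ t) ∷ map nums (LGraph.edges G))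
encInstance-encode G s t =
  cong (λ ns → concatMap encNat (LGraph.n G ∷ toℕ s ∷ toℕ t ∷ ns)) (same _ (λ _ → refl) (LGraph.edges G))
  where
  -- The function `f` stands for the local `edgeNums` of `encInstance`, which cannot be named here;
  -- its defining equation is all that matters.
  same : ∀ {n k} (f : Fin n × Fin k × Fin n → List ℕ) →
         (∀ e → f e ≡ source (nums e) ∷ label (nums e) ∷ target (nums e) ∷ []) →
         ∀ es → concatMap f es ≡ flat (map nums es)
  same f eq []       = refl
  same f eq (e ∷ es) = cong₂ _++_ (eq e) (same f eq es)

fromInRange : ∀ {k n} es → All (InRange k n) es → ∃[ E ] map (nums {n} {k}) E ≡ es
fromInRange []                 []                       = [] , refl
fromInRange ((u , a , v) ∷ es) ((u<n , a<k , v<n) ∷ ps) with fromInRange es ps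
... | E , eq = (fromℕ< u<n , fromℕ< a<k , fromℕ< v<n) ∷ E ,
               cong₂ _∷_ (cong₂ _,_ (toℕ-fromℕ< u<n) (cong₂ _,_ (toℕ-fromℕ< a<k) (toℕ-fromℕ< v<n))) eq

inRange-nums : ∀ {k n} (E : List (Fin n × Fin k × Fin n)) → All (InRange k n) (map nums E)
inRange-nums E = All.map⁺ (All.tabulate λ {(u , a , v)} _ → toℕ<n u , toℕ<n a , toℕ<n v)

module _ {k : ℕ} (G : LGraph k) where

  open LGraph G

  Path⇒Walk : ∀ {u v ys} → Path G u v ys → Walk (map nums edges) (toℕ u) (toℕ v) (map toℕ ys)
  Path⇒Walk nil        = nil
  Path⇒Walk (cons e p) = cons (∈-map⁺ nums e) (Path⇒Walk p)

  Walk⇒Path : ∀ {i j zs} → Walk (map nums edges) i j zs → ∀ u → toℕ u ≡ i →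
              ∃[ v ] ∃[ ys ] toℕ v ≡ j × map toℕ ys ≡ zs × Path G u v ys
  Walk⇒Path nil        u eq = u , [] , eq , refl , nil
  Walk⇒Path (cons e p) u eq with ∈-map⁻ nums e
  ... | (u′ , a , w) , e′ , refl with toℕ-injective eq | Walk⇒Path p w refl
  ...   | refl | v , ys , eqv , refl , q = v , a ∷ ys , eqv , refl , cons e′ q

  Acyclic⇒NoCycle : Acyclic G → NoCycle (map nums edges)
  Acyclic⇒NoCycle acyclic _ _ _ p@(cons e _) with ∈-map⁻ nums e
  ... | (u , _ , _) , _ , refl with Walk⇒Path p u refl
  ...   | v , b ∷ ys , eq , _ , q with toℕ-injective eq
  ...     | refl = acyclic u b ys q

  NoCycle⇒Acyclic : NoCycle (map nums edges) → Acyclic G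
  NoCycle⇒Acyclic noCycle u a ys p = noCycle _ _ _ (Path⇒Walk p)

-- Numbers in range lift to `Fin` and `toℕ` is injective, so paths and walks correspond. From here
-- on graphs are plain data that programs can handle.
DAGREACH⇔ : ∀ {k} {L : Language k} {x} → DAGREACH k L x ⇔
  (∃[ n ] ∃[ s ] ∃[ t ] ∃[ es ] IsInstance k x n s t es × ∃[ ys ] Walk es s t (map toℕ ys) × L ys)
DAGREACH⇔ {k} {L} {x} = mk⇔ to from
  where
  to : DAGREACH k L x → _
  to (G , s , t , refl , acyclic , ys , p , l) =
    LGraph.n G , toℕ s , toℕ t , map nums (LGraph.edges G) ,
    (encInstance-encode G s t , toℕ<n s , toℕ<n t , inRange-nums (LGraph.edges G) , Acyclic⇒NoCycle G acyclic) ,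
    ys , Path⇒Walk G p , l
  from : _ → DAGREACH k L x
  from (n , s , t , es , (refl , s<n , t<n , ranges , noCycle) , ys , p , l) with fromInRange es ranges
  ... | E , refl with Walk⇒Path (lgraph n E) p (fromℕ< s<n) (toℕ-fromℕ< s<n)
  ...   | v , ys′ , eqv , eqys , q =
    lgraph n E , fromℕ< s<n , v ,
    trans (cong₂ (λ s t → encode ((n , s , t) ∷ map nums E)) (sym (toℕ-fromℕ< s<n)) (sym eqv))
          (sym (encInstance-encode (lgraph n E) (fromℕ< s<n) v)) ,
    NoCycle⇒Acyclic (lgraph n E) noCycle , ys′ , q , subst L (sym (map-toℕ-injective eqys)) l
    where
    map-toℕ-injective : ∀ {ys zs : List (Fin k)} → map toℕ ys ≡ map toℕ zs → ys ≡ zs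
    map-toℕ-injective = map-injective toℕ-injective

-- Long walks and cycles

module _ {es : List Triple} where

  vertex : ∀ {u v zs} → Walk es u v zs → Fin (suc (length zs)) → ℕ
  vertex {u} p    zero    = u
  vertex (cons e p) (suc i) = vertex p i

  initial : ∀ {u v zs} (p : Walk es u v zs) i → ∃[ ys ] Walk es u (vertex p i) ys
  initial p          zero    = [] , nil
  initial (cons e p) (suc i) = _ , cons e (proj₂ (initial p i))

  segment : ∀ {u v zs} (p : Walk es u v zs) i j → i Fin.< j → ∃[ a ] ∃[ ys ] Walk es (vertex p i) (vertex p j) (a ∷ ys)
  segment (cons e p) zero    (suc j) _         = _ , _ , cons e (proj₂ (initial p j))
  segment (cons e p) (suc i) (suc j) (s≤s i<j) = segment p i j i<j

  vertex<n : ∀ {k n u v zs} → All (InRange k n) es → u < n → (p : Walk es u v zs) → ∀ i → vertex p i < n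
  vertex<n ranges u<n p          zero    = u<n
  vertex<n ranges u<n (cons e p) (suc i) = vertex<n ranges (proj₂ (proj₂ (All.lookup ranges e))) p i

  -- Pigeonhole: the walk has more than `n` positions, so two of them carry the same vertex, and the
  -- nonempty segment between them is a cycle.
  long-walk : ∀ {k n u v zs} → All (InRange k n) es → u < n → Walk es u v zs → n ≤ length zs → ¬ NoCycle es
  long-walk ranges u<n p n≤ noCycle with pigeonhole (s≤s n≤) (λ i → fromℕ< (vertex<n ranges u<n p i))
  ... | i , j , i<j , eq with segment p i j i<j
  ...   | _ , _ , q = noCycle _ _ _ (subst (λ z → Walk es (vertex p i) z _) (sym (fromℕ<-injective _ _ _ _ eq)) q)

  -- Conversely, going round a cycle gives walks of every length. The second walk is what is left of
  -- the current round; when it is used up, the cycle starts again.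
  unroll : ∀ {u a zs} → Walk es u u (a ∷ zs) → ∀ m {w ys} → Walk es w u ys → ∃[ v ] ∃[ ys′ ] length ys′ ≡ m × Walk es w v ys′
  unroll c          zero    p          = _ , [] , refl , nil
  unroll c@(cons e q) (suc m) nil      with unroll c m q
  ... | v , ys , refl , r = v , _ ∷ ys , refl , cons e r
  unroll c          (suc m) (cons e p) with unroll c m p
  ... | v , ys , refl , r = v , _ ∷ ys , refl , cons e r

-- Deciding whether a word labels a walk of an instance

<ℕ-sound : ∀ m n → (m <ℕ n) ≡ true → m < n
<ℕ-sound zero    (suc n) _  = s≤s z≤n
<ℕ-sound (suc m) (suc n) eq = s≤s (<ℕ-sound m n eq)

<ℕ-complete : ∀ {m n} → m < n → (m <ℕ n) ≡ true
<ℕ-complete {zero}  (s≤s _)   = refl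
<ℕ-complete {suc m} (s≤s m<n) = <ℕ-complete m<n

≡ℕ-sound : ∀ m n → (m ≡ℕ n) ≡ true → m ≡ n
≡ℕ-sound zero    zero    _  = refl
≡ℕ-sound (suc m) (suc n) eq = cong suc (≡ℕ-sound m n eq)

≡ℕ-refl : ∀ n → (n ≡ℕ n) ≡ true
≡ℕ-refl zero    = refl
≡ℕ-refl (suc n) = ≡ℕ-refl n

any-sound : ∀ {A : Set} (f : A → Bool) xs → any f xs ≡ true → ∃[ x ] x ∈ xs × f x ≡ true
any-sound f (x ∷ xs) eq with f x in e
... | true  = x , here refl , e
... | false with any-sound f xs eq
...   | y , y∈ , fy = y , there y∈ , fy

any-complete : ∀ {A : Set} (f : A → Bool) {x xs} → x ∈ xs → f x ≡ true → any f xs ≡ true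
any-complete f (here refl) eq rewrite eq = refl
any-complete f {xs = y ∷ _} (there x∈) eq with f y
... | true  = refl
... | false = any-complete f x∈ eq

all-sound : ∀ {A : Set} (f : A → Bool) xs → all f xs ≡ true → All (λ x → f x ≡ true) xs
all-sound f []       _  = []
all-sound f (x ∷ xs) eq with ∧-true (f x) eq
... | p , q = p ∷ all-sound f xs q

all-complete : ∀ {A : Set} (f : A → Bool) {xs} → All (λ x → f x ≡ true) xs → all f xs ≡ true
all-complete f []       = refl
all-complete f (p ∷ ps) rewrite p = all-complete f ps

≡ℕ-∈ : ∀ {n xs} → n ∈ xs → any (_≡ℕ n) xs ≡ true
≡ℕ-∈ {n} n∈ = any-complete (_≡ℕ n) n∈ (≡ℕ-refl n)

∈-≡ℕ : ∀ n xs → any (_≡ℕ n) xs ≡ true → n ∈ xs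
∈-≡ℕ n xs eq with any-sound (_≡ℕ n) xs eq
... | m , m∈ , m≡n = subst (_∈ xs) (≡ℕ-sound m n m≡n) m∈

hop : (Triple → Bool) → List ℕ → Triple → List ℕ
hop q S e = if q e ∧ any (_≡ℕ source e) S then target e ∷ [] else []

succs : (Triple → Bool) → List Triple → List ℕ → List ℕ
succs q es S = concatMap (hop q S) es

succs-sound : ∀ q es S {v} → v ∈ succs q es S → ∃[ u ] ∃[ a ] (u , a , v) ∈ es × q (u , a , v) ≡ true × u ∈ S
succs-sound q ((u , a , w) ∷ es) S v∈ with q (u , a , w) ∧ any (_≡ℕ u) S in eq
succs-sound q ((u , a , w) ∷ es) S (here refl) | true with ∧-true (q (u , a , w)) eq
... | p , r = u , a , here refl , p , ∈-≡ℕ u S r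
succs-sound q ((u , a , w) ∷ es) S (there v∈) | true with succs-sound q es S v∈
... | u′ , a′ , e , r = u′ , a′ , there e , r
succs-sound q ((u , a , w) ∷ es) S v∈ | false with succs-sound q es S v∈
... | u′ , a′ , e , r = u′ , a′ , there e , r

succs-complete : ∀ q {es S u a v} → (u , a , v) ∈ es → q (u , a , v) ≡ true → u ∈ S → v ∈ succs q es S
succs-complete q {(u , a , v) ∷ es} {S} (here refl) p u∈ rewrite p | ≡ℕ-∈ u∈ = here refl
succs-complete q {e′ ∷ es} {S} (there e) p u∈ with q e′ ∧ any (_≡ℕ source e′) S
... | true  = there (succs-complete q e p u∈)
... | false = succs-complete q e p u∈

-- The graph is run as a nondeterministic automaton: lists serve as sets of the states reachable on
-- the letters read so far.
reach : List Triple → List ℕ → List ℕ → List ℕ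
reach es = foldl λ S a → succs (λ e → label e ≡ℕ a) es S

reach-sound : ∀ es S zs {v} → v ∈ reach es S zs → ∃[ u ] u ∈ S × Walk es u v zs
reach-sound es S []       v∈ = _ , v∈ , nil
reach-sound es S (z ∷ zs) v∈ with reach-sound es _ zs v∈
... | w , w∈ , p with succs-sound _ es S w∈
...   | u , a , e , eq , u∈ with ≡ℕ-sound a z eq
...     | refl = u , u∈ , cons e p

reach-complete : ∀ {es S u v zs} → u ∈ S → Walk es u v zs → v ∈ reach es S zs
reach-complete u∈ nil        = u∈
reach-complete u∈ (cons {a = a} e p) = reach-complete (succs-complete _ e (≡ℕ-refl a) u∈) p

advanced : List Triple → List ℕ → List ℕ
advanced = succs λ _ → true

iterate-sound : ∀ es n S {v} → v ∈ iterate (advanced es) n S → ∃[ u ] ∃[ zs ] u ∈ S × length zs ≡ n × Walk es u v zs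
iterate-sound es zero    S v∈ = _ , [] , v∈ , refl , nil
iterate-sound es (suc n) S v∈ with iterate-sound es n _ v∈
... | w , zs , w∈ , refl , p with succs-sound _ es S w∈
...   | u , a , e , _ , u∈ = u , a ∷ zs , u∈ , refl , cons e p

iterate-complete : ∀ {es S u v zs} → u ∈ S → Walk es u v zs → v ∈ iterate (advanced es) (length zs) S
iterate-complete u∈ nil        = u∈
iterate-complete u∈ (cons e p) = iterate-complete (succs-complete _ e refl u∈) p

isNil : ∀ {A : Set} → List A → Bool
isNil []      = true
isNil (_ ∷ _) = false

-- The graph has a cycle if and only if it has a walk with n edges.
acyclic? : ℕ → List Triple → Bool
acyclic? n es = isNil (iterate (advanced es) n (map source es))

acyclic?-sound : ∀ n es → acyclic? n es ≡ true → NoCycle es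
acyclic?-sound n es eq _ _ _ c@(cons e _) with unroll c n c
... | v , ys , refl , p with iterate (advanced es) (length ys) (map source es) | iterate-complete (∈-map⁺ source e) p
acyclic?-sound n es () _ _ _ c@(cons e _) | v , ys , refl , p | _ ∷ _ | _

acyclic?-complete : ∀ {k} n es → All (InRange k n) es → NoCycle es → acyclic? n es ≡ true
acyclic?-complete n es ranges noCycle with iterate (advanced es) n (map source es) in eq
... | []    = refl
... | m ∷ S with iterate-sound es n (map source es) (subst (m ∈_) (sym eq) (here refl))
...   | u , zs , u∈ , refl , p with ∈-map⁻ source u∈
...     | _ , e , refl = ⊥-elim (long-walk ranges (proj₁ (All.lookup ranges e)) p ≤-refl noCycle)

true-∧ : ∀ {a b} → a ≡ true → b ≡ true → a ∧ b ≡ true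
true-∧ refl eq = eq

inRange? : ℕ → ℕ → Triple → Bool
inRange? k n (u , a , v) = (u <ℕ n) ∧ ((a <ℕ k) ∧ (v <ℕ n))

inRange?-sound : ∀ k n e → inRange? k n e ≡ true → InRange k n e
inRange?-sound k n (u , a , v) eq with ∧-true (u <ℕ n) eq
... | p , eq′ with ∧-true (a <ℕ k) eq′
...   | q , r = <ℕ-sound u n p , <ℕ-sound a k q , <ℕ-sound v n r

inRange?-complete : ∀ {k n e} → InRange k n e → inRange? k n e ≡ true
inRange?-complete (p , q , r) = true-∧ (<ℕ-complete p) (true-∧ (<ℕ-complete q) (<ℕ-complete r))

module _ (k : ℕ) where

  wellFormed? : Triple × List Triple → Bool
  wellFormed? ((n , s , t) , es) = (s <ℕ n) ∧ ((t <ℕ n) ∧ (all (inRange? k n) es ∧ acyclic? n es))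

  walks? : (Triple × List Triple) × List (Fin k) → Bool
  walks? (((n , s , t) , es) , ys) = any (_≡ℕ t) (reach es (s ∷ []) (map toℕ ys))

  passes? : (Bool × List Triple) × List (Fin k) → Bool
  passes? ((ok , ts) , ys) = ok ∧ byList (λ _ → false) (λ z → wellFormed? (proj₁ z) ∧ walks? z) (ts , ys)

  -- Everything that `DAGREACH` asks of a yield except membership in the language: a well-formed
  -- encoding, entries in range, acyclicity, and a walk with these labels from start to goal.
  accepts? : List (Fin 2) × List (Fin k) → Bool
  accepts? (x , ys) = passes? (decode x , ys)

  accepts?-sound : ∀ x ys → accepts? (x , ys) ≡ true →
    ∃[ n ] ∃[ s ] ∃[ t ] ∃[ es ] IsInstance k x n s t es × Walk es s t (map toℕ ys)
  accepts?-sound x ys eq with ∧-true (proj₁ (decode x)) eq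
  ... | ok , eq₁ with proj₂ (decode x) | encode-decode x ok
  ...   | (n , s , t) ∷ es | refl with ∧-true (wellFormed? ((n , s , t) , es)) eq₁
  ...     | wf , walks with ∧-true (s <ℕ n) wf
  ...       | s< , eq₂ with ∧-true (t <ℕ n) eq₂
  ...         | t< , eq₃ with ∧-true (all (inRange? k n) es) eq₃
  ...           | ranges , acyclic with reach-sound es (s ∷ []) (map toℕ ys) (∈-≡ℕ t _ walks)
  ...             | _ , here refl , p = n , s , t , es ,
    (refl , <ℕ-sound s n s< , <ℕ-sound t n t< , All.map (inRange?-sound k n _) (all-sound _ es ranges) ,
     acyclic?-sound n es acyclic) , p

  accepts?-complete : ∀ {x n s t es ys} → IsInstance k x n s t es → Walk es s t (map toℕ ys) → accepts? (x , ys) ≡ true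
  accepts?-complete {n = n} {s} {t} {es} {ys} (refl , s<n , t<n , ranges , noCycle) p =
    trans (cong (λ z → passes? (z , ys)) (decode-encode ((n , s , t) ∷ es)))
      (true-∧ (true-∧ (<ℕ-complete s<n) (true-∧ (<ℕ-complete t<n)
                (true-∧ (all-complete (inRange? k n) (All.map inRange?-complete ranges)) (acyclic?-complete n es ranges noCycle))))
              (≡ℕ-∈ (reach-complete (here refl) p)))

-- Every edge contributes its target at most once, however often its source occurs in `S`. The bound
-- is free of `S`, so repetitions in these lists cannot multiply from round to round.
size-succs : ∀ q es S → size (list nat) (succs q es S) ≤ size (list triple) es
size-succs q []       S = ≤-refl
size-succs q ((u , a , v) ∷ es) S with q (u , a , v) ∧ any (_≡ℕ u) S
... | true  = s≤s (+-mono-≤ (m≤n⇒m≤1+n (≤-trans (m≤n⇒m≤1+n (m≤n+m _ (size nat a))) (m≤n+m _ (size nat u)))) (size-succs q es S))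
... | false = ≤-trans (size-succs q es S) (m≤n⇒m≤1+n (m≤n+m _ (size triple (u , a , v))))

module _ {k : ℕ} where

  PT-succs : ∀ {ε q} → PT k (ε ⊗ triple) bool q →
             PT k (ε ⊗ list triple ⊗ list nat) (list nat) (λ (x , es , S) → succs (λ e → q (x , e)) es S)
  PT-succs p = PT-concatMap
    (PT-if (PT-∧ (p ∙ (PT-proj₁ ∙ PT-proj₁ ▵ PT-proj₂))
                 (PT-any (PT-≡ℕ PT-proj₂ PT-proj₁) (PT-proj₁ ∙ PT-proj₂) (PT-proj₂ ∙ PT-proj₁)))
           (PT-∷ ∙ (PT-proj₂ ∙ PT-proj₂ ∙ PT-proj₂ ▵ PT-const [])) (PT-const []))
    (PT-proj₁ ▵ PT-proj₂ ∙ PT-proj₂) (PT-proj₁ ∙ PT-proj₂)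

  PT-reach : ∀ {ρ es S zs} → PT k ρ (list triple) es → PT k ρ (list nat) S → PT k ρ (list nat) zs →
             PT k ρ (list nat) (λ r → reach (es r) (S r) (zs r))
  PT-reach pes pS pzs = PT-foldl
    (PT-succs (PT-≡ℕ (PT-proj₁ ∙ PT-proj₂ ∙ PT-proj₂) PT-proj₁) ∙ (PT-proj₁ ∙ PT-proj₂ ▵ PT-proj₁ ▵ PT-proj₂ ∙ PT-proj₂))
    X (λ es a S → ≤-trans (size-succs _ es S) (≤-trans (m≤m+n _ _) (m≤n+m _ (size (list nat) S)))) pes pzs pS

  PT-isNil : ∀ {σ} → PT k (list σ) bool isNil
  PT-isNil = PT-cong (λ { [] → refl ; (_ ∷ _) → refl })
    (PT-byList (PT-const true) (PT-const false) ∙ (PT-id ▵ PT-const {τ = unit} tt))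

  PT-acyclic? : ∀ {ρ n es} → PT k ρ nat n → PT k ρ (list triple) es → PT k ρ bool (λ r → acyclic? (n r) (es r))
  PT-acyclic? pn pes = PT-isNil ∙ PT-iterate
    (PT-succs {ε = unit} (PT-const true) ∙ (PT-const tt ▵ PT-proj₁ ▵ PT-proj₂)) X
    (λ es S → ≤-trans (size-succs _ es S) (m≤n+m _ (size (list nat) S)))
    pes pn (PT-map (PT-proj₁ ∙ PT-proj₂) (PT-const {τ = unit} tt) pes)

  PT-accepts? : ∀ j → PT k (list (fin 2) ⊗ list (fin j)) bool (accepts? j)
  PT-accepts? j = PT-∧ (PT-proj₁ ∙ PT-decode ∙ PT-proj₁)
    (PT-byList (PT-const false) (PT-∧ (PT-wellFormed? ∙ PT-proj₁) PT-walks?) ∙ (PT-proj₂ ∙ PT-decode ∙ PT-proj₁ ▵ PT-proj₂))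
    where
    PT-wellFormed? : PT k (triple ⊗ list triple) bool (wellFormed? j)
    PT-wellFormed? = PT-∧ (PT-<ℕ (PT-proj₁ ∙ PT-proj₂ ∙ PT-proj₁) n) (PT-∧ (PT-<ℕ (PT-proj₂ ∙ PT-proj₂ ∙ PT-proj₁) n)
      (PT-∧ (PT-all (PT-∧ (PT-<ℕ (PT-proj₁ ∙ PT-proj₂) PT-proj₁)
                    (PT-∧ (PT-<ℕ (PT-proj₁ ∙ PT-proj₂ ∙ PT-proj₂) (PT-const j)) (PT-<ℕ (PT-proj₂ ∙ PT-proj₂ ∙ PT-proj₂) PT-proj₁)))
                    n PT-proj₂)
            (PT-acyclic? n PT-proj₂)))
      where
      n : PT k (triple ⊗ list triple) nat (λ z → proj₁ (proj₁ z))
      n = PT-proj₁ ∙ PT-proj₁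
    PT-walks? : PT k ((triple ⊗ list triple) ⊗ list (fin j)) bool (walks? j)
    PT-walks? = PT-any (PT-≡ℕ PT-proj₂ PT-proj₁) (PT-proj₂ ∙ PT-proj₂ ∙ PT-proj₁ ∙ PT-proj₁)
      (PT-reach (PT-proj₂ ∙ PT-proj₁) (PT-∷ ∙ (PT-proj₁ ∙ PT-proj₂ ∙ PT-proj₁ ∙ PT-proj₁ ▵ PT-const []))
                (PT-map (PT-toℕ ∙ PT-proj₂) (PT-const {τ = unit} tt) PT-proj₂))

-- Verifiers: P ⊆ NP, and DAGREACH(L) in NP for L in P

prefixStep : ∀ {j} → Fin (3 + j) × List (Fin j) → List (Fin j)
prefixStep (suc (suc (suc i)) , w) = i ∷ w
prefixStep (_ , w)                 = []

-- Folding from the right, every separator or bit erases what follows it, so the letters before the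
-- first such symbol remain.
prefix : ∀ {j} → List (Fin (3 + j)) → List (Fin j)
prefix = foldr (λ x w → prefixStep (x , w)) []

prefix-pairEnc : ∀ {j} (w : List (Fin j)) y → prefix (pairEnc w y) ≡ w
prefix-pairEnc w y = lemma w
  where
  lemma : ∀ {j} (w : List (Fin j)) {y} → prefix (map (3 ↑ʳ_) w ++ zero ∷ y) ≡ w
  lemma []      = refl
  lemma (a ∷ w) = cong (a ∷_) (lemma w)

bitOf : ∀ {j} → Fin (3 + j) → List (Fin 2)
bitOf (suc zero)       = zero ∷ []
bitOf (suc (suc zero)) = suc zero ∷ []
bitOf _                = []

toBit : Bool → Fin 2
toBit false = zero
toBit true  = suc zero

bits-pairEnc : ∀ {j} (w : List (Fin j)) y → concatMap bitOf (pairEnc w y) ≡ map toBit y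
bits-pairEnc w y = lemma w (tail _ refl refl y)
  where
  lemma : ∀ {j} (w : List (Fin j)) {y z} → concatMap bitOf y ≡ z → concatMap bitOf (map (3 ↑ʳ_) w ++ zero ∷ y) ≡ z
  lemma []      eq = eq
  lemma (a ∷ w) eq = lemma w eq
  -- Stated for any `f` with the two values of the function local to `pairEnc`, which has no name
  -- outside.
  tail : ∀ {j} (f : Bool → Fin (3 + j)) → f false ≡ suc zero → f true ≡ suc (suc zero) →
         ∀ y → concatMap bitOf (map f y) ≡ map toBit y
  tail f p q []          = refl
  tail f p q (false ∷ y) rewrite p = cong (zero ∷_) (tail f p q y)
  tail f p q (true ∷ y)  rewrite q = cong (suc zero ∷_) (tail f p q y)

-- A list of length at most one in the role of an option: a number out of range yields no letter.
natToFin : ∀ k → ℕ → List (Fin k)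
natToFin zero    n       = []
natToFin (suc k) zero    = zero ∷ []
natToFin (suc k) (suc n) = map suc (natToFin k n)

natToFin-toℕ : ∀ {k} (i : Fin k) → natToFin k (toℕ i) ≡ i ∷ []
natToFin-toℕ zero    = refl
natToFin-toℕ (suc i) = cong (map suc) (natToFin-toℕ i)

-- Every certificate, malformed ones included, decodes to some word. This is sound because the
-- verifier tests the word obtained and not the certificate.
word : ∀ {j} k → List (Fin (3 + j)) → List (Fin k)
word k z = concatMap (natToFin k) (proj₂ (numbers (concatMap bitOf z)))

unary : ∀ {k} → List (Fin k) → List Bool
unary = concatMap λ a → replicate (toℕ a) true ++ false ∷ []

map-toBit-unary : ∀ {k} (ys : List (Fin k)) → map toBit (unary ys) ≡ concatMap encNat (map toℕ ys)
map-toBit-unary []       = refl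
map-toBit-unary (a ∷ ys) = trans (List.map-++ toBit (replicate (toℕ a) true ++ false ∷ []) (unary ys))
  (cong₂ _++_ (trans (List.map-++ toBit (replicate (toℕ a) true) (false ∷ []))
                     (cong (_++ zero ∷ []) (List.map-replicate toBit (toℕ a) true)))
              (map-toBit-unary ys))

word-pairEnc : ∀ {j k} (w : List (Fin j)) (ys : List (Fin k)) → word k (pairEnc w (unary ys)) ≡ ys
word-pairEnc w ys rewrite bits-pairEnc w (unary ys) | map-toBit-unary ys | numbers-complete (map toℕ ys) = lemma ys
  where
  lemma : ∀ {k} (ys : List (Fin k)) → concatMap (natToFin k) (map toℕ ys) ≡ ys
  lemma []       = refl
  lemma (a ∷ ys) rewrite natToFin-toℕ a = cong (a ∷_) (lemma ys)

length-unary : ∀ {k} (ys : List (Fin k)) → length (unary ys) ≤ length ys * k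
length-unary []           = z≤n
length-unary {k} (a ∷ ys) = begin
  length ((replicate (toℕ a) true ++ false ∷ []) ++ unary ys)        ≡⟨ List.length-++ (replicate (toℕ a) true ++ false ∷ []) ⟩
  length (replicate (toℕ a) true ++ false ∷ []) + length (unary ys)  ≤⟨ +-mono-≤ le (length-unary ys) ⟩
  k + length ys * k                                                  ∎
  where
  open ≤-Reasoning
  le : length (replicate (toℕ a) true ++ false ∷ []) ≤ k
  le = ≤-trans (≤-reflexive (trans (List.length-++ (replicate (toℕ a) true))
                 (trans (cong (_+ 1) (List.length-replicate (toℕ a))) (+-comm (toℕ a) 1)))) (toℕ<n a)

module _ {k : ℕ} where

  PT-prefix : ∀ {j} → PT k (list (fin (3 + j))) (list (fin j)) prefix
  PT-prefix {j} = PT-foldr (PT-cong same (PT-cases programs) ∙ PT-proj₂) X grows (PT-const {τ = unit} tt) PT-id (PT-const [])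
    where
    branches : Fin (3 + j) → ⟦ list (fin j) ⟧ → ⟦ list (fin j) ⟧
    branches x w = prefixStep (x , w)
    programs : ∀ x → PT k (list (fin j)) (list (fin j)) (branches x)
    programs zero                = PT-const []
    programs (suc zero)          = PT-const []
    programs (suc (suc zero))    = PT-const []
    programs (suc (suc (suc i))) = PT-∷ ∙ (PT-const i ▵ PT-id)
    same : ∀ x → branches (proj₁ x) (proj₂ x) ≡ prefixStep x
    same x = refl
    grows : ∀ (e : ⊤) x w → size (list (fin j)) (prefixStep (x , w)) ≤ size (list (fin j)) w + (1 + size (fin (3 + j)) x)
    grows e zero                w = ≤-trans (1≤size (list (fin j)) w) (m≤m+n _ _)
    grows e (suc zero)          w = ≤-trans (1≤size (list (fin j)) w) (m≤m+n _ _)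
    grows e (suc (suc zero))    w = ≤-trans (1≤size (list (fin j)) w) (m≤m+n _ _)
    grows e (suc (suc (suc i))) w = ≤-trans (≤-reflexive (cong suc (+-comm (size (fin j) i) _)))
      (≤-trans (≤-reflexive (sym (+-suc (size (list (fin j)) w) _))) (+-monoʳ-≤ (size (list (fin j)) w) (s≤s (m≤n+m _ 6))))

  PT-natToFin : ∀ j → PT k nat (list (fin j)) (natToFin j)
  PT-natToFin zero    = PT-const []
  PT-natToFin (suc j) = PT-cong (λ { zero → refl ; (suc n) → refl })
    (PT-byNat (PT-const (zero ∷ [])) (PT-map (PT-table suc ∙ PT-proj₂) (PT-const {τ = unit} tt) (PT-natToFin j ∙ PT-proj₁))
      ∙ (PT-id ▵ PT-const {τ = unit} tt))

  PT-word : ∀ {i} j → PT k (list (fin (3 + i))) (list (fin j)) (word j)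
  PT-word j = PT-concatMap (PT-natToFin j ∙ PT-proj₂) (PT-const {τ = unit} tt)
    (PT-proj₂ ∙ PT-numbers ∙ PT-concatMap (PT-table bitOf ∙ PT-proj₂) (PT-const {τ = unit} tt) PT-id)

-- The verifier applies the decision procedure to the part before the separator. The constants 0 and
-- 0 admit just the empty certificate.
InP⇒InNP : ∀ {k} {L : Language k} → InP k L → InNP k L
InP⇒InNP {k} {L} inP with InP⇒PT (3 + k) inP
... | χ , p , χ⇔L = (λ z → χ (prefix z) ≡ true) , PT⇒InP (p ∙ PT-prefix) (λ z → mk⇔ id id) , 0 , 0 , λ w → mk⇔
  (λ l → [] , z≤n , trans (cong χ (prefix-pairEnc w [])) (Equivalence.from (χ⇔L w) l))
  (λ (y , _ , eq) → Equivalence.to (χ⇔L w) (trans (cong χ (sym (prefix-pairEnc w y))) eq))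

-- Here unary notation counts: the number of vertices, hence the length of a yield, is bounded by
-- the input length.
n≤encode : ∀ n s t es → n ≤ length (encode ((n , s , t) ∷ es))
n≤encode n s t es = begin
  n                                     ≡⟨ List.length-replicate n ⟨
  length ones                           ≤⟨ m≤m+n _ 1 ⟩
  length ones + 1                       ≡⟨ List.length-++ ones ⟨
  length (encNat n)                     ≤⟨ m≤m+n _ _ ⟩
  length (encNat n) + _                 ≡⟨ List.length-++ (encNat n) ⟨
  length (encode ((n , s , t) ∷ es))    ∎
  where
  open ≤-Reasoning
  ones : List (Fin 2)
  ones = replicate n (suc zero)

DAGREACH-InNP : ∀ {k} {L : Language k} → InP k L → InNP 2 (DAGREACH k L)
DAGREACH-InNP {k} {L} inP with InP⇒PT 5 inP
-- An acyclic instance `x` has yields of at most `length x` letters, each written with at most `k`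
-- bits; so degree 1 and coefficient `k` suffice.
... | χ , p , χ⇔L = V , PT⇒InP PT-V (λ z → mk⇔ id id) , k , 1 , λ x → mk⇔ (certify x) (extract x)
  where
  verify : List (Fin 5) → Bool
  verify z = accepts? k (prefix z , word k z) ∧ χ (word k z)
  V : Language 5
  V z = verify z ≡ true
  PT-V : PT 5 (list (fin 5)) bool verify
  PT-V = PT-∧ (PT-accepts? k ∙ (PT-prefix ▵ PT-word k)) (p ∙ PT-word k)

  certify : ∀ x → DAGREACH k L x → ∃[ y ] length y ≤ k * length x ^ 1 + k × V (pairEnc x y)
  certify x reachable with Equivalence.to (DAGREACH⇔ {L = L}) reachable
  ... | n , s , t , es , inst@(eq , s<n , _ , ranges , noCycle) , ys , walk , l = unary ys , bound , holds
    where
    open ≤-Reasoning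
    short : length ys ≤ n
    short = ≮⇒≥ λ n< → long-walk ranges s<n walk (≤-trans (<⇒≤ n<) (≤-reflexive (sym (List.length-map toℕ ys)))) noCycle
    n≤ : n ≤ length x
    n≤ = ≤-trans (n≤encode n s t es) (≤-reflexive (cong length (sym eq)))
    bound : length (unary ys) ≤ k * length x ^ 1 + k
    bound = begin
      length (unary ys)       ≤⟨ length-unary ys ⟩
      length ys * k           ≤⟨ *-monoˡ-≤ k (≤-trans short n≤) ⟩
      length x * k            ≡⟨ *-comm (length x) k ⟩
      k * length x            ≡⟨ cong (k *_) (*-identityʳ (length x)) ⟨
      k * length x ^ 1        ≤⟨ m≤m+n _ k ⟩
      k * length x ^ 1 + k    ∎
    holds : V (pairEnc x (unary ys))
    holds = true-∧ (trans (cong₂ (λ u v → accepts? k (u , v)) (prefix-pairEnc x (unary ys)) (word-pairEnc x ys))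
                          (accepts?-complete k inst walk))
                   (trans (cong χ (word-pairEnc x ys)) (Equivalence.from (χ⇔L ys) l))

  extract : ∀ x → ∃[ y ] length y ≤ k * length x ^ 1 + k × V (pairEnc x y) → DAGREACH k L x
  extract x (y , _ , v) with ∧-true (accepts? k (prefix (pairEnc x y) , word k (pairEnc x y))) v
  ... | acc , inL with accepts?-sound k _ _ acc
  ...   | n , s , t , es , inst , walk = Equivalence.from (DAGREACH⇔ {L = L})
    (n , s , t , es , subst (λ z → IsInstance k z n s t es) (prefix-pairEnc x y) inst ,
     word k (pairEnc x y) , walk , Equivalence.to (χ⇔L _) inL)

-- Instances that begin with a path

-- A topological numbering: acyclicity of the constructed graphs can be checked edge by edge.
Decreasing : List Triple → Set
Decreasing = All λ e → target e < source e

walk-decreases : ∀ {es u v zs} → Decreasing es → Walk es u v zs → v ≤ u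
walk-decreases dec nil        = ≤-refl
walk-decreases dec (cons e p) = ≤-trans (walk-decreases dec p) (<⇒≤ (All.lookup dec e))

decreasing⇒NoCycle : ∀ {es} → Decreasing es → NoCycle es
decreasing⇒NoCycle dec _ _ _ (cons e p) = <⇒≱ (All.lookup dec e) (walk-decreases dec p)

walk-∷ : ∀ {e es u v zs} → Walk es u v zs → Walk (e ∷ es) u v zs
walk-∷ nil        = nil
walk-∷ (cons e p) = cons (there e) (walk-∷ p)

-- A walk that starts below the source of `e` only descends and never gets to use `e`.
walk-below : ∀ {e es u v zs} → Decreasing es → u < source e → Walk (e ∷ es) u v zs → Walk es u v zs
walk-below dec u< nil                  = nil
walk-below dec u< (cons (here refl) p) = ⊥-elim (<-irrefl refl u<)
walk-below dec u< (cons (there e) p)   = cons e (walk-below dec (<-trans (All.lookup dec e) u<) p)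

-- Vertices are numbered downwards along the path, so that a fold from the right
-- meets them in increasing order.
descend : ℕ → List Triple → List ℕ → List Triple
descend b es₀ []       = es₀
descend b es₀ (a ∷ zs) = (suc (length zs + b) , a , length zs + b) ∷ descend b es₀ zs

module _ {b : ℕ} {es₀ : List Triple} where

  descend-decreasing : Decreasing es₀ → ∀ zs → Decreasing (descend b es₀ zs)
  descend-decreasing dec []       = dec
  descend-decreasing dec (a ∷ zs) = ≤-refl ∷ descend-decreasing dec zs

  descend-source : All (λ e → source e ≤ b) es₀ → ∀ zs → All (λ e → source e ≤ length zs + b) (descend b es₀ zs)
  descend-source le []       = le
  descend-source le (a ∷ zs) = ≤-refl ∷ All.map m≤n⇒m≤1+n (descend-source le zs)

  descend-label : ∀ {k zs} → All (λ e → label e < k) es₀ → All (_< k) zs → All (λ e → label e < k) (descend b es₀ zs)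
  descend-label le []       = le
  descend-label le (l ∷ ls) = l ∷ descend-label le ls

  walk-descend : ∀ {t ys} zs → Walk es₀ b t ys → Walk (descend b es₀ zs) (length zs + b) t (zs ++ ys)
  walk-descend []       p = p
  walk-descend (a ∷ zs) p = cons (here refl) (walk-∷ (walk-descend zs p))

  -- The topmost vertex has a single outgoing edge, all other sources being smaller, so a walk from
  -- the top has to spell `zs` before it enters `es₀`. The hypothesis `t ≤ b` excludes stopping on
  -- the way.
  descend-walk : ∀ {t ys′} → Decreasing es₀ → All (λ e → source e ≤ b) es₀ → t ≤ b → ∀ zs →
                 Walk (descend b es₀ zs) (length zs + b) t ys′ → ∃[ ys ] ys′ ≡ zs ++ ys × Walk es₀ b t ys
  descend-walk dec le t≤ []       p   = _ , refl , p
  descend-walk dec le t≤ (a ∷ zs) nil = ⊥-elim (≤⇒≯ t≤ (s≤s (m≤n+m b (length zs))))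
  descend-walk dec le t≤ (a ∷ zs) (cons (here refl) p)
    with descend-walk dec le t≤ zs (walk-below (descend-decreasing dec zs) ≤-refl p)
  ... | ys , refl , q = ys , refl , q
  descend-walk dec le t≤ (a ∷ zs) (cons (there e) p) = ⊥-elim (<-irrefl refl (All.lookup (descend-source le zs) e))

instanceOf : ℕ → List Triple → List ℕ → List (Fin 2)
instanceOf b es₀ zs = encode ((suc (length zs + b) , length zs + b , 0) ∷ descend b es₀ zs)

encode-injective : ∀ ts us → encode ts ≡ encode us → ts ≡ us
encode-injective ts us eq = cong proj₂ (trans (sym (decode-encode ts)) (trans (cong decode eq) (decode-encode us)))

instanceOf-reach : ∀ {k b es₀ zs} {L : Language k} → Decreasing es₀ → All (λ e → source e ≤ b) es₀ →
  All (λ e → label e < k) es₀ → All (_< k) zs →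
  DAGREACH k L (instanceOf b es₀ zs) ⇔ (∃[ ys ] (∃[ us ] map toℕ ys ≡ zs ++ us × Walk es₀ b 0 us) × L ys)
instanceOf-reach {k} {b} {es₀} {zs} {L} dec le labels<k zs<k = mk⇔ to from
  where
  dec′ : Decreasing (descend b es₀ zs)
  dec′ = descend-decreasing dec zs
  ranges : All (InRange k (suc (length zs + b))) (descend b es₀ zs)
  -- That targets are in range follows from their lying below the sources.
  ranges = All.zipWith (λ (d , s≤ , l<) → s≤s s≤ , l< , m≤n⇒m≤1+n (≤-trans d s≤))
    (dec′ , All.zip (descend-source le zs , descend-label labels<k zs<k))
  to : DAGREACH k L (instanceOf b es₀ zs) → _
  to reachable with Equivalence.to (DAGREACH⇔ {L = L}) reachable
  ... | n , s , t , es , (eq , _) , ys , p , l with encode-injective ((suc (length zs + b) , length zs + b , 0) ∷ descend b es₀ zs) ((n , s , t) ∷ es) eq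
  ...   | refl = ys , descend-walk dec le z≤n zs p , l
  from : _ → DAGREACH k L (instanceOf b es₀ zs)
  from (ys , (us , eq , p) , l) = Equivalence.from (DAGREACH⇔ {L = L})
    (_ , _ , _ , _ , (refl , ≤-refl , s≤s z≤n , ranges , decreasing⇒NoCycle dec′) , ys ,
     subst (Walk _ _ _) (sym eq) (walk-descend zs p) , l)

-- Truncating the running vertex number at a bound taken from the environment
-- makes the growth of the fold below manifestly polynomial.
cap : ℕ → ℕ → ℕ
cap N m = N ∸ (N ∸ m)

cap-≤ : ∀ {N m} → m ≤ N → cap N m ≡ m
cap-≤ = m∸[m∸n]≡n

size-≤ : ∀ {m n} → m ≤ n → size nat m ≤ size nat n
size-≤ {n = n} z≤n = 1≤size nat n
size-≤ (s≤s m≤n)   = s≤s (s≤s (size-≤ m≤n))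

size-cap : ∀ N m → size nat (cap N m) ≤ size nat N
size-cap N m = size-≤ (m∸n≤m N (N ∸ m))

descendStep : ℕ × ℕ × ℕ × List Triple → ℕ × List Triple
descendStep (N , a , m , es) = suc m , (suc (cap N m) , a , cap N m) ∷ es

-- As `N` bounds every vertex number that occurs, `cap` acts as the identity throughout the fold.
descend-fold : ∀ N b es₀ zs → length zs + b ≤ N →
  foldr (λ a s → descendStep (N , a , s)) (b , es₀) zs ≡ (length zs + b , descend b es₀ zs)
descend-fold N b es₀ []       le = refl
descend-fold N b es₀ (a ∷ zs) le rewrite descend-fold N b es₀ zs (<⇒≤ le) | cap-≤ (<⇒≤ le) = refl

bitLabel : Bool → ℕ
bitLabel false = 1
bitLabel true  = 2

-- The edges reading # y with |y| ≤ p: the separator (label 0) leads from vertex b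
-- to any vertex j ≤ p, and the bits count down from there to vertex 0.
tailEdges : ℕ → ℕ → List Triple
tailEdges b zero    = (b , 0 , 0) ∷ []
tailEdges b (suc j) = (suc j , 1 , j) ∷ (suc j , 2 , j) ∷ (b , 0 , suc j) ∷ tailEdges b j

tailStep : ℕ × ℕ × List Triple → ℕ × List Triple
tailStep (b , j , es) =
  suc j , (suc (cap b j) , 1 , cap b j) ∷ (suc (cap b j) , 2 , cap b j) ∷ (b , 0 , suc (cap b j)) ∷ es

tail-iterate : ∀ b i j → i + j ≤ b →
  iterate (λ s → tailStep (b , s)) i (j , tailEdges b j) ≡ (i + j , tailEdges b (i + j))
tail-iterate b zero    j le = refl
tail-iterate b (suc i) j le rewrite cap-≤ (≤-trans (m≤n+m j (suc i)) le) =
  trans (tail-iterate b i (suc j) (≤-trans (≤-reflexive (+-suc i j)) le)) (cong (λ n → n , tailEdges b n) (+-suc i j))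

module _ {b : ℕ} where

  separator-∈ : ∀ {v p} → v ≤ p → (b , 0 , v) ∈ tailEdges b p
  separator-∈ {p = zero}  z≤n = here refl
  separator-∈ {p = suc p} v≤ with m≤n⇒m<n∨m≡n v≤
  ... | inj₁ (s≤s v≤p) = there (there (there (separator-∈ v≤p)))
  ... | inj₂ refl      = there (there (here refl))

  bit-∈ : ∀ {v p} c → v < p → (suc v , bitLabel c , v) ∈ tailEdges b p
  bit-∈ {p = suc p} c v< with m≤n⇒m<n∨m≡n v<
  bit-∈ c     v< | inj₁ (s≤s v<p) = there (there (there (bit-∈ c v<p)))
  bit-∈ false v< | inj₂ refl = here refl
  bit-∈ true  v< | inj₂ refl = there (here refl)

  tail-∈ : ∀ {u a v} p → (u , a , v) ∈ tailEdges b p →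
           (u ≡ b × a ≡ 0 × v ≤ p) ⊎ (u ≡ suc v × v < p × ∃[ c ] a ≡ bitLabel c)
  tail-∈ zero    (here refl)                 = inj₁ (refl , refl , z≤n)
  tail-∈ (suc p) (here refl)                 = inj₂ (refl , ≤-refl , false , refl)
  tail-∈ (suc p) (there (here refl))         = inj₂ (refl , ≤-refl , true , refl)
  tail-∈ (suc p) (there (there (here refl))) = inj₁ (refl , refl , ≤-refl)
  tail-∈ (suc p) (there (there (there e))) with tail-∈ p e
  ... | inj₁ (eq , eq′ , v≤)  = inj₁ (eq , eq′ , m≤n⇒m≤1+n v≤)
  ... | inj₂ (eq , v< , rest) = inj₂ (eq , m≤n⇒m≤1+n v< , rest)

  -- The bound `p < b` places the source of the separator edges above the whole chain, so these
  -- edges descend as well.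
  tail-decreasing : ∀ {p} → p < b → Decreasing (tailEdges b p)
  tail-decreasing {p} p<b = All.tabulate λ e → lemma (tail-∈ p e)
    where
    lemma : ∀ {u a v} → (u ≡ b × a ≡ 0 × v ≤ p) ⊎ (u ≡ suc v × v < p × ∃[ c ] a ≡ bitLabel c) → v < u
    lemma (inj₁ (refl , _ , v≤)) = ≤-trans (s≤s v≤) p<b
    lemma (inj₂ (refl , _))      = ≤-refl

  tail-source : ∀ {p} → p < b → All (λ e → source e ≤ b) (tailEdges b p)
  tail-source {p} p<b = All.tabulate λ e → lemma (tail-∈ p e)
    where
    lemma : ∀ {u a v} → (u ≡ b × a ≡ 0 × v ≤ p) ⊎ (u ≡ suc v × v < p × ∃[ c ] a ≡ bitLabel c) → u ≤ b
    lemma (inj₁ (refl , _))      = ≤-refl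
    lemma (inj₂ (refl , v< , _)) = ≤-trans v< (<⇒≤ p<b)

  tail-label : ∀ {k} p → All (λ e → label e < 3 + k) (tailEdges b p)
  tail-label {k} p = All.tabulate λ e → lemma (tail-∈ p e)
    where
    lemma : ∀ {u a v} → (u ≡ b × a ≡ 0 × v ≤ p) ⊎ (u ≡ suc v × v < p × ∃[ c ] a ≡ bitLabel c) → a < 3 + k
    lemma (inj₁ (_ , refl , _))             = s≤s z≤n
    lemma (inj₂ (_ , _ , false , refl)) = s≤s (s≤s z≤n)
    lemma (inj₂ (_ , _ , true , refl))  = s≤s (s≤s (s≤s z≤n))

  bits-walk : ∀ {p} y → length y ≤ p → Walk (tailEdges b p) (length y) 0 (map bitLabel y)
  bits-walk []      le = nil
  bits-walk (c ∷ y) le = cons (bit-∈ c le) (bits-walk y (<⇒≤ le))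

  -- Below `b` only bit edges start, and each lowers the vertex by one; the starting vertex is
  -- therefore the number of bits read.
  walk-bits : ∀ {p j us} → p < b → j ≤ p → Walk (tailEdges b p) j 0 us → ∃[ y ] length y ≡ j × us ≡ map bitLabel y
  walk-bits p<b j≤ nil = [] , refl , refl
  walk-bits {p} p<b j≤ (cons e q) with tail-∈ p e
  ... | inj₁ (refl , _) = ⊥-elim (<⇒≱ p<b j≤)
  ... | inj₂ (refl , v< , c , refl) with walk-bits p<b (<⇒≤ v<) q
  ...   | y , refl , refl = c ∷ y , refl , refl

  -- No bit edge starts at `b`, so the first edge reads the separator, and the vertex it jumps to
  -- fixes the length of the certificate.
  tail-walk : ∀ {p us} → p < b → Walk (tailEdges b p) b 0 us ⇔ (∃[ y ] length y ≤ p × us ≡ 0 ∷ map bitLabel y)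
  tail-walk {p} p<b = mk⇔ to λ { (y , le , refl) → cons (separator-∈ le) (bits-walk y le) }
    where
    to : ∀ {us} → Walk (tailEdges b p) b 0 us → ∃[ y ] length y ≤ p × us ≡ 0 ∷ map bitLabel y
    to nil = ⊥-elim (n≮0 p<b)
    to (cons e q) with tail-∈ p e
    ... | inj₁ (refl , refl , v≤) with walk-bits p<b v≤ q
    ...   | y , refl , refl = y , v≤ , refl
    to (cons e q) | inj₂ (refl , v< , _) = ⊥-elim (<⇒≱ p<b v<)

map-toℕ-pairEnc : ∀ {k} (w : List (Fin k)) y →
  map toℕ (pairEnc w y) ≡ map toℕ (map (3 ↑ʳ_) w) ++ 0 ∷ map bitLabel y
map-toℕ-pairEnc w y = trans (List.map-++ toℕ (map (3 ↑ʳ_) w) _)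
  (cong (λ us → map toℕ (map (3 ↑ʳ_) w) ++ 0 ∷ us) (same _ refl refl y))
  where
  same : ∀ {k} (f : Bool → Fin (3 + k)) → f false ≡ suc zero → f true ≡ suc (suc zero) →
         ∀ y → map toℕ (map f y) ≡ map bitLabel y
  same f p q []          = refl
  same f p q (false ∷ y) = cong₂ _∷_ (cong toℕ p) (same f p q y)
  same f p q (true ∷ y)  = cong₂ _∷_ (cong toℕ q) (same f p q y)

-- The reductions run in polynomial time

module _ {k : ℕ} where

  PT-cap : ∀ {ρ f g} → PT k ρ nat f → PT k ρ nat g → PT k ρ nat (λ r → cap (f r) (g r))
  PT-cap p q = PT-∸ p (PT-∸ p q)

  PT-descend : ∀ {ρ b es₀ zs} → PT k ρ nat b → PT k ρ (list triple) es₀ → PT k ρ (list nat) zs →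
               PT k ρ (list triple) (λ r → descend (b r) (es₀ r) (zs r))
  PT-descend {b = b} {es₀} {zs} pb pes pzs =
    PT-cong (λ r → cong proj₂ (descend-fold (length (zs r) + b r) (b r) (es₀ r) (zs r) ≤-refl))
      -- A round adds one edge: its label, two vertex numbers capped by `N`, and seven further
      -- nodes. The environment `N` is the number of the top vertex.
      (PT-proj₂ ∙ PT-foldr step′ (K 7 ⊞ K 2 ⊠ X) grows (PT-+ (PT-length ∙ pzs) pb) pzs (pb ▵ pes))
    where
    c : PT k (nat ⊗ nat ⊗ nat ⊗ list triple) nat (λ (N , a , m , es) → cap N m)
    c = PT-cap PT-proj₁ (PT-proj₁ ∙ PT-proj₂ ∙ PT-proj₂)
    step′ : PT k (nat ⊗ nat ⊗ nat ⊗ list triple) (nat ⊗ list triple) descendStep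
    step′ = PT-suc ∙ PT-proj₁ ∙ PT-proj₂ ∙ PT-proj₂ ▵
      PT-∷ ∙ ((PT-suc ∙ c ▵ PT-proj₁ ∙ PT-proj₂ ▵ c) ▵ PT-proj₂ ∙ PT-proj₂ ∙ PT-proj₂)
    open ≤-Reasoning
    arith : ∀ n a m e → suc ((2 + m) + suc (suc ((2 + n) + suc (a + n)) + e)) + a ≡ suc (m + e) + (7 + (n + a + (n + a + 0)))
    arith = solve-∀
    grows : ∀ N a s → size (nat ⊗ list triple) (descendStep (N , a , s)) ≤
            size (nat ⊗ list triple) s + (7 + 2 * (size nat N + size nat a))
    grows N a (m , es) = begin
      suc ((2 + sm) + suc (suc ((2 + sc) + suc (sa + sc)) + se))
        ≤⟨ s≤s (+-monoʳ-≤ (2 + sm) (s≤s (+-monoˡ-≤ se (s≤s (+-mono-≤ (+-monoʳ-≤ 2 le) (s≤s (+-monoʳ-≤ sa le))))))) ⟩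
      suc ((2 + sm) + suc (suc ((2 + sN) + suc (sa + sN)) + se))        ≤⟨ m≤m+n _ sa ⟩
      suc ((2 + sm) + suc (suc ((2 + sN) + suc (sa + sN)) + se)) + sa   ≡⟨ arith sN sa sm se ⟩
      suc (sm + se) + (7 + 2 * (sN + sa))                               ∎
      where
      sN = size nat N
      sa = size nat a
      sm = size nat m
      se = size (list triple) es
      sc = size nat (cap N m)
      le : sc ≤ sN
      le = size-cap N m

  PT-tailEdges : ∀ {ρ b p} → (∀ r → p r ≤ b r) → PT k ρ nat b → PT k ρ nat p →
                 PT k ρ (list triple) (λ r → tailEdges (b r) (p r))
  PT-tailEdges {b = b} {p} p≤b pb pp =
    PT-cong (λ r → cong proj₂ (trans (tail-iterate (b r) (p r) 0 (≤-trans (≤-reflexive (+-identityʳ (p r))) (p≤b r)))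
                                     (cong (λ n → n , tailEdges (b r) n) (+-identityʳ (p r)))))
      -- A round adds three edges with two vertex numbers each, all at most `b` up to a successor;
      -- this gives the factor 6, and 26 collects the constant parts.
      (PT-proj₂ ∙ PT-iterate step′ (K 26 ⊞ K 6 ⊠ X) grows pb pp
        (PT-const 0 ▵ PT-∷ ∙ ((pb ▵ PT-const 0 ▵ PT-const 0) ▵ PT-const [])))
    where
    c : PT k (nat ⊗ nat ⊗ list triple) nat (λ (b , j , es) → cap b j)
    c = PT-cap PT-proj₁ (PT-proj₁ ∙ PT-proj₂)
    step′ : PT k (nat ⊗ nat ⊗ list triple) (nat ⊗ list triple) tailStep
    step′ = PT-suc ∙ PT-proj₁ ∙ PT-proj₂ ▵
      PT-∷ ∙ ((PT-suc ∙ c ▵ PT-const 1 ▵ c) ▵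
      PT-∷ ∙ ((PT-suc ∙ c ▵ PT-const 2 ▵ c) ▵
      PT-∷ ∙ ((PT-proj₁ ▵ PT-const 0 ▵ PT-suc ∙ c) ▵ PT-proj₂ ∙ PT-proj₂)))
    open ≤-Reasoning
    total : ℕ → ℕ → ℕ → ℕ → ℕ
    total n m j e = suc ((2 + j) + suc (suc ((2 + n) + suc (3 + n)) + suc (suc ((2 + n) + suc (5 + n)) +
                      suc (suc (m + suc (1 + (2 + n))) + e))))
    arith : ∀ n j e → suc ((2 + j) + suc (suc ((2 + n) + suc (3 + n)) + suc (suc ((2 + n) + suc (5 + n)) +
                      suc (suc (n + suc (1 + (2 + n))) + e)))) ≡ suc (j + e) + (26 + 6 * n)
    arith = solve-∀
    grows : ∀ b s → size (nat ⊗ list triple) (tailStep (b , s)) ≤ size (nat ⊗ list triple) s + (26 + 6 * size nat b)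
    grows b (j , es) = begin
      total sc sb sj se  ≤⟨ s≤s (+-monoʳ-≤ (2 + sj) (s≤s (+-mono-≤ (triple≤ 3) (s≤s (+-mono-≤ (triple≤ 5)
                              (s≤s (+-monoˡ-≤ se (s≤s (+-monoʳ-≤ sb (+-monoʳ-≤ 4 le)))))))))) ⟩
      total sb sb sj se  ≡⟨ arith sb sj se ⟩
      suc (sj + se) + (26 + 6 * sb) ∎
      where
      sb = size nat b
      sj = size nat j
      se = size (list triple) es
      sc = size nat (cap b j)
      le : sc ≤ sb
      le = size-cap b j
      triple≤ : ∀ n → suc ((2 + sc) + suc (n + sc)) ≤ suc ((2 + sb) + suc (n + sb))
      triple≤ n = s≤s (+-mono-≤ (+-monoʳ-≤ 2 le) (s≤s (+-monoʳ-≤ n le)))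

  PT-instanceOf : ∀ {ρ b es₀ zs} → PT k ρ nat b → PT k ρ (list triple) es₀ → PT k ρ (list nat) zs →
                  PT k ρ (list (fin 2)) (λ r → instanceOf (b r) (es₀ r) (zs r))
  PT-instanceOf pb pes pzs = PT-encode ∙ PT-∷ ∙ ((PT-suc ∙ s ▵ s ▵ PT-const 0) ▵ PT-descend pb pes pzs)
    where
    s = PT-+ (PT-length ∙ pzs) pb

  PT-labels : ∀ {j} → PT k (list (fin j)) (list nat) (map toℕ)
  PT-labels = PT-map (PT-toℕ ∙ PT-proj₂) (PT-const {τ = unit} tt) PT-id

-- The two implications

labels<k : ∀ {k} (w : List (Fin k)) → All (_< k) (map toℕ w)
labels<k w = All.map⁺ (All.tabulate λ {i} _ → toℕ<n i)

DAGRP⇒InP : ∀ {k} {L : Language k} → InDAGRP k L → InP k L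
DAGRP⇒InP {k} {L} inD with InP⇒PT k inD
-- With base vertex 0 and no further edges the graph is the bare path labelled `w`, whose only yield
-- from top to bottom is `w`.
... | χ , p , χ⇔ = PT⇒InP (p ∙ PT-instanceOf (PT-const 0) (PT-const []) PT-labels) λ w →
    let module R = Equivalence (instanceOf-reach {zs = map toℕ w} {L} [] [] [] (labels<k w))
        module C = Equivalence (χ⇔ (instanceOf 0 [] (map toℕ w)))
    in mk⇔ (λ eq → accepted w (R.to (C.to eq)))
           (λ l → C.from (R.from (w , ([] , sym (List.++-identityʳ _) , nil) , l)))
  where
  accepted : ∀ w → ∃[ ys ] (∃[ us ] map toℕ ys ≡ map toℕ w ++ us × Walk [] 0 0 us) × L ys → L w
  accepted w (ys , ([] , eq , nil) , l) =
    subst L (List.map-injective toℕ-injective (trans eq (List.++-identityʳ _))) l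

InNP⇒InP : P≡DAGR-P → ∀ {k} {L : Language k} → InNP k L → InP k L
InNP⇒InP P≡D {k} {L} (V , inP , c , d , verifies) with InP⇒PT k (Equivalence.to (P≡D (3 + k) V) inP)
-- The branching vertex `suc (bound w)` is the least number above the chain from 0 to `bound w`, so
-- the arguments `≤-refl` supply `p < b`.
... | χ , p , χ⇔ = PT⇒InP (p ∙ PT-instanceOf PT-b (PT-tailEdges (λ w → n≤1+n (bound w)) PT-b PT-bound) PT-zs) λ w →
    let module R = Equivalence (instanceOf-reach {zs = zs w} {V} (tail-decreasing ≤-refl) (tail-source ≤-refl)
                                  (tail-label (bound w)) (labels<k (map (3 ↑ʳ_) w)))
        module C = Equivalence (χ⇔ (instanceOf (suc (bound w)) (tailEdges (suc (bound w)) (bound w)) (zs w)))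
        module N = Equivalence (verifies w)
    in mk⇔ (λ eq → N.from (certificate w (R.to (C.to eq)))) (λ l → C.from (R.from (path w (N.to l))))
  where
  bound : List (Fin k) → ℕ
  bound w = c * length w ^ d + c
  zs : List (Fin k) → List ℕ
  zs w = map toℕ (map (3 ↑ʳ_) w)
  Reached : List (Fin k) → Set
  Reached w = ∃[ ys ] (∃[ us ] map toℕ ys ≡ zs w ++ us × Walk (tailEdges (suc (bound w)) (bound w)) (suc (bound w)) 0 us) × V ys

  PT-bound : PT k (list (fin k)) nat bound
  PT-bound = PT-+ (PT-* (PT-const c) (PT-^ d PT-length)) (PT-const c)
  PT-b : PT k (list (fin k)) nat (λ w → suc (bound w))
  PT-b = PT-suc ∙ PT-bound
  PT-zs : PT k (list (fin k)) (list nat) zs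
  PT-zs = PT-labels ∙ PT-map (PT-table (3 ↑ʳ_) ∙ PT-proj₂) (PT-const {τ = unit} tt) PT-id

  certificate : ∀ w → Reached w → ∃[ y ] length y ≤ bound w × V (pairEnc w y)
  certificate w (ys , (us , eq , walk) , v) with Equivalence.to (tail-walk ≤-refl) walk
  ... | y , le , refl = y , le ,
    subst V (List.map-injective toℕ-injective (trans eq (sym (map-toℕ-pairEnc w y)))) v
  path : ∀ w → ∃[ y ] length y ≤ bound w × V (pairEnc w y) → Reached w
  path w (y , le , v) = pairEnc w y ,
    (_ , map-toℕ-pairEnc w y , Equivalence.from (tail-walk ≤-refl) (y , le , refl)) , v

P≡DAGR-P⇒P≡NP : P≡DAGR-P → P≡NP
P≡DAGR-P⇒P≡NP P≡D k L = mk⇔ InP⇒InNP (InNP⇒InP P≡D)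

P≡NP⇒P≡DAGR-P : P≡NP → P≡DAGR-P
P≡NP⇒P≡DAGR-P P≡N k L =
  mk⇔ (λ inP → Equivalence.from (P≡N 2 (DAGREACH k L)) (DAGREACH-InNP inP)) DAGRP⇒InP

theorem10 : (¬ P≡DAGR-P) ⇔ (¬ P≡NP)
theorem10 = mk⇔ (λ P≢D P≡N → P≢D (P≡NP⇒P≡DAGR-P P≡N)) (λ P≢N P≡D → P≢N (P≡DAGR-P⇒P≡NP P≡D))
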